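{- There is an absolute constant $c>0$ such that every connected vertex-transitive graph on $n\geq 3$ vertices contains a cycle of length at least $c\, n^{13/21}$.
   Context: The paper states this as "a cycle of length at least $\Omega(n^{13/21})$"; graphs are finite and simple, and the length of a cycle is its number of edges (equivalently, vertices). -}

module Defs where

open import Data.Nat using (ℕ; zero; suc; _≤_)
open import Data.Fin using (Fin; zero; suc; inject₁; fromℕ)
open import Data.Bool using (Bool; true; false)
open import Data.Product using (Σ; _×_)
open import Function.Bundles using (_↔_; Inverse)
open import Function.Definitions using (Injective)
open import Relation.Binary.PropositionalEquality using (_≡_)

record Graph (n : ℕ) : Set where
  field
    adj    : Fin n → Fin n → Bool
    sym    : ∀ u v → adj u v ≡ adj v u
    irrefl : ∀ v → adj v v ≡ false

open Graph public

Adj : ∀ {n} → Graph n → Fin n → Fin n → Set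
Adj G u v = adj G u v ≡ true

data Walk {n : ℕ} (G : Graph n) : Fin n → Fin n → Set where
  nil  : ∀ {u} → Walk G u u
  cons : ∀ {u v w} → Adj G u v → Walk G v w → Walk G u w

Connected : ∀ {n} → Graph n → Set
Connected {n} G = (u v : Fin n) → Walk G u v

IsAutomorphism : ∀ {n} → Graph n → (Fin n ↔ Fin n) → Set
IsAutomorphism {n} G σ = (u v : Fin n) → adj G (Inverse.to σ u) (Inverse.to σ v) ≡ adj G u v

VertexTransitive : ∀ {n} → Graph n → Set
VertexTransitive {n} G =
  (u v : Fin n) → Σ (Fin n ↔ Fin n) λ σ → IsAutomorphism G σ × Inverse.to σ u ≡ v

HasCycleOfLength : ∀ {n} → Graph n → ℕ → Set
HasCycleOfLength {n} G L =
  Σ ℕ λ k → L ≡ suc k × 3 ≤ L ×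
  Σ (Fin (suc k) → Fin n) λ f →
    Injective _≡_ _≡_ f ×
    ((i : Fin k) → Adj G (f (inject₁ i)) (f (suc i))) ×
    Adj G (f (fromℕ k)) (f zero)

{-# OPTIONS --safe #-}
-- Let ℓ be the length of a longest cycle.  If C, D are cycles of length ℓ and a set Z of s vertices
-- separates them, then s ℓ ≥ n: otherwise, on average over the automorphism group, some translate of
-- C misses Z, so it lies on one side of Z and is disjoint from C or from D, whereas any two longest
-- cycles meet.  By Menger's theorem two such cycles with m common vertices are therefore joined by
-- k ≥ n / 2ℓ disjoint paths outside C ∩ D, unless already 2 m ℓ ≥ n.
--
-- The common vertices cut C and D into at most m + 1 segments each, and the k paths are the edges of
-- a bipartite graph between the segments of C and those of D.  A rerouting of C through segments of
-- D, together with the reverse rerouting of D through the same segments of C, would lengthen one of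
-- the cycles.  This excludes double edges, and 4-cycles and 6-cycles in which the paths attach to the
-- segments in certain orders.  Consider stars: an edge e = u v with two more edges f₁, f₂ at u and
-- g₁, g₂ at v.  A star is determined by the four outer segments and ten order relations, since two
-- stars that agree in these contain an excluded configuration.  So there are O(m⁴) stars, while a
-- graph with k edges has at least of the order of k⁵ / m⁴ of them; hence k⁵ = O(m⁸).
--
-- Some translate D of C has n m ≤ ℓ², and n¹³ = O(ℓ²¹) follows.

module Submission where

open import Defs hiding (sym)
open import Data.Nat using (ℕ; zero; suc; NonZero; >-nonZero; _+_; _*_; _∸_; _^_; _≤_; _<_; _<ᵇ_; ∣_-_∣; z≤n; s≤s)
open import Data.Nat.Properties
open import Data.Nat.DivMod
open import Data.Nat.Solver using (module +-*-Solver)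
open import Data.Fin as Fin using (Fin; zero; suc; #_)
open import Data.Fin.Properties using (any?; all?; inject≤-injective; injective⇒≤; toℕ-injective; toℕ-fromℕ<; toℕ-inject₁; toℕ-fromℕ; toℕ<n)
open import Data.Bool as Bool using (Bool; true; false; _∧_; _∨_; not; T)
open import Data.Unit using (tt)
open import Data.Product using (Σ; _×_; _,_; proj₁; proj₂; ∃; ∃-syntax)
open import Data.Sum using (_⊎_; inj₁; inj₂; [_,_]′)
open import Data.Empty using (⊥; ⊥-elim)
open import Data.List using (List; []; _∷_; _++_; length; map; filter; reverse; allFin; tabulate; lookup; cartesianProduct; cartesianProductWith; concatMap; take; drop; upTo; downFrom)
open import Data.List.Properties using (length-++; length-map; length-reverse; length-tabulate; length-take; length-drop; length-upTo; ++-identityʳ; unfold-reverse)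
open import Data.List.Membership.Propositional using (_∈_; _∉_; find; lose)
open import Data.List.Membership.Propositional.Properties
open import Data.List.Relation.Unary.Any as Any using (Any; here; there)
open import Data.List.Relation.Unary.Any.Properties using (reverse⁻)
open import Data.List.Relation.Unary.All using ([]; _∷_)
open import Data.List.Relation.Unary.All.Properties using (All¬⇒¬Any; ¬Any⇒All¬)
open import Data.List.Relation.Unary.AllPairs using ([]; _∷_)
open import Data.List.Relation.Unary.Unique.Propositional using (Unique)
import Data.List.Relation.Unary.Unique.Propositional.Properties as Unq
open import Data.List.Relation.Binary.Permutation.Propositional using (_↭_; ↭-refl; ↭-sym; ↭⇒↭ₛ)
open import Data.List.Relation.Binary.Permutation.Propositional.Properties using (↭-length; ++⁺ˡ; ++-comm)
import Data.List.Relation.Binary.Permutation.Setoid.Properties as ↭ₛ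
open import Data.Vec as Vec using (Vec)
open import Data.Vec.Properties using (lookup∘tabulate)
import Data.Vec.Properties as VecP
open import Relation.Binary using (Tri; tri<; tri≈; tri>)
open import Relation.Nullary.Decidable using (⌊_⌋; map′; _×-dec_; _→-dec_; ¬?)
open import Relation.Nullary using (¬_; Dec; yes; no; contradiction)
open import Relation.Binary.PropositionalEquality using (_≡_; _≢_; refl; sym; trans; cong; cong₂; subst; subst₂; setoid; module ≡-Reasoning)
open import Function using (_∘_; id; case_of_)
open import Function.Bundles using (Inverse)
open import Function.Definitions using (Injective)

-- The code of a star records only orders within that star, but an excluded hexagon on two centres
-- e, e′ needs two orders across stars: e against e′ must agree with g against g′ on C and with f
-- against f′ on D. This is why a star has two edges on each side. If two stars have the same code
-- and their centres lie in different columns, then g₁, g₁′, g₂, g₂′ form a 4-cycle, excluded unless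
-- its rows order the columns oppositely; so one of the rows agrees with e against e′. The same
-- holds for f₁, f₂, and these choices select the hexagon.
--
-- Two longest cycles meet because without common vertices each is a single segment and two disjoint
-- paths are a double edge; otherwise Menger gives a cut with at most one vertex and vertices on
-- both sides, impossible in a connected vertex-transitive graph. This also gives m ≥ 1, hence m + 1
-- ≤ 2 m.
--
-- With k ≥ n / 2ℓ and m ≤ ℓ² / n, the bound k⁵ = O(m⁸) turns into n⁵ / ℓ⁵ = O(ℓ¹⁶ / n⁸). If 2 m ℓ ≥
-- n instead, then n² ≤ 2 ℓ³, which is stronger.

-- Lists without repetition

unique-⊆-length : ∀ {A : Set} {xs ys : List A} → Unique xs → (∀ {z} → z ∈ xs → z ∈ ys) → length xs ≤ length ys
unique-⊆-length {xs = []} _ _ = z≤n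
unique-⊆-length {xs = x ∷ xs} {ys} (x∉ ∷ u) sub with ∈-∃++ (sub (here refl))
... | ys₁ , ys₂ , refl = begin
    suc (length xs)                  ≤⟨ s≤s (unique-⊆-length u inner) ⟩
    suc (length (ys₁ ++ ys₂))        ≡⟨ cong suc (length-++ ys₁) ⟩
    suc (length ys₁ + length ys₂)    ≡⟨ +-suc (length ys₁) (length ys₂) ⟨
    length ys₁ + suc (length ys₂)    ≡⟨ length-++ ys₁ ⟨
    length (ys₁ ++ x ∷ ys₂)          ∎
  where
  open ≤-Reasoning
  inner : ∀ {z} → z ∈ xs → z ∈ ys₁ ++ ys₂
  inner z∈ with ∈-++⁻ ys₁ (sub (there z∈))
  ... | inj₁ p         = ∈-++⁺ˡ p
  ... | inj₂ (here refl) = ⊥-elim (All¬⇒¬Any x∉ z∈)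
  ... | inj₂ (there p) = ∈-++⁺ʳ ys₁ p

unique-∷ : ∀ {A : Set} {x : A} {xs} → x ∉ xs → Unique xs → Unique (x ∷ xs)
unique-∷ x∉ u = ¬Any⇒All¬ _ x∉ ∷ u

unique-++ : ∀ {A : Set} {xs ys : List A} → Unique xs → Unique ys → (∀ {z} → z ∈ xs → z ∈ ys → ⊥) → Unique (xs ++ ys)
unique-++ u v d = Unq.++⁺ u v (λ (p , q) → d p q)

unique-reverse : ∀ {A : Set} {xs : List A} → Unique xs → Unique (reverse xs)
unique-reverse {xs = []} u = u
unique-reverse {xs = x ∷ xs} (x∉ ∷ u) = subst Unique (sym (unfold-reverse x xs))
  (unique-++ (unique-reverse u) ([] ∷ []) λ { p (here refl) → All¬⇒¬Any x∉ (reverse⁻ p) })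

-- Walks of a relation R.  The list of a Trail holds all its vertices, that of an Open only the
-- inner ones, and that of a HalfOpen all but the last one, so that a HalfOpen from u to u lists
-- the vertices of a closed walk once.
module Trails {V : Set} (R : V → V → Set) where

  data Trail : V → V → List V → Set where
    [_] : ∀ u → Trail u u (u ∷ [])
    _∷_ : ∀ {u v w xs} → R u v → Trail v w xs → Trail u w (u ∷ xs)

  data Open : V → V → List V → Set where
    [_] : ∀ {u v} → R u v → Open u v []
    _∷_ : ∀ {u v w xs} → R u v → Open v w xs → Open u w (v ∷ xs)

  data HalfOpen : V → V → List V → Set where
    [] : ∀ {u} → HalfOpen u u []
    _∷_ : ∀ {u v w xs} → R u v → HalfOpen v w xs → HalfOpen u w (u ∷ xs)

  private variable
    u v w z : V
    xs ys zs : List V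

  halfOpen : Open u v xs → HalfOpen u v (u ∷ xs)
  halfOpen [ r ]   = r ∷ []
  halfOpen (r ∷ o) = r ∷ halfOpen o

  _⊕_ : Trail u v xs → Open v w ys → HalfOpen u w (xs ++ ys)
  [ _ ]   ⊕ o = halfOpen o
  (r ∷ t) ⊕ o = r ∷ (t ⊕ o)

  _⊙_ : HalfOpen u v xs → HalfOpen v w ys → HalfOpen u w (xs ++ ys)
  []      ⊙ k = k
  (r ∷ h) ⊙ k = r ∷ (h ⊙ k)

  glue : R z u → Trail u v xs → Open v w ys → Open z w (xs ++ ys)
  glue r [ _ ]   o = r ∷ o
  glue r (s ∷ t) o = r ∷ glue s t o

  join : Open z u zs → Trail u v xs → Open v w ys → Open z w (zs ++ xs ++ ys)
  join [ r ]   t o = glue r t o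
  join (r ∷ p) t o = r ∷ join p t o

  trail-snoc : Trail u v xs → R v w → Trail u w (xs ++ w ∷ [])
  trail-snoc [ u ]   r = r ∷ [ _ ]
  trail-snoc (s ∷ t) r = s ∷ trail-snoc t r

  open-snoc : Open u v xs → R v w → Open u w (xs ++ v ∷ [])
  open-snoc [ s ]   r = s ∷ [ r ]
  open-snoc (s ∷ t) r = s ∷ open-snoc t r

  trail-last∈ : Trail u v xs → v ∈ xs
  trail-last∈ [ u ]   = here refl
  trail-last∈ (_ ∷ t) = there (trail-last∈ t)

  trail-head∈ : Trail u v xs → u ∈ xs
  trail-head∈ [ u ]   = here refl
  trail-head∈ (_ ∷ t) = here refl

  module Sym (R-sym : ∀ {u v} → R u v → R v u) where

    trail-reverse : Trail u v xs → Trail v u (reverse xs)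
    trail-reverse [ u ] = [ u ]
    trail-reverse {u} (_∷_ {xs = xs} r t) =
      subst (Trail _ u) (sym (unfold-reverse u xs)) (trail-snoc (trail-reverse t) (R-sym r))

    open-reverse : Open u v xs → Open v u (reverse xs)
    open-reverse [ r ] = [ R-sym r ]
    open-reverse {u} (_∷_ {v = v} {xs = xs} r t) =
      subst (Open _ u) (sym (unfold-reverse v xs)) (open-snoc (open-reverse t) (R-sym r))

-- Boolean vertex sets and their sizes

el : ∀ {n} → (Fin n → Bool) → List (Fin n)
el χ = filter (λ v → χ v Bool.≟ true) (allFin _)

∣_∣ₛ : ∀ {n} → (Fin n → Bool) → ℕ
∣ χ ∣ₛ = length (el χ)

el-unique : ∀ {n} (χ : Fin n → Bool) → Unique (el χ)
el-unique χ = Unq.filter⁺ _ (Unq.allFin⁺ _)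

∈-el⁺ : ∀ {n} (χ : Fin n → Bool) {v} → χ v ≡ true → v ∈ el χ
∈-el⁺ χ p = ∈-filter⁺ _ (∈-allFin _) p

∈-el⁻ : ∀ {n} (χ : Fin n → Bool) {v} → v ∈ el χ → χ v ≡ true
∈-el⁻ χ p = proj₂ (∈-filter⁻ (λ v → χ v Bool.≟ true) {xs = allFin _} p)

lookup-injective : ∀ {A : Set} {xs : List A} → Unique xs → ∀ {i j} → lookup xs i ≡ lookup xs j → i ≡ j
lookup-injective (_ ∷ _)  {zero}  {zero}  _ = refl
lookup-injective (x∉ ∷ _) {zero}  {suc j} p = ⊥-elim (All¬⇒¬Any x∉ (subst (_∈ _) (sym p) (∈-lookup j)))
lookup-injective (x∉ ∷ _) {suc i} {zero}  p = ⊥-elim (All¬⇒¬Any x∉ (subst (_∈ _) p (∈-lookup i)))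
lookup-injective (_ ∷ u)  {suc i} {suc j} p = cong suc (lookup-injective u p)

unique-++⁻ˡ : ∀ {A : Set} (xs : List A) {ys} → Unique (xs ++ ys) → Unique xs
unique-++⁻ˡ []       _        = []
unique-++⁻ˡ (x ∷ xs) (x∉ ∷ u) = unique-∷ (λ p → All¬⇒¬Any x∉ (∈-++⁺ˡ p)) (unique-++⁻ˡ xs u)

unique-resp-↭ : ∀ {A : Set} {xs ys : List A} → xs ↭ ys → Unique xs → Unique ys
unique-resp-↭ p = ↭ₛ.Unique-resp-↭ (setoid _) (↭⇒↭ₛ p)

∈⇒0< : ∀ {A : Set} {x : A} {xs} → x ∈ xs → 0 < length xs
∈⇒0< (here _)  = s≤s z≤n
∈⇒0< (there _) = s≤s z≤n

∨-true⁻ : ∀ {a b} → a ∨ b ≡ true → a ≡ true ⊎ b ≡ true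
∨-true⁻ {true}  _ = inj₁ refl
∨-true⁻ {false} p = inj₂ p

∨-trueˡ : ∀ {a} b → a ≡ true → a ∨ b ≡ true
∨-trueˡ _ refl = refl

∨-trueʳ : ∀ a {b} → b ≡ true → a ∨ b ≡ true
∨-trueʳ true  _ = refl
∨-trueʳ false p = p

∧-true⁻ : ∀ {a b} → a ∧ b ≡ true → a ≡ true × b ≡ true
∧-true⁻ {true} p = refl , p

∧-true⁺ : ∀ {a b} → a ≡ true → b ≡ true → a ∧ b ≡ true
∧-true⁺ refl p = p

true≢false : ∀ {b} → b ≡ true → b ≡ false → ⊥
true≢false refl ()

≢true : ∀ {b} → ¬ b ≡ true → b ≡ false
≢true {false} _ = refl
≢true {true}  p = ⊥-elim (p refl)

is : ∀ {n} → Fin n → Fin n → Bool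
is x v = ⌊ v Fin.≟ x ⌋

is-refl : ∀ {n} (x : Fin n) → is x x ≡ true
is-refl x with x Fin.≟ x
... | yes _ = refl
... | no ¬p = ⊥-elim (¬p refl)

is⁻ : ∀ {n} (x v : Fin n) → is x v ≡ true → v ≡ x
is⁻ x v p with v Fin.≟ x
... | yes q = q
is⁻ x v () | no _

∣∣-mono : ∀ {n} (χ ψ : Fin n → Bool) → (∀ v → χ v ≡ true → ψ v ≡ true) → ∣ χ ∣ₛ ≤ ∣ ψ ∣ₛ
∣∣-mono χ ψ sub = unique-⊆-length (el-unique χ) λ z∈ → ∈-el⁺ ψ (sub _ (∈-el⁻ χ z∈))

∣∨is∣ : ∀ {n} (χ : Fin n → Bool) x → ∣ (λ v → χ v ∨ is x v) ∣ₛ ≤ suc ∣ χ ∣ₛ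
∣∨is∣ χ x = unique-⊆-length {ys = x ∷ el χ} (el-unique _) λ {z} z∈ →
  [ (λ p → there (∈-el⁺ χ p)) , (λ p → here (is⁻ x z p)) ]′ (∨-true⁻ (∈-el⁻ (λ v → χ v ∨ is x v) z∈))

-- Pigeonhole: a value `t` that is missed would make k + 1 distinct members of `χ`. In Menger's
-- theorem this shows that every vertex of an enlarged separator is an end of some path.
injective-onto : ∀ {n k} (χ : Fin n → Bool) (f : Fin k → Fin n) → (∀ {i j} → f i ≡ f j → i ≡ j) →
  (∀ i → χ (f i) ≡ true) → ∣ χ ∣ₛ ≤ k → ∀ t → χ t ≡ true → ∃[ i ] f i ≡ t
injective-onto {k = k} χ f inj f∈ small t t∈ with any? (λ i → f i Fin.≟ t)
... | yes p = p
... | no ¬p = contradiction (≤-trans (unique-⊆-length unique sub) small) (<⇒≱ (≤-reflexive (cong suc (sym (length-tabulate f)))))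
  where
  unique : Unique (t ∷ tabulate f)
  unique = unique-∷ (λ t∈ → ¬p (Data.Product.map₂ sym (∈-tabulate⁻ t∈))) (Unq.tabulate⁺ inj)
  sub : ∀ {z} → z ∈ t ∷ tabulate f → z ∈ el χ
  sub (here refl) = ∈-el⁺ χ t∈
  sub (there p) with ∈-tabulate⁻ p
  ... | i , refl = ∈-el⁺ χ (f∈ i)

-- Menger's theorem for directed graphs given by edge lists

module Menger {n : ℕ} where

  V : Set
  V = Fin n

  Edge : List (V × V) → V → V → Set
  Edge E x y = (x , y) ∈ E

  record Linkage (E : List (V × V)) (A B : V → Bool) (k : ℕ) : Set where
    field
      src tgt  : Fin k → V
      vertices : Fin k → List V
      trail    : ∀ i → Trails.Trail (Edge E) (src i) (tgt i) (vertices i)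
      src∈     : ∀ i → A (src i) ≡ true
      tgt∈     : ∀ i → B (tgt i) ≡ true
      unique   : ∀ i → Unique (vertices i)
      disjoint : ∀ {i j z} → z ∈ vertices i → z ∈ vertices j → i ≡ j

    src-injective : ∀ {i j} → src i ≡ src j → i ≡ j
    src-injective {i} {j} p = disjoint (Trails.trail-head∈ _ (trail i))
      (subst (_∈ vertices j) (sym p) (Trails.trail-head∈ _ (trail j)))

    tgt-injective : ∀ {i j} → tgt i ≡ tgt j → i ≡ j
    tgt-injective {i} {j} p = disjoint (Trails.trail-last∈ _ (trail i))
      (subst (_∈ vertices j) (sym p) (Trails.trail-last∈ _ (trail j)))

  -- Paths run from `A` to `B`, so `noEdge` forbids only edges from outside `Y` to outside `X`;
  -- edges in the opposite direction are harmless.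
  record Separation (E : List (V × V)) (A B : V → Bool) (k : ℕ) : Set where
    field
      X Y    : V → Bool
      A⊆X    : ∀ v → A v ≡ true → X v ≡ true
      B⊆Y    : ∀ v → B v ≡ true → Y v ≡ true
      cover  : ∀ v → X v ≡ true ⊎ Y v ≡ true
      noEdge : ∀ {x y} → (x , y) ∈ E → Y x ≡ false → X y ≡ true
      order  : ∣ (λ v → X v ∧ Y v) ∣ₛ < k

  module _ {E : List (V × V)} {e : V × V} where
    open Trails

    weaken : ∀ {u v xs} → Trail (Edge E) u v xs → Trail (Edge (e ∷ E)) u v xs
    weaken [ u ]   = [ u ]
    weaken (r ∷ t) = there r ∷ weaken t

  -- A path meeting T ⊇ X ∩ Y in an endpoint only cannot change sides.
  module _ {E : List (V × V)} {X Y T : V → Bool}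
           (cover : ∀ v → X v ≡ true ⊎ Y v ≡ true)
           (noEdge : ∀ {x y} → (x , y) ∈ E → Y x ≡ false → X y ≡ true)
           (S⊆T : ∀ v → X v ≡ true → Y v ≡ true → T v ≡ true) where
    open Trails (Edge E)

    private
      Y-false : ∀ {v} → X v ≡ true → T v ≡ false → Y v ≡ false
      Y-false p q = ≢true λ r → true≢false (S⊆T _ p r) q

      X-false : ∀ {v} → Y v ≡ true → T v ≡ false → X v ≡ false
      X-false p q = ≢true λ r → true≢false (S⊆T _ r p) q

    stays-left : ∀ {u v xs} → Trail u v xs → Unique xs → X u ≡ true →
      (∀ {z} → z ∈ xs → z ≢ v → T z ≡ false) → ∀ {z} → z ∈ xs → z ≢ v → Y z ≡ false
    stays-left [ u ] _ _ _ (here refl) z≢ = ⊥-elim (z≢ refl)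
    stays-left (r ∷ t) (u∉ ∷ un) Xu out (here refl) z≢ = Y-false Xu (out (here refl) z≢)
    stays-left (r ∷ t) (u∉ ∷ un) Xu out (there z∈) z≢ =
      stays-left t un (noEdge r (Y-false Xu (out (here refl) u≢))) (λ p → out (there p)) z∈ z≢
      where
      u≢ : _
      u≢ refl = All¬⇒¬Any u∉ (trail-last∈ t)

    stays-right : ∀ {u v xs} → Trail u v xs → Unique xs → Y v ≡ true →
      (∀ {z} → z ∈ xs → z ≢ u → T z ≡ false) → ∀ {z} → z ∈ xs → Y z ≡ true
    stays-right [ u ] _ Yv _ (here refl) = Yv
    stays-right {u} (_∷_ {v = w} r t) (u∉ ∷ un) Yv out = λ where
        (here refl) → Yu
        (there z∈)  → rec z∈
      where
      rec : ∀ {z} → z ∈ _ → Y z ≡ true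
      rec = stays-right t un Yv λ z∈ _ → out (there z∈) λ { refl → All¬⇒¬Any u∉ z∈ }
      w≢u : w ≢ u
      w≢u refl = All¬⇒¬Any u∉ (trail-head∈ t)
      Yu : Y u ≡ true
      Yu with Y u in eq
      ... | true  = refl
      ... | false = ⊥-elim (true≢false (noEdge r eq) (X-false (rec (trail-head∈ t)) (out (there (trail-head∈ t)) w≢u)))

  open Trails

  trail-init : ∀ {R : V → V → Set} {u v xs} → Trail R u v xs → ∃[ ys ] (HalfOpen R u v ys × xs ≡ ys ++ v ∷ [])
  trail-init [ u ] = [] , [] , refl
  trail-init {u = u} (r ∷ t) with trail-init t
  ... | ys , h , refl = u ∷ ys , r ∷ h , refl

  extend : ∀ {R : V → V → Set} {u v w xs} → Trail R u v xs → R v w → HalfOpen R u w xs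
  extend [ u ]   s = s ∷ []
  extend (r ∷ t) s = r ∷ extend t s

  prepend : ∀ {R : V → V → Set} {u v w xs ys} → HalfOpen R u v xs → Trail R v w ys → Trail R u w (xs ++ ys)
  prepend []      t = t
  prepend (r ∷ h) t = r ∷ prepend h t

  unique-init : ∀ {v : V} ys → Unique (ys ++ v ∷ []) → Unique ys × v ∉ ys
  unique-init [] _ = [] , λ ()
  unique-init {v} (y ∷ ys) (y∉ ∷ u) with unique-init ys u
  ... | u′ , v∉ = unique-∷ (λ p → All¬⇒¬Any y∉ (∈-++⁺ˡ p)) u′ ,
    λ { (here refl) → All¬⇒¬Any y∉ (∈-++⁺ʳ ys (here refl)) ; (there p) → v∉ p }

  -- Göring's induction on the edges: a separation (X , Y) of the graph without the edge x → y is
  -- crossed by that edge only, and the linkages from A to (X ∩ Y) ∪ {x} and from (X ∩ Y) ∪ {y} to B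
  -- meet in X ∩ Y only.
  module Step {E : List (V × V)} {x y : V} {A B : V → Bool} {k : ℕ} (sep : Separation E A B k)
              (Yx : Separation.Y sep x ≡ false) (Xy : Separation.X sep y ≡ false) where
    open Separation sep

    S T₁ T₂ : V → Bool
    S v  = X v ∧ Y v
    T₁ v = S v ∨ is x v
    T₂ v = S v ∨ is y v

    S⊆T₁ : ∀ v → X v ≡ true → Y v ≡ true → T₁ v ≡ true
    S⊆T₁ v p q = ∨-trueˡ _ (∧-true⁺ p q)

    S⊆T₂ : ∀ v → X v ≡ true → Y v ≡ true → T₂ v ≡ true
    S⊆T₂ v p q = ∨-trueˡ _ (∧-true⁺ p q)

    -- `T₁` contains the old separator and the tail of the new edge, so whatever separates `A` from
    -- `T₁` separates `A` from `B`. The new middle lies in that of `s`, because a vertex in both `X`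
    -- and `Y` belongs to `T₁` and thus to `s.Y`.
    separation₁ : Separation E A T₁ k → Separation ((x , y) ∷ E) A B k
    separation₁ s = record
      { X = λ v → X v ∧ s.X v
      ; Y = λ v → Y v ∨ s.Y v
      ; A⊆X = λ v p → ∧-true⁺ (A⊆X v p) (s.A⊆X v p)
      ; B⊆Y = λ v p → ∨-trueˡ _ (B⊆Y v p)
      ; cover = cov
      ; noEdge = ne
      ; order = ≤-<-trans (∣∣-mono _ _ sub) s.order }
      where
      module s = Separation s
      cov : ∀ v → X v ∧ s.X v ≡ true ⊎ Y v ∨ s.Y v ≡ true
      cov v with cover v | s.cover v
      ... | inj₂ p | _      = inj₂ (∨-trueˡ _ p)
      ... | inj₁ _ | inj₂ q = inj₂ (∨-trueʳ (Y v) q)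
      ... | inj₁ p | inj₁ q = inj₁ (∧-true⁺ p q)
      ne : ∀ {p q} → (p , q) ∈ (x , y) ∷ E → Y p ∨ s.Y p ≡ false → X q ∧ s.X q ≡ true
      ne {p} r eq with Y p in e₁
      ne (here refl) eq | false = ⊥-elim (true≢false (s.B⊆Y x (∨-trueʳ (S x) (is-refl x))) eq)
      ne (there r) eq | false = ∧-true⁺ (noEdge r e₁) (s.noEdge r eq)
      sub : ∀ v → (X v ∧ s.X v) ∧ (Y v ∨ s.Y v) ≡ true → s.X v ∧ s.Y v ≡ true
      sub v p with ∧-true⁻ {X v ∧ s.X v} p
      ... | q , r with ∧-true⁻ {X v} q | ∨-true⁻ {Y v} r
      ... | a , b | inj₁ c = ∧-true⁺ b (s.B⊆Y v (S⊆T₁ v a c))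
      ... | a , b | inj₂ c = ∧-true⁺ b c

    separation₂ : Separation E T₂ B k → Separation ((x , y) ∷ E) A B k
    separation₂ s = record
      { X = λ v → X v ∨ s.X v
      ; Y = λ v → Y v ∧ s.Y v
      ; A⊆X = λ v p → ∨-trueˡ _ (A⊆X v p)
      ; B⊆Y = λ v p → ∧-true⁺ (B⊆Y v p) (s.B⊆Y v p)
      ; cover = cov
      ; noEdge = ne
      ; order = ≤-<-trans (∣∣-mono _ _ sub) s.order }
      where
      module s = Separation s
      cov : ∀ v → X v ∨ s.X v ≡ true ⊎ Y v ∧ s.Y v ≡ true
      cov v with cover v | s.cover v
      ... | inj₁ p | _      = inj₁ (∨-trueˡ _ p)
      ... | inj₂ _ | inj₁ q = inj₁ (∨-trueʳ (X v) q)
      ... | inj₂ p | inj₂ q = inj₂ (∧-true⁺ p q)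
      ne : ∀ {p q} → (p , q) ∈ (x , y) ∷ E → Y p ∧ s.Y p ≡ false → X q ∨ s.X q ≡ true
      ne (here refl) eq = ∨-trueʳ (X y) (s.A⊆X y (∨-trueʳ (S y) (is-refl y)))
      ne {p} (there r) eq with Y p in e₁
      ... | false = ∨-trueˡ _ (noEdge r e₁)
      ... | true  = ∨-trueʳ (X _) (s.noEdge r eq)
      sub : ∀ v → (X v ∨ s.X v) ∧ (Y v ∧ s.Y v) ≡ true → s.X v ∧ s.Y v ≡ true
      sub v p with ∧-true⁻ {X v ∨ s.X v} p
      ... | q , r with ∧-true⁻ {Y v} r | ∨-true⁻ {X v} q
      ... | a , b | inj₁ c = ∧-true⁺ (s.A⊆X v (S⊆T₂ v c a)) b
      ... | a , b | inj₂ c = ∧-true⁺ c b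

    module _ (𝒫 : Linkage E A T₁ k) (𝒬 : Linkage E T₂ B k) where
      private
        module P = Linkage 𝒫
        module Q = Linkage 𝒬

      P-onto : ∀ t → T₁ t ≡ true → ∃[ i ] P.tgt i ≡ t
      P-onto = injective-onto T₁ P.tgt P.tgt-injective P.tgt∈ (≤-trans (∣∨is∣ S x) order)

      Q-onto : ∀ t → T₂ t ≡ true → ∃[ i ] Q.src i ≡ t
      Q-onto = injective-onto T₂ Q.src Q.src-injective Q.src∈ (≤-trans (∣∨is∣ S y) order)

      -- Every vertex of `T₁` ends one of the paths, and the paths are disjoint; so none of them
      -- meets `T₁` before its end.
      P-left : ∀ i {z} → z ∈ P.vertices i → z ≢ P.tgt i → Y z ≡ false
      P-left i = stays-left cover noEdge S⊆T₁ (P.trail i) (P.unique i) (A⊆X _ (P.src∈ i)) out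
        where
        out : ∀ {z} → z ∈ P.vertices i → z ≢ P.tgt i → T₁ z ≡ false
        out z∈ z≢ = ≢true λ t → case P-onto _ t of λ where
          (j , refl) → z≢ (cong P.tgt (P.disjoint (trail-last∈ _ (P.trail j)) z∈))

      Q-right : ∀ i {z} → z ∈ Q.vertices i → Y z ≡ true
      Q-right i = stays-right cover noEdge S⊆T₂ (Q.trail i) (Q.unique i) (B⊆Y _ (Q.tgt∈ i)) out
        where
        out : ∀ {z} → z ∈ Q.vertices i → z ≢ Q.src i → T₂ z ≡ false
        out z∈ z≢ = ≢true λ t → case Q-onto _ t of λ where
          (j , refl) → z≢ (cong Q.src (Q.disjoint (trail-head∈ _ (Q.trail j)) z∈))

      -- A path ending in `S` gives up its last vertex, with which a path of `𝒬` begins; the path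
      -- ending in `x` keeps it and takes the new edge to `y`. Either way the listed vertices avoid
      -- `Y`, while those of `𝒬` lie in `Y`.
      record Prefix (i : Fin k) : Set where
        field
          end      : V
          vertices : List V
          path     : HalfOpen (Edge ((x , y) ∷ E)) (P.src i) end vertices
          unique   : Unique vertices
          ⊆P       : ∀ {z} → z ∈ vertices → z ∈ P.vertices i
          left     : ∀ {z} → z ∈ vertices → Y z ≡ false
          end∈     : T₂ end ≡ true
          endIs    : (S end ≡ true × P.tgt i ≡ end) ⊎ (end ≡ y × P.tgt i ≡ x)

      prefix : ∀ i → Prefix i
      prefix i with S (P.tgt i) in eq
      ... | true with trail-init (weaken (P.trail i)) | P.unique i | P-left i
      ... | ys , h , vs≡ | u | l = record
        { end = P.tgt i ; vertices = ys ; path = h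
        ; unique = proj₁ (unique-init ys u′)
        ; ⊆P = ⊆P
        ; left = λ z∈ → l (⊆P z∈) λ { refl → proj₂ (unique-init ys u′) z∈ }
        ; end∈ = ∨-trueˡ _ eq ; endIs = inj₁ (eq , refl) }
        where
        u′ : Unique (ys ++ P.tgt i ∷ [])
        u′ = subst Unique vs≡ u
        ⊆P : ∀ {z} → z ∈ ys → z ∈ P.vertices i
        ⊆P z∈ = subst (_ ∈_) (sym vs≡) (∈-++⁺ˡ z∈)
      prefix i | false = record
        { end = y ; vertices = P.vertices i
        ; path = extend (weaken (P.trail i)) (here (cong (_, y) tgt≡x))
        ; unique = P.unique i ; ⊆P = id ; left = left
        ; end∈ = ∨-trueʳ (S y) (is-refl y) ; endIs = inj₂ (refl , tgt≡x) }
        where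
        tgt≡x : P.tgt i ≡ x
        tgt≡x with ∨-true⁻ {S (P.tgt i)} (P.tgt∈ i)
        ... | inj₁ p = ⊥-elim (true≢false p eq)
        ... | inj₂ p = is⁻ x _ p
        left : ∀ {z} → z ∈ P.vertices i → Y z ≡ false
        left {z} z∈ with z Fin.≟ P.tgt i
        ... | yes refl = subst (λ v → Y v ≡ false) (sym tgt≡x) Yx
        ... | no z≢    = P-left i z∈ z≢

      module Pre i = Prefix (prefix i)

      y∉S : S y ≡ true → ⊥
      y∉S p = true≢false (proj₁ (∧-true⁻ {X y} p)) Xy

      end-injective : ∀ {i j} → Pre.end i ≡ Pre.end j → i ≡ j
      end-injective {i} {j} p with Pre.endIs i | Pre.endIs j
      ... | inj₁ (_ , q)  | inj₁ (_ , r)  = P.tgt-injective (trans q (trans p (sym r)))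
      ... | inj₂ (_ , q)  | inj₂ (_ , r)  = P.tgt-injective (trans q (sym r))
      ... | inj₁ (s , _)  | inj₂ (e , _)  = ⊥-elim (y∉S (subst (λ v → S v ≡ true) (trans p e) s))
      ... | inj₂ (e , _)  | inj₁ (s , _)  = ⊥-elim (y∉S (subst (λ v → S v ≡ true) (trans (sym p) e) s))

      σ : Fin k → Fin k
      σ i = proj₁ (Q-onto (Pre.end i) (Pre.end∈ i))

      σ-src : ∀ i → Q.src (σ i) ≡ Pre.end i
      σ-src i = proj₂ (Q-onto (Pre.end i) (Pre.end∈ i))

      linkage : Linkage ((x , y) ∷ E) A B k
      linkage = record
        { src = P.src ; tgt = λ i → Q.tgt (σ i)
        ; vertices = λ i → Pre.vertices i ++ Q.vertices (σ i)
        ; trail = λ i → prepend (Pre.path i)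
            (subst (λ v → Trail _ v (Q.tgt (σ i)) (Q.vertices (σ i))) (σ-src i) (weaken (Q.trail (σ i))))
        ; src∈ = P.src∈ ; tgt∈ = λ i → Q.tgt∈ (σ i)
        ; unique = λ i → unique-++ (Pre.unique i) (Q.unique (σ i)) λ p q → true≢false (Q-right (σ i) q) (Pre.left i p)
        ; disjoint = disj }
        where
        disj : ∀ {i j z} → z ∈ Pre.vertices i ++ Q.vertices (σ i) → z ∈ Pre.vertices j ++ Q.vertices (σ j) → i ≡ j
        disj {i} {j} p q with ∈-++⁻ (Pre.vertices i) p | ∈-++⁻ (Pre.vertices j) q
        ... | inj₁ p | inj₁ q = P.disjoint (Pre.⊆P i p) (Pre.⊆P j q)
        ... | inj₁ p | inj₂ q = ⊥-elim (true≢false (Q-right (σ j) q) (Pre.left i p))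
        ... | inj₂ p | inj₁ q = ⊥-elim (true≢false (Q-right (σ i) p) (Pre.left j q))
        ... | inj₂ p | inj₂ q = end-injective (trans (sym (σ-src i)) (trans (cong Q.src (Q.disjoint p q)) (σ-src j)))

  addEdge : ∀ {E x y A B k} (s : Separation E A B k) → Separation.Y s x ≡ true ⊎ Separation.X s y ≡ true →
    Separation ((x , y) ∷ E) A B k
  addEdge s p = record { Separation s hiding (noEdge) ; noEdge = λ where
      (here refl) eq → [ (λ q → ⊥-elim (true≢false q eq)) , id ]′ p
      (there r) eq → Separation.noEdge s r eq }

  menger : ∀ E A B k → Linkage E A B k ⊎ Separation E A B k
  menger [] A B k with k ≤? ∣ (λ v → A v ∧ B v) ∣ₛ
  ... | yes k≤ = inj₁ record
    { src = f ; tgt = f ; vertices = λ i → f i ∷ []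
    ; trail = λ i → [ f i ]
    ; src∈ = λ i → proj₁ (∧-true⁻ (f∈ i)) ; tgt∈ = λ i → proj₂ (∧-true⁻ {A (f i)} (f∈ i))
    ; unique = λ i → [] ∷ []
    ; disjoint = λ { (here refl) (here eq) → inject≤-injective _ _ _ _ (lookup-injective (el-unique _) eq) } }
    where
    f : Fin k → V
    f i = lookup (el (λ v → A v ∧ B v)) (Fin.inject≤ i k≤)
    f∈ : ∀ i → A (f i) ∧ B (f i) ≡ true
    f∈ i = ∈-el⁻ (λ v → A v ∧ B v) (∈-lookup (Fin.inject≤ i k≤))
  -- Without edges a path is a single vertex. Adding the complement of `A` to `B` makes the pair
  -- cover all vertices and leaves the vertices common to `A` and `B` as its middle.
  ... | no k≰ = inj₂ record
    { X = A ; Y = λ v → B v ∨ not (A v)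
    ; A⊆X = λ _ p → p ; B⊆Y = λ _ p → ∨-trueˡ _ p
    ; cover = cov
    ; noEdge = λ ()
    ; order = ≤-<-trans (∣∣-mono _ _ sub) (≰⇒> k≰) }
    where
    cov : ∀ v → A v ≡ true ⊎ B v ∨ not (A v) ≡ true
    cov v with A v
    ... | true  = inj₁ refl
    ... | false = inj₂ (∨-trueʳ (B v) refl)
    sub : ∀ v → A v ∧ (B v ∨ not (A v)) ≡ true → A v ∧ B v ≡ true
    sub v p with A v | B v
    ... | true | true = refl
  menger ((x , y) ∷ E) A B k with menger E A B k
  ... | inj₁ l = inj₁ record
    { Linkage l hiding (trail) ; trail = λ i → weaken (Linkage.trail l i) }
  -- The separation survives the new edge unless this runs from outside `Y` to outside `X`.
  ... | inj₂ s with Separation.Y s x in Yx | Separation.X s y in Xy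
  ... | true  | _     = inj₂ (addEdge s (inj₁ Yx))
  ... | false | true  = inj₂ (addEdge s (inj₂ Xy))
  ... | false | false with menger E A (Step.T₁ s Yx Xy) k | menger E (Step.T₂ s Yx Xy) B k
  ... | inj₂ s₁ | _       = inj₂ (Step.separation₁ s Yx Xy s₁)
  ... | inj₁ _  | inj₂ s₂ = inj₂ (Step.separation₂ s Yx Xy s₂)
  ... | inj₁ P  | inj₁ Q  = inj₁ (Step.linkage s Yx Xy P Q)

-- Cycles as closed walks and as periodic sequences

adj-sym : ∀ {n} (G : Graph n) {u v} → Adj G u v → Adj G v u
adj-sym G {u} {v} p = trans (Graph.sym G v u) p

adj-≢ : ∀ {n} (G : Graph n) {u v} → Adj G u v → u ≢ v
adj-≢ G {u} p refl = true≢false p (irrefl G u)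

module _ {n : ℕ} (G : Graph n) where
  open Trails (Adj G)

  halfOpen-lookup : ∀ {u w x xs} → HalfOpen u w (x ∷ xs) →
    u ≡ x ×
    ((i : Fin (length xs)) → Adj G (lookup (x ∷ xs) (Fin.inject₁ i)) (lookup (x ∷ xs) (suc i))) ×
    Adj G (lookup (x ∷ xs) (Fin.fromℕ (length xs))) w
  halfOpen-lookup (r ∷ []) = refl , (λ ()) , r
  halfOpen-lookup (r ∷ h@(_ ∷ _)) with halfOpen-lookup h
  ... | refl , step , last = refl , (λ { zero → r ; (suc i) → step i }) , last

  closed⇒cycle : ∀ {u xs} → HalfOpen u u xs → Unique xs → 3 ≤ length xs → HasCycleOfLength G (length xs)
  closed⇒cycle {xs = x ∷ xs} h un long with halfOpen-lookup h
  ... | refl , step , last =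
    length xs , refl , long , lookup (x ∷ xs) , lookup-injective un , step , last

-- Positions range over all natural numbers, so that an arc through position 0 is an interval like
-- any other; `distinct` states injectivity on every window of ℓ consecutive positions.
record Cyc {n : ℕ} (G : Graph n) (ℓ : ℕ) : Set where
  field
    at       : ℕ → Fin n
    step     : ∀ p → Adj G (at p) (at (suc p))
    periodic : ∀ p → at (p + ℓ) ≡ at p
    distinct : ∀ {p q} → p < q → q < p + ℓ → at p ≢ at q
    reduce   : ∀ p → ∃[ r ] (r < ℓ × at p ≡ at r)

  distinct′ : ∀ {p q} → p < ℓ → q < ℓ → at p ≡ at q → p ≡ q
  distinct′ {p} {q} p< q< eq with <-cmp p q
  ... | tri< a _ _ = ⊥-elim (distinct a (<-≤-trans q< (m≤n+m ℓ p)) eq)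
  ... | tri≈ _ b _ = b
  ... | tri> _ _ c = ⊥-elim (distinct c (<-≤-trans p< (m≤n+m ℓ q)) (sym eq))

module _ (k : ℕ) where
  private
    ℓ = suc k

  suc-% : ∀ p → (p % ℓ < k × suc p % ℓ ≡ suc (p % ℓ)) ⊎ (p % ℓ ≡ k × suc p % ℓ ≡ 0)
  suc-% p with p % ℓ <? k
  ... | yes r<k = inj₁ (r<k , (begin
        suc p % ℓ                       ≡⟨ cong (λ x → suc x % ℓ) (m≡m%n+[m/n]*n p ℓ) ⟩
        (suc (p % ℓ) + p / ℓ * ℓ) % ℓ   ≡⟨ [m+kn]%n≡m%n (suc (p % ℓ)) (p / ℓ) ℓ ⟩
        suc (p % ℓ) % ℓ                 ≡⟨ m<n⇒m%n≡m (s≤s r<k) ⟩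
        suc (p % ℓ)                     ∎))
    where open ≡-Reasoning
  ... | no r≮k = inj₂ (r≡k , (begin
        suc p % ℓ                       ≡⟨ cong (λ x → suc x % ℓ) (m≡m%n+[m/n]*n p ℓ) ⟩
        (suc (p % ℓ) + p / ℓ * ℓ) % ℓ   ≡⟨ cong (λ x → (suc x + p / ℓ * ℓ) % ℓ) r≡k ⟩
        (suc (p / ℓ) * ℓ) % ℓ           ≡⟨ m*n%n≡0 (suc (p / ℓ)) ℓ ⟩
        0                               ∎))
    where
    open ≡-Reasoning
    r≡k : p % ℓ ≡ k
    r≡k = ≤-antisym (m<1+n⇒m≤n (m%n<n p ℓ)) (≮⇒≥ r≮k)

  -- With equal remainders, p < q forces a larger quotient, hence q ≥ p + ℓ.
  %-distinct : ∀ {p q} → p < q → q < p + ℓ → p % ℓ ≢ q % ℓ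
  %-distinct {p} {q} p<q q<p+ℓ eq = <⇒≱ q<p+ℓ (begin
      p + ℓ                              ≡⟨ cong (_+ ℓ) (m≡m%n+[m/n]*n p ℓ) ⟩
      p % ℓ + p / ℓ * ℓ + ℓ              ≡⟨ +-assoc (p % ℓ) _ _ ⟩
      p % ℓ + (p / ℓ * ℓ + ℓ)            ≡⟨ cong₂ _+_ eq (+-comm (p / ℓ * ℓ) ℓ) ⟩
      q % ℓ + suc (p / ℓ) * ℓ            ≤⟨ +-monoʳ-≤ (q % ℓ) (*-monoˡ-≤ ℓ quot<) ⟩
      q % ℓ + q / ℓ * ℓ                  ≡⟨ m≡m%n+[m/n]*n q ℓ ⟨
      q                                  ∎)
    where
    open ≤-Reasoning
    quot< : p / ℓ < q / ℓ
    quot< = *-cancelʳ-< ℓ _ _ (+-cancelˡ-< (q % ℓ) _ _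
      (subst₂ _<_ (trans (m≡m%n+[m/n]*n p ℓ) (cong (_+ p / ℓ * ℓ) eq)) (m≡m%n+[m/n]*n q ℓ) p<q))

toCyc : ∀ {n} {G : Graph n} {ℓ} → HasCycleOfLength G ℓ → Cyc G ℓ
toCyc {n} {G} (k , refl , _ , f , inj , step , last) = record
  { at = at ; step = step′
  ; periodic = λ p → at-cong (p + suc k) p ([m+n]%n≡m%n p (suc k))
  ; distinct = λ {p} {q} p<q q< eq → %-distinct k p<q q< (at-inj p q eq)
  ; reduce = λ p → p % suc k , m%n<n p (suc k) , at-cong p (p % suc k) (sym (m%n%n≡m%n p (suc k))) }
  where
  idx : ℕ → Fin (suc k)
  idx p = Fin.fromℕ< (m%n<n p (suc k))
  at : ℕ → Fin n
  at p = f (idx p)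
  at-cong : ∀ p q → p % suc k ≡ q % suc k → at p ≡ at q
  at-cong p q eq = cong f (toℕ-injective (trans (toℕ-fromℕ< _) (trans eq (sym (toℕ-fromℕ< _)))))
  at-inj : ∀ p q → at p ≡ at q → p % suc k ≡ q % suc k
  at-inj p q eq = trans (sym (toℕ-fromℕ< _)) (trans (cong Fin.toℕ (inj eq)) (toℕ-fromℕ< _))
  step′ : ∀ p → Adj G (at p) (at (suc p))
  step′ p with suc-% k p
  ... | inj₁ (r<k , eq) = subst₂ (Adj G)
        (cong f (toℕ-injective (trans (toℕ-inject₁ _) (trans (toℕ-fromℕ< r<k) (sym (toℕ-fromℕ< _))))))
        (cong f (toℕ-injective (trans (cong suc (toℕ-fromℕ< r<k)) (trans (sym eq) (sym (toℕ-fromℕ< _))))))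
        (step (Fin.fromℕ< r<k))
  ... | inj₂ (r≡k , eq) = subst₂ (Adj G)
        (cong f (toℕ-injective (trans (toℕ-fromℕ k) (trans (sym r≡k) (sym (toℕ-fromℕ< _))))))
        (cong f (toℕ-injective (trans (sym eq) (sym (toℕ-fromℕ< _)))))
        last

-- Existence of a longest cycle

anyVec? : ∀ {n} k {P : Vec (Fin n) k → Set} → (∀ v → Dec (P v)) → Dec (∃ P)
anyVec? zero    P? = map′ (λ p → Vec.[] , p) (λ { (Vec.[] , p) → p }) (P? Vec.[])
anyVec? (suc k) P? = map′ (λ { (x , v , p) → x Vec.∷ v , p }) (λ { (x Vec.∷ v , p) → x , v , p })
  (any? λ x → anyVec? k λ v → P? (x Vec.∷ v))

injective? : ∀ {n k} (v : Vec (Fin n) k) → Dec (Injective _≡_ _≡_ (Vec.lookup v))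
injective? v = map′ (λ f {i} {j} → f i j) (λ f i j → f {i} {j})
  (all? λ i → all? λ j → (Vec.lookup v i Fin.≟ Vec.lookup v j) →-dec (i Fin.≟ j))

hasCycle? : ∀ {n} (G : Graph n) L → Dec (HasCycleOfLength G L)
hasCycle? G zero = no λ { (k , () , _) }
hasCycle? {n} G (suc k) = map′ to from (3 ≤? suc k ×-dec anyVec? (suc k) P?)
  where
  P : Vec (Fin n) (suc k) → Set
  P v = Injective _≡_ _≡_ (Vec.lookup v) ×
        ((i : Fin k) → Adj G (Vec.lookup v (Fin.inject₁ i)) (Vec.lookup v (suc i))) ×
        Adj G (Vec.lookup v (Fin.fromℕ k)) (Vec.lookup v zero)
  P? : ∀ v → Dec (P v)
  P? v = injective? v ×-dec (all? λ i → _ Bool.≟ true) ×-dec (_ Bool.≟ true)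
  to : 3 ≤ suc k × ∃ P → HasCycleOfLength G (suc k)
  to (long , v , inj , p) = k , refl , long , Vec.lookup v , inj , p
  from : HasCycleOfLength G (suc k) → 3 ≤ suc k × ∃ P
  from (_ , refl , long , f , inj , step , last) = long , Vec.tabulate f ,
    (λ {i} {j} eq → inj (trans (sym (lookup∘tabulate f i)) (trans eq (lookup∘tabulate f j)))) ,
    (λ i → subst₂ (Adj G) (sym (lookup∘tabulate f _)) (sym (lookup∘tabulate f _)) (step i)) ,
    subst₂ (Adj G) (sym (lookup∘tabulate f _)) (sym (lookup∘tabulate f _)) last

Longest : ∀ {n} → Graph n → ℕ → Set
Longest G ℓ = ∀ {L} → HasCycleOfLength G L → L ≤ ℓ

-- A cycle has at most n vertices, so the search starts at n and lowers the bound past every length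
-- that does not occur.
longestCycle : ∀ {n} (G : Graph n) {L} → HasCycleOfLength G L → ∃[ ℓ ] (HasCycleOfLength G ℓ × Longest G ℓ)
longestCycle {n} G cyc = go n (λ { (k , refl , _ , f , inj , _) → injective⇒≤ inj })
  where
  go : ∀ b → Longest G b → ∃[ ℓ ] (HasCycleOfLength G ℓ × Longest G ℓ)
  go b bound with hasCycle? G b
  ... | yes p = b , p , bound
  go zero bound    | no ¬p = ⊥-elim (¬p (subst (HasCycleOfLength G) (n≤0⇒n≡0 (bound cyc)) cyc))
  go (suc b) bound | no ¬p = go b λ {L} c → m<1+n⇒m≤n (≤∧≢⇒< (bound c) λ { refl → ¬p c })

-- Existence of some cycle

walk-exit : ∀ {n} {G : Graph n} (χ : Fin n → Bool) {u v} → Walk G u v → χ u ≡ true → χ v ≡ false →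
  ∃[ p ] ∃[ q ] (Adj G p q × χ p ≡ true × χ q ≡ false)
walk-exit χ nil p q = ⊥-elim (true≢false p q)
walk-exit χ (cons {u} {v} e w) p q with χ v in eq
... | true  = walk-exit χ w eq q
... | false = u , v , e , p , eq

module _ {n : ℕ} (G : Graph (3 + n)) (conn : Connected G) (vt : VertexTransitive G) where
  private
    V = Fin (3 + n)

  TwoNeighbours : V → Set
  TwoNeighbours u = ∃[ s ] ∃[ t ] (Adj G u s × Adj G u t × s ≢ t)

  avoid₂ : (a b : V) → ∃[ x ] (x ≢ a × x ≢ b)
  avoid₂ a b with a Fin.≟ zero | b Fin.≟ zero
  ... | no p     | no q     = zero , p ∘ sym , q ∘ sym
  ... | yes refl | yes refl = suc zero , (λ ()) , λ ()
  ... | yes refl | no q with b Fin.≟ suc zero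
  ... | yes refl = suc (suc zero) , (λ ()) , λ ()
  ... | no r     = suc zero , (λ ()) , r ∘ sym
  avoid₂ a b | no p | yes refl with a Fin.≟ suc zero
  ... | yes refl = suc (suc zero) , (λ ()) , λ ()
  ... | no r     = suc zero , r ∘ sym , λ ()

  -- Some edge joins 0 to a vertex `a`. As there is a third vertex, connectedness gives an edge
  -- leaving the set of these two, and its end inside the set has two neighbours.
  someTwoNeighbours : ∃ TwoNeighbours
  someTwoNeighbours with walk-exit (is zero) (conn zero (suc zero)) refl refl
  ... | p , a , e , p≡ , a≢ with is⁻ zero p p≡
  ... | refl with avoid₂ zero a
  ... | x , x≢0 , x≢a with walk-exit (λ v → is zero v ∨ is a v) (conn zero x) refl
                             (≢true λ t → [ (λ q → x≢0 (is⁻ zero x q)) , (λ q → x≢a (is⁻ a x q)) ]′ (∨-true⁻ {is zero x} t))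
  ... | u , q , f , u∈ , q∉ with ∨-true⁻ {is zero u} u∈
  ... | inj₁ u≡0 with is⁻ zero u u≡0
  ... | refl = zero , a , q , e , f , λ { refl → true≢false (∨-trueʳ (is zero a) (is-refl a)) q∉ }
  someTwoNeighbours | p , a , e , p≡ , a≢ | refl | x , x≢0 , x≢a | u , q , f , u∈ , q∉ | inj₂ u≡a with is⁻ a u u≡a
  ... | refl = a , zero , q , adj-sym G e , f , λ { refl → true≢false refl q∉ }

  twoNeighbours : ∀ u → TwoNeighbours u
  twoNeighbours u with someTwoNeighbours
  ... | w , s , t , e , f , s≢t with vt w u
  ... | σ , aut , refl = Inverse.to σ s , Inverse.to σ t , trans (aut w s) e , trans (aut w t) f ,
    λ eq → s≢t (trans (sym (Inverse.strictlyInverseʳ σ s)) (trans (cong (Inverse.from σ) eq) (Inverse.strictlyInverseʳ σ t)))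

  otherNeighbour : ∀ u w → ∃[ t ] (Adj G u t × t ≢ w)
  otherNeighbour u w with twoNeighbours u
  ... | s , t , e , f , s≢t with s Fin.≟ w
  ... | yes refl = t , f , s≢t ∘ sym
  ... | no s≢w   = s , e , s≢w

  open Trails (Adj G)

  closeAt : ∀ {u v xs t} → Trail u v xs → t ∈ xs → ∃[ ys ] ∃[ zs ] (Trail u t ys × xs ≡ ys ++ zs)
  closeAt [ u ] (here refl) = _ , [] , [ u ] , refl
  closeAt (_∷_ {xs = xs} r tr) (here refl) = _ , xs , [ _ ] , refl
  closeAt (r ∷ tr) (there p) with closeAt tr p
  ... | ys , zs , tr′ , refl = _ , zs , r ∷ tr′ , refl

  -- A path is prolonged at its first vertex `u` by a neighbour other than `w`. If that neighbour is
  -- already on the path, it lies beyond `w` and closes a cycle of length at least 3. The fuel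
  -- suffices because a path cannot have more vertices than the graph.
  grow : ∀ fuel {u w v xs} → Adj G u w → Trail w v (w ∷ xs) → Unique (u ∷ w ∷ xs) →
    3 + n < fuel + length (u ∷ w ∷ xs) → ∃ (HasCycleOfLength G)
  grow zero e tr un big =
    ⊥-elim (<⇒≱ big (≤-trans (unique-⊆-length un (λ {z} _ → ∈-allFin z)) (≤-reflexive (length-tabulate {n = 3 + n} id))))
  grow (suc fuel) {u} {w} {xs = xs} e tr un big with otherNeighbour u w
  ... | t , f , t≢w with Any.any? (t Fin.≟_) (u ∷ w ∷ xs)
  ... | no t∉ = grow fuel (adj-sym G f) (e ∷ tr) (unique-∷ t∉ un) (≤-trans big (≤-reflexive (sym (+-suc fuel _))))
  ... | yes (here t≡u) = ⊥-elim (adj-≢ G f (sym t≡u))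
  ... | yes (there (here t≡w)) = ⊥-elim (t≢w t≡w)
  ... | yes (there (there t∈)) with closeAt tr (there t∈)
  ... | _ , zs , [ _ ] , refl = ⊥-elim (t≢w refl)
  ... | _ , zs , (_∷_ {xs = ys} s tr′) , refl = _ , closed⇒cycle G ((e ∷ s ∷ tr′) ⊕ [ adj-sym G f ])
      (subst Unique (sym (++-identityʳ (u ∷ w ∷ ys))) (unique-++⁻ˡ (u ∷ w ∷ ys) un))
      (s≤s (s≤s (≤-trans (trail-nonempty tr′) (≤-reflexive (cong length (sym (++-identityʳ ys)))))))
    where
    trail-nonempty : ∀ {u v xs} → Trail u v xs → 1 ≤ length xs
    trail-nonempty [ _ ]   = s≤s z≤n
    trail-nonempty (_ ∷ _) = s≤s z≤n

  someCycle : ∃ (HasCycleOfLength G)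
  someCycle with twoNeighbours zero
  ... | s , _ , e , _ = grow (3 + n) e [ s ] (unique-∷ (λ { (here refl) → adj-≢ G e refl }) ([] ∷ []))
    (≤-trans (n≤1+n _) (≤-reflexive (+-comm 2 (3 + n))))

-- Rerouting a longest cycle through bridges

module Rerouting {n : ℕ} {G : Graph n} {ℓ : ℕ} (long : 3 ≤ ℓ) (longest : Longest G ℓ) (C : Cyc G ℓ) where
  open Trails (Adj G)
  open Sym (adj-sym G)
  open Cyc C

  private variable
    u v w u′ v′ w′ : Fin n
    lo hi lo′ hi′ : ℕ

  closed-short : ∀ {xs} → HalfOpen u u xs → Unique xs → length xs ≤ ℓ
  closed-short {xs = xs} h un with length xs ≤? ℓ
  ... | yes p = p
  ... | no ¬p = longest (closed⇒cycle G h un (≤-trans long (<⇒≤ (≰⇒> ¬p))))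

  -- `lo` and `hi` delimit the positions on `C` and are unchanged when the arc is reversed, so they
  -- need not be the positions of `u` and `v` in this order.
  record Arc (u v : Fin n) (lo hi : ℕ) : Set where
    field
      list   : List (Fin n)
      trail  : Trail u v list
      size   : length list + lo ≡ suc hi
      unique : Unique list
      on     : ∀ {z} → z ∈ list → ∃[ p ] (lo ≤ p × p ≤ hi × z ≡ at p)

  forward : lo ≤ hi → hi < lo + ℓ → Arc (at lo) (at hi) lo hi
  forward {lo} {hi} lo≤hi hi< = go (hi ∸ lo) (m∸n+n≡m lo≤hi) ≤-refl
    where
    go : ∀ γ {p} → γ + p ≡ hi → lo ≤ p → Arc (at p) (at hi) p hi
    go zero refl _ = record
      { list = at hi ∷ [] ; trail = [ _ ] ; size = refl ; unique = [] ∷ []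
      ; on = λ { (here refl) → hi , ≤-refl , ≤-refl , refl } }
    go (suc γ) {p} eq lo≤p = record
      { list = at p ∷ r.list ; trail = step p ∷ r.trail
      ; size = trans (sym (+-suc _ p)) r.size
      ; unique = unique-∷ fresh r.unique
      ; on = λ { (here refl) → p , ≤-refl , p≤hi , refl
               ; (there z∈) → case r.on z∈ of λ (q , p<q , q≤hi , z≡) → q , <⇒≤ p<q , q≤hi , z≡ } }
      where
      module r = Arc (go γ (trans (+-suc γ p) eq) (m≤n⇒m≤1+n lo≤p))
      p≤hi : p ≤ hi
      p≤hi = subst (p ≤_) eq (m≤n+m p (suc γ))
      fresh : at p ∉ r.list
      fresh p∈ with r.on p∈
      ... | q , p<q , q≤hi , eq′ = distinct p<q (≤-<-trans q≤hi (<-≤-trans hi< (+-monoˡ-≤ ℓ lo≤p))) eq′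

  backward : Arc u v lo hi → Arc v u lo hi
  backward A = record
    { list = reverse list ; trail = trail-reverse trail
    ; size = trans (cong (_+ _) (length-reverse list)) size
    ; unique = unique-reverse unique ; on = λ z∈ → on (reverse⁻ z∈) }
    where open Arc A

  record Bridge (u v : Fin n) : Set where
    field
      list   : List (Fin n)
      path   : Open u v list
      unique : Unique list
      off    : ∀ {z} → z ∈ list → ∀ p → z ≢ at p

  reverse-bridge : Bridge u v → Bridge v u
  reverse-bridge K = record
    { list = reverse list ; path = open-reverse path
    ; unique = unique-reverse unique ; off = λ z∈ → off (reverse⁻ z∈) }
    where open Bridge K

  _#_ : Bridge u v → Bridge u′ v′ → Set
  K # L = ∀ {z} → z ∈ Bridge.list K → z ∈ Bridge.list L → ⊥

  infixr 6 _▸_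
  _▸_ : Arc u v lo hi → Bridge v w → List (Fin n)
  A ▸ K = Arc.list A ++ Bridge.list K

  piece-path : (A : Arc u v lo hi) (K : Bridge v w) → HalfOpen u w (A ▸ K)
  piece-path A K = Arc.trail A ⊕ Bridge.path K

  arc-off-bridge : (A : Arc u v lo hi) (K : Bridge u′ v′) → ∀ {z} → z ∈ Arc.list A → z ∈ Bridge.list K → ⊥
  arc-off-bridge A K z∈ z∈′ with Arc.on A z∈
  ... | p , _ , _ , z≡ = Bridge.off K z∈′ p z≡

  piece-unique : (A : Arc u v lo hi) (K : Bridge v w) → Unique (A ▸ K)
  piece-unique A K = unique-++ (Arc.unique A) (Bridge.unique K) (arc-off-bridge A K)

  arcs-disjoint : (A : Arc u v lo hi) (B : Arc u′ v′ lo′ hi′) → hi < lo′ → hi′ < lo + ℓ →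
    ∀ {z} → z ∈ Arc.list A → z ∈ Arc.list B → ⊥
  arcs-disjoint A B hi<lo′ hi′< z∈A z∈B with Arc.on A z∈A | Arc.on B z∈B
  ... | p , lo≤p , p≤hi , refl | q , lo′≤q , q≤hi′ , eq =
    distinct (<-≤-trans (≤-<-trans p≤hi hi<lo′) lo′≤q) (≤-<-trans q≤hi′ (<-≤-trans hi′< (+-monoˡ-≤ ℓ lo≤p))) eq

  pieces-disjoint : (A : Arc u v lo hi) (K : Bridge v w) (B : Arc u′ v′ lo′ hi′) (L : Bridge v′ w′) →
    hi < lo′ → hi′ < lo + ℓ → K # L → ∀ {z} → z ∈ A ▸ K → z ∈ B ▸ L → ⊥
  pieces-disjoint A K B L p q K#L z∈ z∈′ with ∈-++⁻ (Arc.list A) z∈ | ∈-++⁻ (Arc.list B) z∈′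
  ... | inj₁ a | inj₁ b = arcs-disjoint A B p q a b
  ... | inj₁ a | inj₂ l = arc-off-bridge A L a l
  ... | inj₂ k | inj₁ b = arc-off-bridge B K b k
  ... | inj₂ k | inj₂ l = K#L k l

  -- The way round through position 0 becomes an interval once `hi` is replaced by its next copy
  -- `hi + ℓ`.
  wrap : ∀ {lo hi} → lo ≤ hi + ℓ → hi < lo → Arc (at lo) (at hi) lo (hi + ℓ)
  wrap {lo} {hi} p q = subst (λ v → Arc (at lo) v lo (hi + ℓ)) (periodic hi) (forward p (+-monoˡ-< ℓ q))

  size▸ : (A : Arc u v lo hi) (K : Bridge v w) → length (A ▸ K) + lo ≡ suc hi + length (Bridge.list K)
  size▸ {lo = lo} {hi} A K = begin
      length (Arc.list A ++ Bridge.list K) + lo   ≡⟨ cong (_+ lo) (length-++ (Arc.list A)) ⟩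
      a + l + lo                                  ≡⟨ solve 3 (λ a l o → a :+ l :+ o := a :+ o :+ l) refl a l lo ⟩
      a + lo + l                                  ≡⟨ cong (_+ l) (Arc.size A) ⟩
      suc hi + l                                  ∎
    where
    open ≡-Reasoning
    open +-*-Solver
    a = length (Arc.list A)
    l = length (Bridge.list K)

  -- In reroute₁, reroute₂ and reroute₃ the stretches of C strictly between xᵢ and xᵢ′ are replaced by
  -- bridges; the bounds are written without subtraction.
  reroute₁ : ∀ {x x′} → x < x′ → x′ < x + ℓ → (K : Bridge (at x) (at x′)) →
    1 + length (Bridge.list K) + x ≤ x′
  reroute₁ {x} {x′} x<x′ x′< K = +-cancelʳ-≤ ℓ _ _ (begin
      1 + length (Bridge.list K) + x + ℓ      ≡⟨ solve 3 (λ l x n → con 1 :+ l :+ x :+ n := con 1 :+ (x :+ n) :+ l) refl (length (Bridge.list K)) x ℓ ⟩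
      suc (x + ℓ) + length (Bridge.list K)    ≡⟨ size▸ W K ⟨
      length (W ▸ K) + x′                     ≤⟨ +-monoˡ-≤ x′ (closed-short (piece-path W K) (piece-unique W K)) ⟩
      ℓ + x′                                  ≡⟨ +-comm ℓ x′ ⟩
      x′ + ℓ                                  ∎)
    where
    open ≤-Reasoning
    open +-*-Solver
    W = wrap (<⇒≤ x′<) x<x′

  reroute₂ : ∀ {x₁ x₁′ x₂ x₂′} → x₁ < x₁′ → x₁′ < x₂ → x₂ < x₂′ → x₂′ < x₁ + ℓ →
    (K : Bridge (at x₁) (at x₂)) (L : Bridge (at x₁′) (at x₂′)) → K # L →
    2 + length (Bridge.list K) + length (Bridge.list L) + (x₁ + x₂) ≤ x₁′ + x₂′
  reroute₂ {x₁} {x₁′} {x₂} {x₂′} x₁<x₁′ x₁′<x₂ x₂<x₂′ x₂′< K L K#L = +-cancelʳ-≤ ℓ _ _ (begin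
      2 + k + l + (x₁ + x₂) + ℓ
        ≡⟨ solve 5 (λ k l x y n → con 2 :+ k :+ l :+ (x :+ y) :+ n := con 1 :+ (x :+ n) :+ k :+ (con 1 :+ y :+ l)) refl k l x₁ x₂ ℓ ⟩
      (suc (x₁ + ℓ) + k) + (suc x₂ + l)
        ≡⟨ cong₂ _+_ (size▸ W K) (size▸ P L) ⟨
      (length (W ▸ K) + x₂′) + (length (P ▸ L) + x₁′)
        ≡⟨ solve 4 (λ a b c d → (a :+ b) :+ (c :+ d) := (a :+ c) :+ (d :+ b)) refl (length (W ▸ K)) x₂′ (length (P ▸ L)) x₁′ ⟩
      (length (W ▸ K) + length (P ▸ L)) + (x₁′ + x₂′)
        ≡⟨ cong (_+ (x₁′ + x₂′)) (length-++ (W ▸ K)) ⟨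
      length ((W ▸ K) ++ (P ▸ L)) + (x₁′ + x₂′)
        ≤⟨ +-monoˡ-≤ (x₁′ + x₂′) (closed-short (piece-path W K ⊙ piece-path P L)
             (unique-++ (piece-unique W K) (piece-unique P L) λ p q →
               pieces-disjoint P L W K x₂<x₂′ (+-monoˡ-< ℓ x₁<x₁′) (λ r s → K#L s r) q p)) ⟩
      ℓ + (x₁′ + x₂′)
        ≡⟨ +-comm ℓ _ ⟩
      x₁′ + x₂′ + ℓ  ∎)
    where
    open ≤-Reasoning
    open +-*-Solver
    k = length (Bridge.list K)
    l = length (Bridge.list L)
    x₁<x₂ : x₁ < x₂
    x₁<x₂ = <-trans x₁<x₁′ x₁′<x₂
    W = wrap (<⇒≤ x₂′<) (<-trans x₁<x₂ x₂<x₂′)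
    -- The new cycle runs from x₂′ round to x₁, over `K` to x₂, back along `C` to x₁′, and over `L`
    -- to x₂′. Bridges from x₁ to x₂′ and from x₁′ to x₂ would produce two cycles instead; this is
    -- why orders have to be controlled.
    P = backward (forward (<⇒≤ x₁′<x₂) (<-trans x₂<x₂′ (<-trans x₂′< (+-monoˡ-< ℓ x₁<x₁′))))

  module _ {x₁ x₁′ x₂ x₂′ x₃ x₃′ : ℕ} (x₁<x₁′ : x₁ < x₁′) (x₁′<x₂ : x₁′ < x₂) (x₂<x₂′ : x₂ < x₂′)
           (x₂′<x₃ : x₂′ < x₃) (x₃<x₃′ : x₃ < x₃′) (x₃′< : x₃′ < x₁ + ℓ) where
    private
      x₃′<x₁′+ℓ : x₃′ < x₁′ + ℓ
      x₃′<x₁′+ℓ = <-trans x₃′< (+-monoˡ-< ℓ x₁<x₁′)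
      x₁′<x₂′ : x₁′ < x₂′
      x₁′<x₂′ = <-trans x₁′<x₂ x₂<x₂′
      W = wrap (<⇒≤ x₃′<) (<-trans (<-trans x₁<x₁′ x₁′<x₂′) (<-trans x₂′<x₃ x₃<x₃′))
      P = forward (<⇒≤ x₁′<x₂) (<-trans x₂<x₂′ (<-trans x₂′<x₃ (<-trans x₃<x₃′ x₃′<x₁′+ℓ)))
      Q = forward (<⇒≤ x₂′<x₃) (<-trans x₃<x₃′ (<-trans x₃′<x₁′+ℓ (+-monoˡ-< ℓ x₁′<x₂′)))

      -- The outer arc comes first in the new cycle; the two inner arcs, kept in the order of C by
      -- lo ≤ hi < lo′ ≤ hi′, may be traversed in either order and direction.
      three : ∀ {p p′ q q′ l m r} (A : Arc p p′ x₁′ x₂) (B : Arc q q′ x₂′ x₃)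
        (K : Bridge (at x₁) l) (M : Bridge p′ m) (N : Bridge q′ r) → K # M → K # N → M # N →
        (∀ {xs ys zs} → HalfOpen (at x₃′) l xs → HalfOpen p m ys → HalfOpen q r zs →
          ∃[ ws ] (HalfOpen (at x₃′) (at x₃′) ws × ws ↭ xs ++ ys ++ zs)) →
        3 + (length (Bridge.list K) + length (Bridge.list M) + length (Bridge.list N)) + (x₁ + x₂ + x₃)
          ≤ x₁′ + x₂′ + x₃′
      three A B K M N K#M K#N M#N close with close (piece-path W K) (piece-path A M) (piece-path B N)
      ... | ws , h , perm = +-cancelʳ-≤ ℓ _ _ (begin
          3 + (k + m + n′) + (x₁ + x₂ + x₃) + ℓ
            ≡⟨ solve 7 (λ k m n x y z o → con 3 :+ (k :+ m :+ n) :+ (x :+ y :+ z) :+ o :=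
                 con 1 :+ (x :+ o) :+ k :+ ((con 1 :+ y :+ m) :+ (con 1 :+ z :+ n))) refl k m n′ x₁ x₂ x₃ ℓ ⟩
          (suc (x₁ + ℓ) + k) + ((suc x₂ + m) + (suc x₃ + n′))
            ≡⟨ cong₂ _+_ (size▸ W K) (cong₂ _+_ (size▸ A M) (size▸ B N)) ⟨
          (length xs + x₃′) + ((length ys + x₁′) + (length zs + x₂′))
            ≡⟨ solve 6 (λ a b c d e f → (a :+ b) :+ ((c :+ d) :+ (e :+ f)) := (a :+ (c :+ e)) :+ (d :+ f :+ b)) refl
                 (length xs) x₃′ (length ys) x₁′ (length zs) x₂′ ⟩
          (length xs + (length ys + length zs)) + (x₁′ + x₂′ + x₃′)
            ≡⟨ cong (_+ _) (trans (length-++ xs) (cong (length xs +_) (length-++ ys))) ⟨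
          length (xs ++ ys ++ zs) + (x₁′ + x₂′ + x₃′)
            ≡⟨ cong (_+ _) (↭-length perm) ⟨
          length ws + (x₁′ + x₂′ + x₃′)
            ≤⟨ +-monoˡ-≤ _ (closed-short h (unique-resp-↭ (↭-sym perm) un)) ⟩
          ℓ + (x₁′ + x₂′ + x₃′)
            ≡⟨ +-comm ℓ _ ⟩
          x₁′ + x₂′ + x₃′ + ℓ ∎)
        where
        open ≤-Reasoning
        open +-*-Solver
        k = length (Bridge.list K)
        m = length (Bridge.list M)
        n′ = length (Bridge.list N)
        xs = W ▸ K
        ys = A ▸ M
        zs = B ▸ N
        un : Unique (xs ++ ys ++ zs)
        un = unique-++ (piece-unique W K)
          (unique-++ (piece-unique A M) (piece-unique B N)
            (pieces-disjoint A M B N x₂<x₂′ (<-trans x₃<x₃′ x₃′<x₁′+ℓ) M#N))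
          λ p q → case ∈-++⁻ ys q of λ where
            (inj₁ q) → pieces-disjoint A M W K (<-trans x₂<x₂′ (<-trans x₂′<x₃ x₃<x₃′)) (+-monoˡ-< ℓ x₁<x₁′) (λ r s → K#M s r) q p
            (inj₂ q) → pieces-disjoint B N W K x₃<x₃′ (+-monoˡ-< ℓ (<-trans x₁<x₁′ x₁′<x₂′)) (λ r s → K#N s r) q p

    reroute₃ᵅ : (K : Bridge (at x₁) (at x₂′)) (M : Bridge (at x₂) (at x₃)) (N : Bridge (at x₁′) (at x₃′)) →
      K # M → K # N → M # N →
      3 + (length (Bridge.list K) + length (Bridge.list N) + length (Bridge.list (reverse-bridge M))) + (x₁ + x₂ + x₃)
        ≤ x₁′ + x₂′ + x₃′
    -- Route: from x₃′ round to x₁, `K` to x₂′, forward to x₃, `M` reversed to x₂, backward to x₁′,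
    -- `N` to x₃′. The second inner arc is visited before the first, hence the permutation.
    reroute₃ᵅ K M N K#M K#N M#N = three (backward P) Q K N (reverse-bridge M) K#N
      (λ r s → K#M r (reverse⁻ s)) (λ r s → M#N (reverse⁻ s) r)
      λ {xs} {ys} {zs} h₁ h₂ h₃ → xs ++ zs ++ ys , h₁ ⊙ (h₃ ⊙ h₂) , ++⁺ˡ xs (++-comm zs ys)

    reroute₃ᵝ : (K : Bridge (at x₁) (at x₂)) (M : Bridge (at x₁′) (at x₃)) (N : Bridge (at x₂′) (at x₃′)) →
      K # M → K # N → M # N →
      3 + (length (Bridge.list K) + length (Bridge.list M) + length (Bridge.list N)) + (x₁ + x₂ + x₃)
        ≤ x₁′ + x₂′ + x₃′
    -- Route: from x₃′ round to x₁, `K` to x₂, backward to x₁′, `M` to x₃, backward to x₂′, `N` to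
    -- x₃′.
    reroute₃ᵝ K M N K#M K#N M#N = three (backward P) (backward Q) K M N K#M K#N M#N
      λ h₁ h₂ h₃ → _ , h₁ ⊙ (h₂ ⊙ h₃) , ↭-refl

-- Two longest cycles joined by disjoint paths

record LinkedCycles {n : ℕ} (G : Graph n) (ℓ k : ℕ) : Set where
  open Trails (Adj G)
  field
    C D     : Cyc G ℓ
    a b     : Fin k → ℕ
    a<      : ∀ e → a e < ℓ
    b<      : ∀ e → b e < ℓ
    inner   : Fin k → List (Fin n)
    path    : ∀ e → Open (Cyc.at C (a e)) (Cyc.at D (b e)) (inner e)
    simple  : ∀ e → Unique (inner e)
    apart   : ∀ {e f z} → z ∈ inner e → z ∈ inner f → e ≡ f
    inner∉C : ∀ {e z} → z ∈ inner e → ∀ p → z ≢ Cyc.at C p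
    inner∉D : ∀ {e z} → z ∈ inner e → ∀ p → z ≢ Cyc.at D p
    a-injective : ∀ {e f} → a e ≡ a f → e ≡ f
    b-injective : ∀ {e f} → b e ≡ b f → e ≡ f
    -- I and J number the segments into which the common vertices cut C and D.
    I J     : ℕ → ℕ
    I-mono  : ∀ {p q} → p ≤ q → I p ≤ I q
    J-mono  : ∀ {p q} → p ≤ q → J p ≤ J q
    I-free  : ∀ e f → a e < a f → I (a e) ≡ I (a f) → ∀ p → a e ≤ p → p ≤ a f → ∀ q → Cyc.at C p ≢ Cyc.at D q
    J-free  : ∀ e f → b e < b f → J (b e) ≡ J (b f) → ∀ p → b e ≤ p → p ≤ b f → ∀ q → Cyc.at D p ≢ Cyc.at C q

-- Each length comparison obtained by rerouting `C` can thus be reused for `D`, where it says the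
-- opposite.
flip : ∀ {n} {G : Graph n} {ℓ k} → LinkedCycles G ℓ k → LinkedCycles G ℓ k
flip {G = G} L = record
  { C = D ; D = C ; a = b ; b = a ; a< = b< ; b< = a<
  ; inner = λ e → reverse (inner e)
  ; path = λ e → Trails.Sym.open-reverse (Adj G) (adj-sym G) (path e)
  ; simple = λ e → unique-reverse (simple e)
  ; apart = λ p q → apart (reverse⁻ p) (reverse⁻ q)
  ; inner∉C = λ p → inner∉D (reverse⁻ p)
  ; inner∉D = λ p → inner∉C (reverse⁻ p)
  ; a-injective = b-injective ; b-injective = a-injective
  ; I = J ; J = I ; I-mono = J-mono ; J-mono = I-mono ; I-free = J-free ; J-free = I-free }
  where open LinkedCycles L

<ᵇ-true : ∀ {m n} → m < n → (m <ᵇ n) ≡ true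
<ᵇ-true {m} {n} p with m <ᵇ n | <⇒<ᵇ p
... | true | _ = refl

<ᵇ-false : ∀ {m n} → n < m → (m <ᵇ n) ≡ false
<ᵇ-false {m} {n} p = ≢true λ q → <-asym p (<ᵇ⇒< m n (subst T (sym q) tt))

-- Meaningful for p ≠ q and p′ ≠ q′ only.
Parallel : ℕ → ℕ → ℕ → ℕ → Set
Parallel p q p′ q′ = (p <ᵇ q) ≡ (p′ <ᵇ q′)

parallel-elim : ∀ {p q p′ q′} → p ≢ q → p′ ≢ q′ → Parallel p q p′ q′ → (p < q × p′ < q′) ⊎ (q < p × q′ < p′)
parallel-elim {p} {q} {p′} {q′} p≢q p′≢q′ eq with <-cmp p q | <-cmp p′ q′
... | tri< x _ _ | tri< y _ _ = inj₁ (x , y)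
... | tri> _ _ x | tri> _ _ y = inj₂ (x , y)
... | tri< x _ _ | tri> _ _ y = ⊥-elim (true≢false (<ᵇ-true x) (trans eq (<ᵇ-false y)))
... | tri> _ _ x | tri< y _ _ = ⊥-elim (true≢false (<ᵇ-true y) (trans (sym eq) (<ᵇ-false x)))
... | tri≈ _ x _ | _          = ⊥-elim (p≢q x)
... | tri< _ _ _ | tri≈ _ y _ = ⊥-elim (p′≢q′ y)
... | tri> _ _ _ | tri≈ _ y _ = ⊥-elim (p′≢q′ y)

∣-∣-< : ∀ {p q} → p < q → ∣ p - q ∣ + p ≡ q
∣-∣-< {p} {q} p<q = trans (cong (_+ p) (m≤n⇒∣m-n∣≡n∸m (<⇒≤ p<q))) (m∸n+n≡m (<⇒≤ p<q))

module OneSided {n : ℕ} {G : Graph n} {ℓ k : ℕ} (long : 3 ≤ ℓ) (longest : Longest G ℓ) (L : LinkedCycles G ℓ k) where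
  open LinkedCycles L
  open Trails (Adj G)
  open Sym (adj-sym G)
  open Rerouting long longest C
  private module 𝒟 = Rerouting long longest D

  -- Intended are bridges that follow one path from `C` to `D`, a stretch of `D` with `size` edges,
  -- and another path back to `C`. Such a stretch has one vertex more than edges, hence the strict
  -- `size≤`. `within` confines the bridge to column κ, so that links in different columns are
  -- disjoint.
  record Link (κ : ℕ) (u v : Fin n) (size : ℕ) : Set where
    field
      bridge : Bridge u v
      size≤  : size < length (Bridge.list bridge)
      within : ∀ {z} → z ∈ Bridge.list bridge →
        (∃[ e ] (J (b e) ≡ κ × z ∈ inner e)) ⊎ (∃[ p ] (p < ℓ × J p ≡ κ × z ≡ Cyc.at D p))

  link< : ∀ e f → b e < b f → J (b e) ≡ J (b f) → Link (J (b e)) (Cyc.at C (a e)) (Cyc.at C (a f)) ∣ b e - b f ∣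
  link< e f e<f same = record { bridge = record
      { list = list ; path = join (path e) (𝒟.Arc.trail A) (open-reverse (path f))
      ; unique = unique-++ (simple e) (unique-++ (𝒟.Arc.unique A) (unique-reverse (simple f)) arc-f) e-rest
      ; off = off } ; size≤ = size≤ ; within = within }
    where
    A = 𝒟.forward (<⇒≤ e<f) (<-≤-trans (b< f) (m≤n+m ℓ (b e)))
    list = inner e ++ 𝒟.Arc.list A ++ reverse (inner f)
    arc-f : ∀ {z} → z ∈ 𝒟.Arc.list A → z ∈ reverse (inner f) → ⊥
    arc-f p q with 𝒟.Arc.on A p
    ... | r , _ , _ , z≡ = inner∉D (reverse⁻ q) r z≡
    e-rest : ∀ {z} → z ∈ inner e → z ∈ 𝒟.Arc.list A ++ reverse (inner f) → ⊥
    e-rest p q with ∈-++⁻ (𝒟.Arc.list A) q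
    ... | inj₁ q = case 𝒟.Arc.on A q of λ (r , _ , _ , z≡) → inner∉D p r z≡
    ... | inj₂ q = <-irrefl (cong b (apart p (reverse⁻ q))) e<f
    pieces : ∀ {z} → z ∈ list → z ∈ inner e ⊎ z ∈ inner f ⊎ ∃[ p ] (b e ≤ p × p ≤ b f × z ≡ Cyc.at D p)
    pieces p with ∈-++⁻ (inner e) p
    ... | inj₁ q = inj₁ q
    ... | inj₂ q with ∈-++⁻ (𝒟.Arc.list A) q
    ... | inj₁ r = inj₂ (inj₂ (𝒟.Arc.on A r))
    ... | inj₂ r = inj₂ (inj₁ (reverse⁻ r))
    off : ∀ {z} → z ∈ list → ∀ p → z ≢ Cyc.at C p
    off z∈ with pieces z∈
    ... | inj₁ q = inner∉C q
    ... | inj₂ (inj₁ q) = inner∉C q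
    ... | inj₂ (inj₂ (p , lo , hi , refl)) = J-free e f e<f same p lo hi
    within : ∀ {z} → z ∈ list → _
    within z∈ with pieces z∈
    ... | inj₁ q = inj₁ (e , refl , q)
    ... | inj₂ (inj₁ q) = inj₁ (f , sym same , q)
    -- `J` is monotone and equal at both ends of the stretch, hence constant on it.
    ... | inj₂ (inj₂ (p , lo , hi , z≡)) = inj₂ (p , ≤-<-trans hi (b< f) ,
          ≤-antisym (≤-trans (J-mono hi) (≤-reflexive (sym same))) (J-mono lo) , z≡)
    size≤ : ∣ b e - b f ∣ < length list
    size≤ = begin
      suc ∣ b e - b f ∣        ≡⟨ +-cancelʳ-≡ (b e) _ _ (trans (cong suc (∣-∣-< e<f)) (sym (𝒟.Arc.size A))) ⟩
      length (𝒟.Arc.list A)    ≤⟨ m≤m+n _ _ ⟩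
      length (𝒟.Arc.list A) + length (reverse (inner f)) ≡⟨ length-++ (𝒟.Arc.list A) ⟨
      length (𝒟.Arc.list A ++ reverse (inner f))         ≤⟨ m≤n+m _ (length (inner e)) ⟩
      length (inner e) + length (𝒟.Arc.list A ++ reverse (inner f)) ≡⟨ length-++ (inner e) ⟨
      length list              ∎
      where open ≤-Reasoning

  link-reverse : ∀ {κ u v s} → Link κ u v s → Link κ v u s
  link-reverse K = record
    { bridge = reverse-bridge bridge
    ; size≤ = ≤-trans size≤ (≤-reflexive (sym (length-reverse (Bridge.list bridge))))
    ; within = λ z∈ → within (reverse⁻ z∈) }
    where open Link K

  link : ∀ e f → a e ≢ a f → J (b e) ≡ J (b f) → Link (J (b e)) (Cyc.at C (a e)) (Cyc.at C (a f)) ∣ b e - b f ∣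
  link e f a≢ same with <-cmp (b e) (b f)
  ... | tri< p _ _ = link< e f p same
  ... | tri≈ _ p _ = ⊥-elim (a≢ (cong a (b-injective p)))
  ... | tri> _ _ p = subst₂ (λ κ s → Link κ _ _ s) (sym same) (∣-∣-comm (b f) (b e)) (link-reverse (link< f e p (sym same)))

  links-disjoint : ∀ {κ λ′ u v u′ v′ s t} (K : Link κ u v s) (M : Link λ′ u′ v′ t) → κ ≢ λ′ →
    Link.bridge K # Link.bridge M
  links-disjoint K M κ≢ z∈ z∈′ with Link.within K z∈ | Link.within M z∈′
  ... | inj₁ (e , refl , p) | inj₁ (f , refl , q) = κ≢ (cong (λ e → J (b e)) (apart p q))
  ... | inj₁ (e , _ , p) | inj₂ (q , _ , _ , z≡) = inner∉D p q z≡
  ... | inj₂ (p , _ , _ , z≡) | inj₁ (f , _ , q) = inner∉D q p z≡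
  ... | inj₂ (p , p< , refl , z≡) | inj₂ (q , q< , refl , z≡′) =
        κ≢ (cong J (Cyc.distinct′ D p< q< (trans (sym z≡) z≡′)))

  I-reflects-< : ∀ {p q} → I p < I q → p < q
  I-reflects-< I< = ≰⇒> λ q≤p → <⇒≱ I< (I-mono q≤p)

  -- Replacing the stretch of `C` by the one of `D` must not give a longer cycle. The two connecting
  -- paths are added as well, so the comparison is strict.
  digon : ∀ e f → a e < a f → J (b e) ≡ J (b f) → ∣ b e - b f ∣ < ∣ a e - a f ∣
  digon e f e<f same = +-cancelʳ-≤ (a e) _ _ (begin
      suc ∣ b e - b f ∣ + a e               ≤⟨ +-monoˡ-≤ (a e) (m≤n⇒m≤1+n (Link.size≤ K)) ⟩
      suc (length (Bridge.list (Link.bridge K))) + a e ≤⟨ reroute₁ e<f (<-≤-trans (a< f) (m≤n+m ℓ _)) (Link.bridge K) ⟩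
      a f                                   ≡⟨ ∣-∣-< e<f ⟨
      ∣ a e - a f ∣ + a e                   ∎)
    where
    open ≤-Reasoning
    K = link e f (<⇒≢ e<f) same

  square< : ∀ e₁ f₁ e₂ f₂ → I (a e₁) ≡ I (a f₁) → I (a e₂) ≡ I (a f₂) → I (a e₁) < I (a e₂) →
    J (b e₁) ≡ J (b e₂) → J (b f₁) ≡ J (b f₂) → J (b e₁) ≢ J (b f₁) → a e₁ < a f₁ → a e₂ < a f₂ →
    ∣ b e₁ - b e₂ ∣ + ∣ b f₁ - b f₂ ∣ < ∣ a e₁ - a f₁ ∣ + ∣ a e₂ - a f₂ ∣
  square< e₁ f₁ e₂ f₂ I₁ I₂ I< Je Jf J≢ o₁ o₂ = +-cancelʳ-≤ (a e₁ + a e₂) _ _ (begin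
      suc (∣ b e₁ - b e₂ ∣ + ∣ b f₁ - b f₂ ∣) + (a e₁ + a e₂)
        ≤⟨ +-monoˡ-≤ (a e₁ + a e₂) (≤-trans (s≤s (+-mono-≤ (<⇒≤ (Link.size≤ K)) (<⇒≤ (Link.size≤ M)))) (n≤1+n _)) ⟩
      2 + length (Bridge.list (Link.bridge K)) + length (Bridge.list (Link.bridge M)) + (a e₁ + a e₂)
        ≤⟨ reroute₂ o₁ (I-reflects-< (subst (_< I (a e₂)) I₁ I<)) o₂ (<-≤-trans (a< f₂) (m≤n+m ℓ _))
             (Link.bridge K) (Link.bridge M) (links-disjoint K M J≢) ⟩
      a f₁ + a f₂
        ≡⟨ cong₂ _+_ (∣-∣-< o₁) (∣-∣-< o₂) ⟨
      (∣ a e₁ - a f₁ ∣ + a e₁) + (∣ a e₂ - a f₂ ∣ + a e₂)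
        ≡⟨ solve 4 (λ x y z w → (x :+ y) :+ (z :+ w) := (x :+ z) :+ (y :+ w)) refl ∣ a e₁ - a f₁ ∣ (a e₁) ∣ a e₂ - a f₂ ∣ (a e₂) ⟩
      ∣ a e₁ - a f₁ ∣ + ∣ a e₂ - a f₂ ∣ + (a e₁ + a e₂) ∎)
    where
    open ≤-Reasoning
    open +-*-Solver
    K = link e₁ e₂ (λ eq → <⇒≢ I< (cong I eq)) Je
    M = link f₁ f₂ (λ eq → <⇒≢ I< (trans I₁ (trans (cong I eq) (sym I₂)))) Jf

  -- Exchanging each e with its f, or index 1 with index 2, permutes the hypotheses and reaches the
  -- situation of `square<` in all four cases.
  square : ∀ e₁ f₁ e₂ f₂ → I (a e₁) ≡ I (a f₁) → I (a e₂) ≡ I (a f₂) → I (a e₁) ≢ I (a e₂) →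
    J (b e₁) ≡ J (b e₂) → J (b f₁) ≡ J (b f₂) → J (b e₁) ≢ J (b f₁) → Parallel (a e₁) (a f₁) (a e₂) (a f₂) →
    ∣ b e₁ - b e₂ ∣ + ∣ b f₁ - b f₂ ∣ < ∣ a e₁ - a f₁ ∣ + ∣ a e₂ - a f₂ ∣
  square e₁ f₁ e₂ f₂ I₁ I₂ I≢ Je Jf J≢ par = split (parallel-elim (ne e₁ f₁ J≢) (ne e₂ f₂ (λ eq → J≢ (trans Je (trans eq (sym Jf))))) par) (<-cmp (I (a e₁)) (I (a e₂)))
    where
    ne : ∀ e f → J (b e) ≢ J (b f) → a e ≢ a f
    ne e f J≢ eq = J≢ (cong (λ e → J (b e)) (a-injective eq))
    Goal = ∣ b e₁ - b e₂ ∣ + ∣ b f₁ - b f₂ ∣ < ∣ a e₁ - a f₁ ∣ + ∣ a e₂ - a f₂ ∣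
    split : (a e₁ < a f₁ × a e₂ < a f₂) ⊎ (a f₁ < a e₁ × a f₂ < a e₂) → Tri (I (a e₁) < I (a e₂)) _ (I (a e₂) < I (a e₁)) → Goal
    split _ (tri≈ _ eq _) = ⊥-elim (I≢ eq)
    split (inj₁ (o₁ , o₂)) (tri< I< _ _) = square< e₁ f₁ e₂ f₂ I₁ I₂ I< Je Jf J≢ o₁ o₂
    split (inj₂ (o₁ , o₂)) (tri< I< _ _) = subst₂ _<_ (+-comm ∣ b f₁ - b f₂ ∣ _) (cong₂ _+_ (∣-∣-comm (a f₁) _) (∣-∣-comm (a f₂) _))
      (square< f₁ e₁ f₂ e₂ (sym I₁) (sym I₂) (subst₂ _<_ I₁ I₂ I<) Jf Je (J≢ ∘ sym) o₁ o₂)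
    split (inj₁ (o₁ , o₂)) (tri> _ _ I>) = subst₂ _<_ (cong₂ _+_ (∣-∣-comm (b e₂) _) (∣-∣-comm (b f₂) _)) (+-comm ∣ a e₂ - a f₂ ∣ _)
      (square< e₂ f₂ e₁ f₁ I₂ I₁ I> (sym Je) (sym Jf) (λ eq → J≢ (trans Je (trans eq (sym Jf)))) o₂ o₁)
    split (inj₂ (o₁ , o₂)) (tri> _ _ I>) = subst₂ _<_
      (trans (+-comm ∣ b f₂ - b f₁ ∣ _) (cong₂ _+_ (∣-∣-comm (b e₂) _) (∣-∣-comm (b f₂) _)))
      (trans (+-comm ∣ a f₂ - a e₂ ∣ _) (cong₂ _+_ (∣-∣-comm (a f₁) _) (∣-∣-comm (a f₂) _)))
      (square< f₂ e₂ f₁ e₁ (sym I₂) (sym I₁) (subst₂ _<_ I₂ I₁ I>) (sym Jf) (sym Je) (λ eq → J≢ (trans Je (sym (trans Jf eq)))) o₂ o₁)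

  -- The 6-cycle has the rows e f, e′ f′, g g′ and the columns g e, g′ e′, f f′. Stretches of `D` in
  -- the columns are compared with stretches of `C` in the rows.
  Hexagon : (e f g e′ f′ g′ : Fin k) → Set
  Hexagon e f g e′ f′ g′ =
    ∣ b g - b e ∣ + ∣ b g′ - b e′ ∣ + ∣ b f - b f′ ∣ < ∣ a g - a g′ ∣ + ∣ a f - a e ∣ + ∣ a f′ - a e′ ∣

  private
    cancel₃ : ∀ {s t x₁ x₂ x₃ d₁ d₂ d₃ y₁ y₂ y₃} → d₁ + x₁ ≡ y₁ → d₂ + x₂ ≡ y₂ → d₃ + x₃ ≡ y₃ → s ≤ t →
      3 + t + (x₁ + x₂ + x₃) ≤ y₁ + y₂ + y₃ → suc s ≤ d₁ + d₂ + d₃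
    cancel₃ {s} {t} {x₁} {x₂} {x₃} {d₁} {d₂} {d₃} refl refl refl s≤t le = +-cancelʳ-≤ (x₁ + x₂ + x₃) _ _ (begin
      suc s + (x₁ + x₂ + x₃)                ≤⟨ +-monoˡ-≤ _ (≤-trans (s≤s s≤t) (m≤n+m (suc t) 2)) ⟩
      3 + t + (x₁ + x₂ + x₃)                ≤⟨ le ⟩
      (d₁ + x₁) + (d₂ + x₂) + (d₃ + x₃)
        ≡⟨ solve 6 (λ a b c x y z → (a :+ x) :+ (b :+ y) :+ (c :+ z) := a :+ b :+ c :+ (x :+ y :+ z)) refl d₁ d₂ d₃ x₁ x₂ x₃ ⟩
      d₁ + d₂ + d₃ + (x₁ + x₂ + x₃)         ∎)
      where
      open ≤-Reasoning
      open +-*-Solver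

  link-subst : ∀ {κ u v u′ v′ s} → u ≡ u′ → v ≡ v′ → Link κ u v s → Link κ u′ v′ s
  link-subst refl refl K = K

  module _ {e f g e′ f′ g′ : Fin k}
           (If : I (a f) ≡ I (a e)) (If′ : I (a f′) ≡ I (a e′)) (Ig : I (a g) ≡ I (a g′))
           (Jg : J (b g) ≡ J (b e)) (Jg′ : J (b g′) ≡ J (b e′)) (Jf : J (b f) ≡ J (b f′))
           (Jee′ : J (b e) ≢ J (b e′)) (Jef : J (b e) ≢ J (b f)) (Je′f : J (b e′) ≢ J (b f))
           (Iee′ : I (a e) < I (a e′)) (Ige : I (a g) ≢ I (a e)) (Ige′ : I (a g) ≢ I (a e′)) where

    private
      K = link g e (λ eq → Ige (cong I eq)) Jg
      N = link g′ e′ (λ eq → Ige′ (trans Ig (cong I eq))) Jg′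
      M = link f f′ (λ eq → <⇒≢ Iee′ (trans (sym If) (trans (cong I eq) If′))) Jf


    -- The cycle is cut so that the segment of g comes first; s = ℓ if this moves e, f, e′, f′ up.
    hexagon-core : ∀ s → (∀ p → Cyc.at C (p + s) ≡ Cyc.at C p) →
      (∀ x → I (a x) ≡ I (a e) → a g′ < a x + s) → (∀ x → I (a x) ≡ I (a e′) → a x + s < a g + ℓ) →
      a g < a g′ → Parallel (a f) (a e) (a f′) (a e′) → Hexagon e f g e′ f′ g′
    hexagon-core s shift lo hi g<g′ par with parallel-elim (λ eq → Jef (cong (λ e → J (b e)) (sym (a-injective eq))))
                                                (λ eq → Je′f (trans (cong (λ e → J (b e)) (sym (a-injective eq))) (sym Jf))) par
    -- Let x₁, x₁′ be the ends in row g, and x₂ < x₂′ and x₃ < x₃′ those in the rows of e and e′.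
    -- Here the links join x₁ to x₂′, x₂ to x₃ and x₁′ to x₃′; in the other case they join x₁ to x₂,
    -- x₁′ to x₃ and x₂′ to x₃′.
    ... | inj₁ (f<e , f′<e′) = cancel₃ {x₁ = a g} {a f + s} {a f′ + s} {∣ a g - a g′ ∣} {∣ a f - a e ∣} {∣ a f′ - a e′ ∣}
          (∣-∣-< g<g′) (lift f<e) (lift f′<e′)
          (+-mono-≤ (+-mono-≤ (<⇒≤ (Link.size≤ K′)) (<⇒≤ (Link.size≤ N′)))
            (≤-trans (<⇒≤ (Link.size≤ M′)) (≤-reflexive (sym (length-reverse (Bridge.list (Link.bridge M′)))))))
          (reroute₃ᵅ g<g′ (lo f If) (+-monoˡ-< s f<e) (+-monoˡ-< s (I-reflects-< (subst (I (a e) <_) (sym If′) Iee′)))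
            (+-monoˡ-< s f′<e′) (hi e′ refl) (Link.bridge K′) (Link.bridge M′) (Link.bridge N′)
            (links-disjoint K′ M′ (λ eq → Jef (trans (sym Jg) eq)))
            (links-disjoint K′ N′ (λ eq → Jee′ (trans (sym Jg) (trans eq Jg′))))
            (links-disjoint M′ N′ (λ eq → Je′f (sym (trans eq Jg′)))))
      where
      lift : ∀ {p q} → p < q → ∣ p - q ∣ + (p + s) ≡ q + s
      lift {p} {q} p<q = trans (sym (+-assoc ∣ p - q ∣ p s)) (cong (_+ s) (∣-∣-< p<q))
      K′ = link-subst refl (sym (shift (a e))) K
      N′ = link-subst refl (sym (shift (a e′))) N
      M′ = link-subst (sym (shift (a f))) (sym (shift (a f′))) M
    ... | inj₂ (e<f , e′<f′) = cancel₃ {x₁ = a g} {a e + s} {a e′ + s} {∣ a g - a g′ ∣} {∣ a f - a e ∣} {∣ a f′ - a e′ ∣}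
          (∣-∣-< g<g′) (lift e<f) (lift e′<f′)
          (+-mono-≤ (+-mono-≤ (<⇒≤ (Link.size≤ K′)) (<⇒≤ (Link.size≤ N′))) (<⇒≤ (Link.size≤ M′)))
          (reroute₃ᵝ g<g′ (lo e refl) (+-monoˡ-< s e<f) (+-monoˡ-< s (I-reflects-< (subst (_< I (a e′)) (sym If) Iee′)))
            (+-monoˡ-< s e′<f′) (hi f′ If′) (Link.bridge K′) (Link.bridge N′) (Link.bridge M′)
            (links-disjoint K′ N′ (λ eq → Jee′ (trans (sym Jg) (trans eq Jg′))))
            (links-disjoint K′ M′ (λ eq → Jef (trans (sym Jg) eq)))
            (links-disjoint N′ M′ (λ eq → Je′f (trans (sym Jg′) eq))))
      where
      lift : ∀ {p q} → p < q → ∣ q - p ∣ + (p + s) ≡ q + s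
      lift {p} {q} p<q = trans (cong (_+ (p + s)) (∣-∣-comm q p))
        (trans (sym (+-assoc ∣ p - q ∣ p s)) (cong (_+ s) (∣-∣-< p<q)))
      K′ = link-subst refl (sym (shift (a e))) K
      N′ = link-subst refl (sym (shift (a e′))) N
      M′ = link-subst (sym (shift (a f))) (sym (shift (a f′))) M

    -- The rerouting needs the cyclic order g, e, e′ of the rows. By the last condition row g lies
    -- before both other rows or after both, and in the latter case these are moved up by one
    -- period. Between them it would reverse the cyclic order.
    hexagon< : a g < a g′ → Parallel (a f) (a e) (a f′) (a e′) → Parallel (a e) (a g) (a e′) (a g′) →
      Hexagon e f g e′ f′ g′
    hexagon< g<g′ par par′ with parallel-elim (λ eq → Ige (cong I (sym eq))) (λ eq → Ige′ (trans Ig (cong I (sym eq)))) par′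
    ... | inj₁ (e<g , e′<g′) = hexagon-core ℓ (Cyc.periodic C) (λ x _ → <-≤-trans (a< g′) (m≤n+m ℓ (a x)))
            (λ x Ix → +-monoˡ-< ℓ (I-reflects-< (≤∧≢⇒< (subst₂ _≤_ (sym Ix) (sym Ig) (I-mono (<⇒≤ e′<g′))) (λ eq → Ige′ (trans (sym eq) Ix)))))
            g<g′ par
    ... | inj₂ (g<e , g′<e′) = hexagon-core 0 (λ p → cong (Cyc.at C) (+-identityʳ p))
            (λ x Ix → subst (a g′ <_) (sym (+-identityʳ (a x))) (I-reflects-< (≤∧≢⇒< (subst₂ _≤_ Ig (sym Ix) (I-mono (<⇒≤ g<e))) (λ eq → Ige (trans Ig (trans eq Ix))))))
            (λ x _ → subst (_< a g + ℓ) (sym (+-identityʳ (a x))) (<-≤-trans (a< x) (m≤n+m ℓ (a g))))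
            g<g′ par

  hexagon : ∀ e f g e′ f′ g′ → I (a f) ≡ I (a e) → I (a f′) ≡ I (a e′) → I (a g) ≡ I (a g′) →
    J (b g) ≡ J (b e) → J (b g′) ≡ J (b e′) → J (b f) ≡ J (b f′) →
    J (b e) ≢ J (b e′) → J (b e) ≢ J (b f) → J (b e′) ≢ J (b f) →
    I (a e) ≢ I (a e′) → I (a g) ≢ I (a e) → I (a g) ≢ I (a e′) →
    Parallel (a e) (a e′) (a g) (a g′) → Parallel (a f) (a e) (a f′) (a e′) → Parallel (a e) (a g) (a e′) (a g′) →
    Hexagon e f g e′ f′ g′
  hexagon e f g e′ f′ g′ If If′ Ig Jg Jg′ Jf Jee′ Jef Je′f Iee′ Ige Ige′ p₁ p₂ p₃
    with parallel-elim (λ eq → Iee′ (cong I eq))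
           (λ eq → Jee′ (trans (sym Jg) (trans (cong (λ e → J (b e)) (a-injective eq)) Jg′))) p₁
  ... | inj₁ (e<e′ , g<g′) = hexagon< If If′ Ig Jg Jg′ Jf Jee′ Jef Je′f
          (≤∧≢⇒< (I-mono (<⇒≤ e<e′)) Iee′) Ige Ige′ g<g′ p₂ p₃
  ... | inj₂ (e′<e , g′<g) = subst₂ _<_
          (cong₂ _+_ (+-comm ∣ b g′ - b e′ ∣ _) (∣-∣-comm (b f′) (b f)))
          (trans (+-assoc ∣ a g′ - a g ∣ _ _) (trans (cong₂ _+_ (∣-∣-comm (a g′) (a g)) (+-comm ∣ a f′ - a e′ ∣ _)) (sym (+-assoc ∣ a g - a g′ ∣ _ _))))
          (hexagon< If′ If (sym Ig) Jg′ Jg (sym Jf) (Jee′ ∘ sym) (λ eq → Je′f (trans eq (sym Jf))) (λ eq → Jef (trans eq (sym Jf)))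
            (≤∧≢⇒< (I-mono (<⇒≤ e′<e)) (Iee′ ∘ sym)) (λ eq → Ige′ (trans Ig eq)) (λ eq → Ige (trans Ig eq)) g′<g (sym p₂) (sym p₃))

-- Configurations excluded by rerouting both cycles

bool-pigeonhole : (x y z : Bool) → x ≡ y ⊎ x ≡ z ⊎ y ≡ z
bool-pigeonhole true  true  _     = inj₁ refl
bool-pigeonhole false false _     = inj₁ refl
bool-pigeonhole true  false true  = inj₂ (inj₁ refl)
bool-pigeonhole true  false false = inj₂ (inj₂ refl)
bool-pigeonhole false true  true  = inj₂ (inj₂ refl)
bool-pigeonhole false true  false = inj₂ (inj₁ refl)

bool-split : {x y : Bool} (z : Bool) → x ≢ y → z ≡ x ⊎ z ≡ y
bool-split {x} {y} z x≢y with bool-pigeonhole z x y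
... | inj₁ p        = inj₁ p
... | inj₂ (inj₁ p) = inj₂ p
... | inj₂ (inj₂ p) = ⊥-elim (x≢y p)

module TwoSided {n : ℕ} {G : Graph n} {ℓ k : ℕ} (long : 3 ≤ ℓ) (longest : Longest G ℓ) (L : LinkedCycles G ℓ k) where
  open LinkedCycles L
  private
    module C = OneSided long longest L
    module D = OneSided long longest (flip L)

  row col : Fin k → ℕ
  row e = I (a e)
  col e = J (b e)

  -- Rerouting `C` makes the stretch of `D` strictly shorter than that of `C`, and rerouting `D`
  -- gives the reverse. The cases differ only in the direction in which the stretches are read.
  digon-free : ∀ {e f} → row e ≡ row f → col e ≡ col f → e ≡ f
  digon-free {e} {f} r c with <-cmp (a e) (a f) | <-cmp (b e) (b f)
  ... | tri≈ _ p _ | _          = a-injective p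
  ... | tri< _ _ _ | tri≈ _ q _ = b-injective q
  ... | tri> _ _ _ | tri≈ _ q _ = b-injective q
  ... | tri< p _ _ | tri< q _ _ = ⊥-elim (<-asym (C.digon e f p c) (D.digon e f q r))
  ... | tri> _ _ p | tri> _ _ q = ⊥-elim (<-asym (C.digon f e p (sym c)) (D.digon f e q (sym r)))
  ... | tri< p _ _ | tri> _ _ q = ⊥-elim (<-asym (C.digon e f p c)
        (subst₂ _<_ (∣-∣-comm (a f) (a e)) (∣-∣-comm (b f) (b e)) (D.digon f e q (sym r))))
  ... | tri> _ _ p | tri< q _ _ = ⊥-elim (<-asym (C.digon f e p (sym c))
        (subst₂ _<_ (∣-∣-comm (a e) (a f)) (∣-∣-comm (b e) (b f)) (D.digon e f q r)))

  square-free : ∀ e₁ f₁ e₂ f₂ → row e₁ ≡ row f₁ → row e₂ ≡ row f₂ → row e₁ ≢ row e₂ →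
    col e₁ ≡ col e₂ → col f₁ ≡ col f₂ → col e₁ ≢ col f₁ →
    Parallel (a e₁) (a f₁) (a e₂) (a f₂) → Parallel (b e₁) (b e₂) (b f₁) (b f₂) → ⊥
  square-free e₁ f₁ e₂ f₂ r₁ r₂ r≢ c₁ c₂ c≢ p q =
    <-asym (C.square e₁ f₁ e₂ f₂ r₁ r₂ r≢ c₁ c₂ c≢ p) (D.square e₁ e₂ f₁ f₂ c₁ c₂ c≢ r₁ r₂ r≢ q)

  hexagon-free : ∀ e f g e′ f′ g′ → row f ≡ row e → row f′ ≡ row e′ → row g ≡ row g′ →
    col g ≡ col e → col g′ ≡ col e′ → col f ≡ col f′ →
    row e ≢ row e′ → row g ≢ row e → row g ≢ row e′ →
    col e ≢ col e′ → col f ≢ col e → col f ≢ col e′ →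
    Parallel (a e) (a e′) (a g) (a g′) → Parallel (a f) (a e) (a f′) (a e′) → Parallel (a e) (a g) (a e′) (a g′) →
    Parallel (b e) (b e′) (b f) (b f′) → Parallel (b g) (b e) (b g′) (b e′) → Parallel (b e) (b f) (b e′) (b f′) → ⊥
  hexagon-free e f g e′ f′ g′ rf rf′ rg cg cg′ cf r≢ rge rge′ c≢ cfe cfe′ p₁ p₂ p₃ q₁ q₂ q₃ =
    <-asym (C.hexagon e f g e′ f′ g′ rf rf′ rg cg cg′ cf c≢ (cfe ∘ sym) (cfe′ ∘ sym) r≢ rge rge′ p₁ p₂ p₃)
      (subst₂ _<_ (rotate ∣ a f - a e ∣ ∣ a f′ - a e′ ∣ ∣ a g - a g′ ∣)
                  (trans (+-assoc ∣ b f - b f′ ∣ _ _) (+-comm ∣ b f - b f′ ∣ _))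
        (D.hexagon e g f e′ g′ f′ cg cg′ cf rf rf′ rg r≢ (rge ∘ sym) (rge′ ∘ sym) c≢ cfe cfe′ q₁ q₂ q₃))
    where
    rotate : ∀ x y z → x + y + z ≡ z + x + y
    rotate x y z = trans (+-comm (x + y) z) (sym (+-assoc z x y))

  -- Two of the three rows order the two columns alike, which gives an excluded 4-cycle.
  two-columns : ∀ e g₁ g₂ e′ g₁′ g₂′ → col g₁ ≡ col e → col g₂ ≡ col e → col g₁′ ≡ col e′ → col g₂′ ≡ col e′ →
    row g₁ ≡ row g₁′ → row g₂ ≡ row g₂′ → row e ≡ row e′ → g₁ ≢ e → g₂ ≢ e → g₁ ≢ g₂ → e ≢ e′ →
    Parallel (b g₁) (b e) (b g₁′) (b e′) → Parallel (b g₂) (b e) (b g₂′) (b e′) → Parallel (b g₁) (b g₂) (b g₁′) (b g₂′) → ⊥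
  two-columns e g₁ g₂ e′ g₁′ g₂′ c₁ c₂ c₁′ c₂′ r₁ r₂ r g₁≢e g₂≢e g₁≢g₂ e≢e′ q₁ q₂ q₁₂
    with bool-pigeonhole (a g₁ <ᵇ a g₁′) (a g₂ <ᵇ a g₂′) (a e <ᵇ a e′)
  ... | inj₁ p = square-free g₁ g₁′ g₂ g₂′ r₁ r₂ (λ eq → g₁≢g₂ (digon-free eq (trans c₁ (sym c₂)))) (trans c₁ (sym c₂)) (trans c₁′ (sym c₂′))
        (λ eq → e≢e′ (digon-free r (trans (sym c₁) (trans eq c₁′)))) p q₁₂
  ... | inj₂ (inj₁ p) = square-free g₁ g₁′ e e′ r₁ r (λ eq → g₁≢e (digon-free eq c₁)) c₁ c₁′
        (λ eq → e≢e′ (digon-free r (trans (sym c₁) (trans eq c₁′)))) p q₁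
  ... | inj₂ (inj₂ p) = square-free g₂ g₂′ e e′ r₂ r (λ eq → g₂≢e (digon-free eq c₂)) c₂ c₂′
        (λ eq → e≢e′ (digon-free r (trans (sym c₂) (trans eq c₂′)))) p q₂

-- Stars and their codes

module Stars {n : ℕ} {G : Graph n} {ℓ k : ℕ} (long : 3 ≤ ℓ) (longest : Longest G ℓ) (L : LinkedCycles G ℓ k) where
  open LinkedCycles L
  open TwoSided long longest L
  private module Flip = TwoSided long longest (flip L)

  Star : Set
  Star = Fin k × (Fin k × Fin k) × (Fin k × Fin k)

  record IsStar (s : Star) : Set where
    e = proj₁ s
    f₁ = proj₁ (proj₁ (proj₂ s))
    f₂ = proj₂ (proj₁ (proj₂ s))
    g₁ = proj₁ (proj₂ (proj₂ s))
    g₂ = proj₂ (proj₂ (proj₂ s))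
    field
      row₁ : row f₁ ≡ row e
      row₂ : row f₂ ≡ row e
      col₁ : col g₁ ≡ col e
      col₂ : col g₂ ≡ col e
      f₁≢e : f₁ ≢ e
      f₂≢e : f₂ ≢ e
      g₁≢e : g₁ ≢ e
      g₂≢e : g₂ ≢ e
      f₁≢f₂ : f₁ ≢ f₂
      g₁≢g₂ : g₁ ≢ g₂

  -- For each cycle there are five bits: three order the edges that share the centre's segment of
  -- that cycle, and two compare the centre with the edges that end in the outer segments.
  code : Star → Vec ℕ 4 × Vec Bool 10
  code (e , (f₁ , f₂) , (g₁ , g₂)) =
    (row g₁ Vec.∷ row g₂ Vec.∷ col f₁ Vec.∷ col f₂ Vec.∷ Vec.[]) ,
    ((a f₁ <ᵇ a e) Vec.∷ (a f₂ <ᵇ a e) Vec.∷ (a f₁ <ᵇ a f₂) Vec.∷ (a e <ᵇ a g₁) Vec.∷ (a e <ᵇ a g₂) Vec.∷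
     (b g₁ <ᵇ b e) Vec.∷ (b g₂ <ᵇ b e) Vec.∷ (b g₁ <ᵇ b g₂) Vec.∷ (b e <ᵇ b f₁) Vec.∷ (b e <ᵇ b f₂) Vec.∷ Vec.[])

  code-injective : ∀ {s s′} → IsStar s → IsStar s′ → code s ≡ code s′ → s ≡ s′
  code-injective {s} {s′} S S′ eq = conclude (S.e Fin.≟ S′.e)
    where
    module S = IsStar S
    module S′ = IsStar S′
    seg : ∀ x → Vec.lookup (proj₁ (code s)) x ≡ Vec.lookup (proj₁ (code s′)) x
    seg x = cong (λ c → Vec.lookup (proj₁ c) x) eq
    bit : ∀ x → Vec.lookup (proj₂ (code s)) x ≡ Vec.lookup (proj₂ (code s′)) x
    bit x = cong (λ c → Vec.lookup (proj₂ c) x) eq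

    -- The edges g₁, g₁′, g₂, g₂′ form a 4-cycle on two columns, and the code already makes its
    -- order on `D` agree. Hence its two rows must order the columns oppositely.
    opposite-a : col S.e ≢ col S′.e → Parallel (a S.g₁) (a S′.g₁) (a S.g₂) (a S′.g₂) → ⊥
    opposite-a c≢ p = square-free S.g₁ S′.g₁ S.g₂ S′.g₂ (seg (# 0)) (seg (# 1))
      (λ q → S.g₁≢g₂ (digon-free q (trans S.col₁ (sym S.col₂)))) (trans S.col₁ (sym S.col₂)) (trans S′.col₁ (sym S′.col₂))
      (λ q → c≢ (trans (sym S.col₁) (trans q S′.col₁))) p (bit (# 7))

    opposite-b : row S.e ≢ row S′.e → Parallel (b S.f₁) (b S′.f₁) (b S.f₂) (b S′.f₂) → ⊥
    opposite-b r≢ p = Flip.square-free S.f₁ S′.f₁ S.f₂ S′.f₂ (seg (# 2)) (seg (# 3))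
      (λ q → S.f₁≢f₂ (digon-free (trans S.row₁ (sym S.row₂)) q)) (trans S.row₁ (sym S.row₂)) (trans S′.row₁ (sym S′.row₂))
      (λ q → r≢ (trans (sym S.row₁) (trans q S′.row₁))) p (bit (# 2))

    -- An outer row and an outer column close e and e′ up to a hexagon. The code supplies the orders
    -- within each star; the two hypotheses supply the orders across the stars.
    hexagons : row S.e ≢ row S′.e → col S.e ≢ col S′.e →
      Parallel (a S.e) (a S′.e) (a S.g₁) (a S′.g₁) ⊎ Parallel (a S.e) (a S′.e) (a S.g₂) (a S′.g₂) →
      Parallel (b S.e) (b S′.e) (b S.f₁) (b S′.f₁) ⊎ Parallel (b S.e) (b S′.e) (b S.f₂) (b S′.f₂) → ⊥
    hexagons r≢ c≢ (inj₁ p) (inj₁ q) = hexagon-free S.e S.f₁ S.g₁ S′.e S′.f₁ S′.g₁ S.row₁ S′.row₁ (seg (# 0)) S.col₁ S′.col₁ (seg (# 2)) r≢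
          (λ x → S.g₁≢e (digon-free x S.col₁)) (λ x → S′.g₁≢e (digon-free (trans (sym (seg (# 0))) x) S′.col₁)) c≢
          (λ x → S.f₁≢e (digon-free S.row₁ x)) (λ x → S′.f₁≢e (digon-free S′.row₁ (trans (sym (seg (# 2))) x)))
          p (bit (# 0)) (bit (# 3)) q (bit (# 5)) (bit (# 8))
    hexagons r≢ c≢ (inj₁ p) (inj₂ q) = hexagon-free S.e S.f₂ S.g₁ S′.e S′.f₂ S′.g₁ S.row₂ S′.row₂ (seg (# 0)) S.col₁ S′.col₁ (seg (# 3)) r≢
          (λ x → S.g₁≢e (digon-free x S.col₁)) (λ x → S′.g₁≢e (digon-free (trans (sym (seg (# 0))) x) S′.col₁)) c≢
          (λ x → S.f₂≢e (digon-free S.row₂ x)) (λ x → S′.f₂≢e (digon-free S′.row₂ (trans (sym (seg (# 3))) x)))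
          p (bit (# 1)) (bit (# 3)) q (bit (# 5)) (bit (# 9))
    hexagons r≢ c≢ (inj₂ p) (inj₁ q) = hexagon-free S.e S.f₁ S.g₂ S′.e S′.f₁ S′.g₂ S.row₁ S′.row₁ (seg (# 1)) S.col₂ S′.col₂ (seg (# 2)) r≢
          (λ x → S.g₂≢e (digon-free x S.col₂)) (λ x → S′.g₂≢e (digon-free (trans (sym (seg (# 1))) x) S′.col₂)) c≢
          (λ x → S.f₁≢e (digon-free S.row₁ x)) (λ x → S′.f₁≢e (digon-free S′.row₁ (trans (sym (seg (# 2))) x)))
          p (bit (# 0)) (bit (# 4)) q (bit (# 6)) (bit (# 8))
    hexagons r≢ c≢ (inj₂ p) (inj₂ q) = hexagon-free S.e S.f₂ S.g₂ S′.e S′.f₂ S′.g₂ S.row₂ S′.row₂ (seg (# 1)) S.col₂ S′.col₂ (seg (# 3)) r≢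
          (λ x → S.g₂≢e (digon-free x S.col₂)) (λ x → S′.g₂≢e (digon-free (trans (sym (seg (# 1))) x) S′.col₂)) c≢
          (λ x → S.f₂≢e (digon-free S.row₂ x)) (λ x → S′.f₂≢e (digon-free S′.row₂ (trans (sym (seg (# 3))) x)))
          p (bit (# 1)) (bit (# 4)) q (bit (# 6)) (bit (# 9))

    distinct-edges : S.e ≢ S′.e → ⊥
    distinct-edges e≢e′ with row S.e ≟ row S′.e | col S.e ≟ col S′.e
    ... | yes r | _ = two-columns S.e S.g₁ S.g₂ S′.e S′.g₁ S′.g₂ S.col₁ S.col₂ S′.col₁ S′.col₂ (seg (# 0)) (seg (# 1)) r
          S.g₁≢e S.g₂≢e S.g₁≢g₂ e≢e′ (bit (# 5)) (bit (# 6)) (bit (# 7))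
    ... | no _  | yes c = Flip.two-columns S.e S.f₁ S.f₂ S′.e S′.f₁ S′.f₂ S.row₁ S.row₂ S′.row₁ S′.row₂ (seg (# 2)) (seg (# 3)) c
          S.f₁≢e S.f₂≢e S.f₁≢f₂ e≢e′ (bit (# 0)) (bit (# 1)) (bit (# 2))
    -- The order of e against e′ is one bit beside two opposite ones, so it agrees with one of them,
    -- on each cycle separately.
    ... | no r≢ | no c≢ = hexagons r≢ c≢ (bool-split (a S.e <ᵇ a S′.e) (opposite-a c≢)) (bool-split (b S.e <ᵇ b S′.e) (opposite-b r≢))

    conclude : Dec (S.e ≡ S′.e) → s ≡ s′
    conclude (no e≢e′) = ⊥-elim (distinct-edges e≢e′)
    conclude (yes e≡e′) = cong₂ _,_ e≡e′ (cong₂ _,_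
      (cong₂ _,_ (same-row S.row₁ S′.row₁ (seg (# 2))) (same-row S.row₂ S′.row₂ (seg (# 3))))
      (cong₂ _,_ (same-col S.col₁ S′.col₁ (seg (# 0))) (same-col S.col₂ S′.col₂ (seg (# 1)))))
      where
      same-row : ∀ {f f′} → row f ≡ row S.e → row f′ ≡ row S′.e → col f ≡ col f′ → f ≡ f′
      same-row p q c = digon-free (trans p (trans (cong row e≡e′) (sym q))) c
      same-col : ∀ {g g′} → col g ≡ col S.e → col g′ ≡ col S′.e → row g ≡ row g′ → g ≡ g′
      same-col p q r = digon-free r (trans p (trans (cong col e≡e′) (sym q)))

-- Counting stars

module _ {A : Set} where

  private variable
    B : Set
    xs : List A

  length-product : ∀ {C : Set} (f : A → B → C) xs ys → length (cartesianProductWith f xs ys) ≡ length xs * length ys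
  length-product f []       ys = refl
  length-product f (x ∷ xs) ys = trans (length-++ (map (f x) ys)) (cong₂ _+_ (length-map (f x) ys) (length-product f xs ys))

  unique-map : (f : A → B) → (∀ {x y} → x ∈ xs → y ∈ xs → f x ≡ f y → x ≡ y) → Unique xs → Unique (map f xs)
  unique-map f inj [] = []
  unique-map f inj (x∉ ∷ u) = unique-∷
    (λ p → case ∈-map⁻ f p of λ (y , y∈ , eq) → All¬⇒¬Any x∉ (subst (_∈ _) (sym (inj (here refl) (there y∈) eq)) y∈))
    (unique-map f (λ p q → inj (there p) (there q)) u)

  length-concatMap : ∀ (f : A → List B) {c} xs → (∀ {x} → x ∈ xs → c ≤ length (f x)) → length xs * c ≤ length (concatMap f xs)
  length-concatMap f []       _ = z≤n
  length-concatMap f (x ∷ xs) h = ≤-trans (+-mono-≤ (h (here refl)) (length-concatMap f xs (h ∘ there)))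
    (≤-reflexive (sym (length-++ (f x))))

  ∈-concatMap : ∀ (f : A → List B) xs {z} → z ∈ concatMap f xs → ∃[ x ] (x ∈ xs × z ∈ f x)
  ∈-concatMap f (x ∷ xs) p with ∈-++⁻ (f x) p
  ... | inj₁ q = x , here refl , q
  ... | inj₂ q with ∈-concatMap f xs q
  ... | y , y∈ , r = y , there y∈ , r

  unique-concatMap : ∀ (f : A → List B) → Unique xs → (∀ x → Unique (f x)) →
    (∀ {x y z} → z ∈ f x → z ∈ f y → x ≡ y) → Unique (concatMap f xs)
  unique-concatMap f [] _ _ = []
  unique-concatMap f (x∉ ∷ u) uf inj = unique-++ (uf _) (unique-concatMap f u uf inj) λ p q →
    case ∈-concatMap f _ q of λ (y , y∈ , r) → All¬⇒¬Any x∉ (subst (_∈ _) (sym (inj p r)) y∈)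

  filter-split : ∀ {P : A → Set} (P? : ∀ x → Dec (P x)) xs →
    length xs ≡ length (filter P? xs) + length (filter (λ x → ¬? (P? x)) xs)
  filter-split P? [] = refl
  filter-split P? (x ∷ xs) with P? x
  ... | yes _ = cong suc (filter-split P? xs)
  ... | no  _ = trans (cong suc (filter-split P? xs)) (sym (+-suc (length (filter P? xs)) _))

  -- Classes are split off from the largest label downwards. The bound is demanded only of inhabited
  -- classes, since its proof may use a representative.
  fibres : (f : A → ℕ) (c : ℕ) → ∀ M xs → Unique xs → (∀ {x} → x ∈ xs → f x < M) →
    (∀ {x} ys → x ∈ xs → Unique ys → (∀ {y} → y ∈ ys → y ∈ xs × f y ≡ f x) → length ys ≤ c) →
    length xs ≤ M * c
  fibres f c zero [] _ _ _ = z≤n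
  fibres f c zero (x ∷ xs) _ lt _ = ⊥-elim (n≮0 (lt (here refl)))
  fibres f c (suc M) xs u lt small = begin
      length xs                                                   ≡⟨ filter-split P? xs ⟩
      length (filter P? xs) + length (filter (λ x → ¬? (P? x)) xs)  ≤⟨ +-mono-≤ (top (filter P? xs) refl) rest ⟩
      c + M * c                                                   ∎
    where
    open ≤-Reasoning
    P? : ∀ x → Dec (f x ≡ M)
    P? x = f x ≟ M
    top : ∀ ys → filter P? xs ≡ ys → length ys ≤ c
    top [] _ = z≤n
    top (y ∷ ys) eq = small (y ∷ ys) (proj₁ (mem (here refl))) (subst Unique eq (Unq.filter⁺ P? u))
        λ z∈ → Data.Product.map₂ (λ q → trans q (sym (proj₂ (mem (here refl))))) (mem z∈)
      where
      mem : ∀ {z} → z ∈ y ∷ ys → z ∈ xs × f z ≡ M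
      mem z∈ = ∈-filter⁻ P? (subst (_ ∈_) (sym eq) z∈)
    mem : ∀ {z} → z ∈ filter (λ x → ¬? (P? x)) xs → z ∈ xs × f z ≢ M
    mem = ∈-filter⁻ (λ x → ¬? (P? x))
    rest : length (filter (λ x → ¬? (P? x)) xs) ≤ M * c
    rest = fibres f c M _ (Unq.filter⁺ _ u)
      (λ z∈ → ≤∧≢⇒< (m<1+n⇒m≤n (lt (proj₁ (mem z∈)))) (proj₂ (mem z∈)))
      λ ys x∈ uy h → small ys (proj₁ (mem x∈)) uy (λ y∈ → proj₁ (mem (proj₁ (h y∈))) , proj₂ (h y∈))

  vecs : List A → ∀ m → List (Vec A m)
  vecs xs zero    = Vec.[] ∷ []
  vecs xs (suc m) = cartesianProductWith Vec._∷_ xs (vecs xs m)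

  -- h² ordered pairs of distinct entries: one from the first h entries, one from the others.
  pairs : ℕ → List A → List (A × A)
  pairs h xs = cartesianProduct (take h xs) (drop h xs)

  take-or-drop : ∀ h (xs : List A) → Unique xs → ∀ {x y} → x ∈ take h xs → y ∈ drop h xs → x ∈ xs × y ∈ xs × x ≢ y
  take-or-drop zero    xs       u        () q
  take-or-drop (suc h) (z ∷ xs) (z∉ ∷ u) (here refl) q = here refl , there (drop⊆ h xs q) ,
    λ { refl → All¬⇒¬Any z∉ (drop⊆ h xs q) }
    where
    drop⊆ : ∀ h (xs : List A) {y} → y ∈ drop h xs → y ∈ xs
    drop⊆ zero    xs       p = p
    drop⊆ (suc h) (x ∷ xs) p = there (drop⊆ h xs p)
  take-or-drop (suc h) (z ∷ xs) (z∉ ∷ u) (there p) q with take-or-drop h xs u p q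
  ... | x∈ , y∈ , x≢y = there x∈ , there y∈ , x≢y

  length-pairs : ∀ h xs → 2 * h ≤ length xs → h * h ≤ length (pairs h xs)
  length-pairs h xs 2h≤ = begin
      h * h                                     ≤⟨ *-mono-≤ t d ⟩
      length (take h xs) * length (drop h xs)   ≡⟨ length-product _,_ (take h xs) (drop h xs) ⟨
      length (pairs h xs)                       ∎
    where
    open ≤-Reasoning
    h+h≤ : h + h ≤ length xs
    h+h≤ = subst (λ x → h + x ≤ length xs) (+-identityʳ h) 2h≤
    t : h ≤ length (take h xs)
    t = ≤-reflexive (sym (trans (length-take h xs) (m≤n⇒m⊓n≡m (≤-trans (m≤m+n h h) h+h≤))))
    d : h ≤ length (drop h xs)
    d = ≤-trans (m+n≤o⇒m≤o∸n h h+h≤) (≤-reflexive (sym (length-drop h xs)))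

  unique-pairs : ∀ h → Unique xs → Unique (pairs h xs)
  unique-pairs h u = Unq.cartesianProduct⁺ (Unq.take⁺ h u) (Unq.drop⁺ h u)

length-vecs : ∀ {A : Set} (xs : List A) m → length (vecs xs m) ≡ length xs ^ m
length-vecs xs zero    = refl
length-vecs xs (suc m) = trans (length-product Vec._∷_ xs (vecs xs m)) (cong (length xs *_) (length-vecs xs m))

∈-vecs : ∀ {A : Set} {xs : List A} {m} (v : Vec A m) → (∀ i → Vec.lookup v i ∈ xs) → v ∈ vecs xs m
∈-vecs Vec.[]      _ = here refl
∈-vecs (x Vec.∷ v) h = ∈-cartesianProductWith⁺ Vec._∷_ (h zero) (∈-vecs v (h ∘ suc))

box : ℕ → ∀ r s → List (Vec ℕ r × Vec Bool s)
box M r s = cartesianProduct (vecs (upTo M) r) (vecs (true ∷ false ∷ []) s)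

length-box : ∀ M r s → length (box M r s) ≡ M ^ r * 2 ^ s
length-box M r s = trans (length-product _,_ (vecs (upTo M) r) (vecs (true ∷ false ∷ []) s))
  (cong₂ _*_ (trans (length-vecs (upTo M) r) (cong (_^ r) (length-upTo M))) (length-vecs (true ∷ false ∷ []) s))

∈-box : ∀ {M r s} (v : Vec ℕ r) (w : Vec Bool s) → (∀ i → Vec.lookup v i < M) → (v , w) ∈ box M r s
∈-box v w v< = ∈-cartesianProduct⁺ (∈-vecs v λ i → ∈-upTo⁺ (v< i)) (∈-vecs w λ i → ∈-bool (Vec.lookup w i))
  where
  ∈-bool : ∀ x → x ∈ true ∷ false ∷ []
  ∈-bool true  = here refl
  ∈-bool false = there (here refl)

module Counting {n : ℕ} {G : Graph n} {ℓ k : ℕ} (long : 3 ≤ ℓ) (longest : Longest G ℓ) (L : LinkedCycles G ℓ k)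
                (M h : ℕ) (8hM≤k : h * (8 * M) ≤ k)
                (I<M : ∀ e → LinkedCycles.I L (LinkedCycles.a L e) < M)
                (J<M : ∀ e → LinkedCycles.J L (LinkedCycles.b L e) < M) where
  open TwoSided long longest L
  open Stars long longest L

  code∈ : ∀ s → code s ∈ box M 4 10
  code∈ (e , (f₁ , f₂) , (g₁ , g₂)) = ∈-box _ _
    λ { zero → I<M g₁ ; (suc zero) → I<M g₂
      ; (suc (suc zero)) → J<M f₁ ; (suc (suc (suc zero))) → J<M f₂ }

  module Class (label : Fin k → ℕ) (label< : ∀ e → label e < M) where

    others : Fin k → List (Fin k)
    others e = filter (λ f → label f ≟ label e ×-dec ¬? (f Fin.≟ e)) (allFin k)

    others-unique : ∀ e → Unique (others e)
    others-unique e = Unq.filter⁺ _ (Unq.allFin⁺ k)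

    ∈-others : ∀ {e f} → f ∈ others e → label f ≡ label e × f ≢ e
    ∈-others {e} p = proj₂ (∈-filter⁻ (λ f → label f ≟ label e ×-dec ¬? (f Fin.≟ e)) {xs = allFin k} p)

    big? : ∀ e → Dec (2 * h ≤ length (others e))
    big? e = 2 * h ≤? length (others e)

    -- An edge with fewer than 2h others in its class lies in a class of at most 2h edges, and there
    -- are at most `M` classes.
    few-small : length (filter (λ e → ¬? (big? e)) (allFin k)) ≤ M * (2 * h)
    few-small = fibres label (2 * h) M _ (Unq.filter⁺ _ (Unq.allFin⁺ k)) (λ {e} _ → label< e)
      λ {e} ys e∈ u same → ≤-trans (unique-⊆-length {ys = e ∷ others e} u λ {y} y∈ → in-class (proj₂ (same y∈)))
        (≰⇒> (proj₂ (∈-filter⁻ (λ e → ¬? (big? e)) {xs = allFin k} e∈)))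
      where
      in-class : ∀ {e y} → label y ≡ label e → y ∈ e ∷ others e
      in-class {e} {y} eq with y Fin.≟ e
      ... | yes refl = here refl
      ... | no y≢e   = there (∈-filter⁺ _ (∈-allFin y) (eq , y≢e))

  module R = Class row I<M
  module K = Class col J<M

  good : List (Fin k)
  good = filter K.big? (filter R.big? (allFin k))

  ∈-good : ∀ {e} → e ∈ good → 2 * h ≤ length (R.others e) × 2 * h ≤ length (K.others e)
  ∈-good p with ∈-filter⁻ K.big? p
  ... | q , kb = proj₂ (∈-filter⁻ R.big? {xs = allFin k} q) , kb

  starsAt : Fin k → List Star
  starsAt e = map (e ,_) (cartesianProduct (pairs h (R.others e)) (pairs h (K.others e)))

  stars : List Star
  stars = concatMap starsAt good

  stars-unique : Unique stars
  stars-unique = unique-concatMap starsAt (Unq.filter⁺ _ (Unq.filter⁺ _ (Unq.allFin⁺ k)))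
    (λ e → Unq.map⁺ (λ { refl → refl })
      (Unq.cartesianProduct⁺ (unique-pairs h (R.others-unique e)) (unique-pairs h (K.others-unique e))))
    λ p q → trans (sym (centre p)) (centre q)
    where
    centre : ∀ {x z} → z ∈ starsAt x → proj₁ z ≡ x
    centre p with ∈-map⁻ _ p
    ... | _ , _ , refl = refl

  stars-are : ∀ {s} → s ∈ stars → IsStar s
  stars-are p with ∈-concatMap starsAt good p
  ... | e , _ , q with ∈-map⁻ (e ,_) q
  ... | ((f₁ , f₂) , (g₁ , g₂)) , r , refl with ∈-cartesianProduct⁻ (pairs h (R.others e)) _ r
  ... | pf , pg with ∈-cartesianProduct⁻ (take h (R.others e)) _ pf | ∈-cartesianProduct⁻ (take h (K.others e)) _ pg
  ... | f₁∈ , f₂∈ | g₁∈ , g₂∈ with take-or-drop h _ (R.others-unique e) f₁∈ f₂∈ | take-or-drop h _ (K.others-unique e) g₁∈ g₂∈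
  ... | f₁o , f₂o , f≢ | g₁o , g₂o , g≢ = record
    { row₁ = proj₁ (R.∈-others f₁o) ; row₂ = proj₁ (R.∈-others f₂o)
    ; col₁ = proj₁ (K.∈-others g₁o) ; col₂ = proj₁ (K.∈-others g₂o)
    ; f₁≢e = proj₂ (R.∈-others f₁o) ; f₂≢e = proj₂ (R.∈-others f₂o)
    ; g₁≢e = proj₂ (K.∈-others g₁o) ; g₂≢e = proj₂ (K.∈-others g₂o)
    ; f₁≢f₂ = f≢ ; g₁≢g₂ = g≢ }

  stars-few : length stars ≤ M ^ 4 * 2 ^ 10
  stars-few = begin
      length stars              ≡⟨ length-map code stars ⟨
      length (map code stars)   ≤⟨ unique-⊆-length (unique-map code (λ p q → code-injective (stars-are p) (stars-are q)) stars-unique) sub ⟩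
      length (box M 4 10)       ≡⟨ length-box M 4 10 ⟩
      M ^ 4 * 2 ^ 10            ∎
    where
    open ≤-Reasoning
    sub : ∀ {c} → c ∈ map code stars → c ∈ box M 4 10
    sub p with ∈-map⁻ code p
    ... | s , _ , refl = code∈ s

  stars-many : length good * (h * h * (h * h)) ≤ length stars
  stars-many = length-concatMap starsAt good λ {e} e∈ → begin
      h * h * (h * h)   ≤⟨ *-mono-≤ (length-pairs h (R.others e) (proj₁ (∈-good e∈))) (length-pairs h (K.others e) (proj₂ (∈-good e∈))) ⟩
      length (pairs h (R.others e)) * length (pairs h (K.others e))  ≡⟨ length-product _,_ (pairs h (R.others e)) _ ⟨
      length (cartesianProduct (pairs h (R.others e)) (pairs h (K.others e))) ≡⟨ length-map (e ,_) (cartesianProduct (pairs h (R.others e)) (pairs h (K.others e))) ⟨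
      length (starsAt e) ∎
    where open ≤-Reasoning

  -- At most 2Mh edges are lost to small rows and as many to small columns; by 8hM ≤ k this is at
  -- most half of all edges.
  good-many : k ≤ 2 * length good
  good-many = +-cancelʳ-≤ k _ _ (begin
      k + k                                      ≡⟨ cong (k +_) (+-identityʳ k) ⟨
      2 * k                                      ≤⟨ *-monoʳ-≤ 2 split ⟩
      2 * (length good + M * (2 * h) + M * (2 * h)) ≡⟨ solve 3 (λ g M h → con 2 :* (g :+ M :* (con 2 :* h) :+ M :* (con 2 :* h)) := con 2 :* g :+ h :* (con 8 :* M)) refl (length good) M h ⟩
      2 * length good + h * (8 * M)              ≤⟨ +-monoʳ-≤ (2 * length good) (8hM≤k) ⟩
      2 * length good + k                        ∎)
    where
    open ≤-Reasoning
    open +-*-Solver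
    R-list = filter R.big? (allFin k)
    split : k ≤ length good + M * (2 * h) + M * (2 * h)
    split = begin
      k                        ≡⟨ length-tabulate {n = k} id ⟨
      length (allFin k)        ≡⟨ filter-split R.big? (allFin k) ⟩
      length R-list + length (filter (λ e → ¬? (R.big? e)) (allFin k)) ≡⟨ cong (_+ length (filter (λ e → ¬? (R.big? e)) (allFin k))) (filter-split K.big? R-list) ⟩
      length good + length (filter (λ e → ¬? (K.big? e)) R-list) + length (filter (λ e → ¬? (R.big? e)) (allFin k))
        ≤⟨ +-mono-≤ (+-monoʳ-≤ (length good) (≤-trans (unique-⊆-length (Unq.filter⁺ _ (Unq.filter⁺ _ (Unq.allFin⁺ k))) sub) K.few-small)) R.few-small ⟩
      length good + M * (2 * h) + M * (2 * h) ∎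
      where
      sub : ∀ {z} → z ∈ filter (λ e → ¬? (K.big? e)) R-list → z ∈ filter (λ e → ¬? (K.big? e)) (allFin k)
      sub {z} p = ∈-filter⁺ _ (∈-allFin z) (proj₂ (∈-filter⁻ (λ e → ¬? (K.big? e)) {xs = R-list} p))

-- The bound on the number of links

^-distribʳ-* : ∀ k m n → (m * n) ^ k ≡ m ^ k * n ^ k
^-distribʳ-* zero    m n = refl
^-distribʳ-* (suc k) m n = trans (cong (m * n *_) (^-distribʳ-* k m n))
  (solve 4 (λ a b c d → (a :* b) :* (c :* d) := (a :* c) :* (b :* d)) refl m n (m ^ k) (n ^ k))
  where open +-*-Solver

-- Of the five factors k, one is charged to the number g of good centres and four to the h⁴ stars at
-- each of them.
few-links-dense : ∀ {k g M h} c d → k ≤ 2 * g → g * (h * h * (h * h)) ≤ M ^ 4 * d → k ≤ c * (M * h) →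
  k ^ 5 ≤ 2 * c ^ 4 * d * M ^ 8
few-links-dense {k} {g} {M} {h} c d k≤2g stars k≤ = begin
    k * k ^ 4                                        ≤⟨ *-mono-≤ k≤2g (^-monoˡ-≤ 4 k≤) ⟩
    2 * g * (c * (M * h)) ^ 4                        ≡⟨ regroup ⟩
    2 * c ^ 4 * (M ^ 4 * (g * (h * h * (h * h))))    ≤⟨ *-monoʳ-≤ (2 * c ^ 4) (*-monoʳ-≤ (M ^ 4) stars) ⟩
    2 * c ^ 4 * (M ^ 4 * (M ^ 4 * d))                ≡⟨ collect (2 * c ^ 4) ⟩
    2 * c ^ 4 * d * M ^ 8                            ∎
  where
  open ≤-Reasoning
  open +-*-Solver
  regroup : 2 * g * (c * (M * h)) ^ 4 ≡ 2 * c ^ 4 * (M ^ 4 * (g * (h * h * (h * h))))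
  regroup = begin-equality
    2 * g * (c * (M * h)) ^ 4            ≡⟨ cong (2 * g *_) (trans (^-distribʳ-* 4 c (M * h)) (cong (c ^ 4 *_) (^-distribʳ-* 4 M h))) ⟩
    2 * g * (c ^ 4 * (M ^ 4 * h ^ 4))    ≡⟨ cong (λ x → 2 * g * (c ^ 4 * (M ^ 4 * x))) (solve 1 (λ h → h :* (h :* (h :* (h :* con 1))) := h :* h :* (h :* h)) refl h) ⟩
    2 * g * (c ^ 4 * (M ^ 4 * (h * h * (h * h))))
      ≡⟨ solve 4 (λ g x y z → con 2 :* g :* (x :* (y :* z)) := con 2 :* x :* (y :* (g :* z))) refl g (c ^ 4) (M ^ 4) (h * h * (h * h)) ⟩
    2 * c ^ 4 * (M ^ 4 * (g * (h * h * (h * h)))) ∎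
  collect : ∀ c → c * (M ^ 4 * (M ^ 4 * d)) ≡ c * d * M ^ 8
  collect c = trans (solve 3 (λ x c d → c :* (x :* (x :* d)) := c :* d :* (x :* x)) refl (M ^ 4) c d)
    (cong (c * d *_) (sym (^-distribˡ-+-* M 4 4)))

few-links-sparse : ∀ {k M} c → 1 ≤ M → k ≤ c * M → k ^ 5 ≤ c ^ 5 * M ^ 8
few-links-sparse {k} {M} c M≥1 k≤ = begin
    k ^ 5          ≤⟨ ^-monoˡ-≤ 5 k≤ ⟩
    (c * M) ^ 5    ≡⟨ ^-distribʳ-* 5 c M ⟩
    c ^ 5 * M ^ 5  ≤⟨ *-monoʳ-≤ (c ^ 5) (^-monoʳ-≤ M {{>-nonZero M≥1}} (≤ᵇ⇒≤ 5 8 tt)) ⟩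
    c ^ 5 * M ^ 8  ∎
  where open ≤-Reasoning

-- For h = 0 counting stars gives nothing, but then k ≤ 8M is enough. Otherwise h + 1 ≤ 2h gives k ≤
-- 16Mh, and 2²⁷ is 2 · 16⁴ · 2¹⁰.
few-links-arith : ∀ k g M h → 1 ≤ M → k ≤ 2 * g → g * (h * h * (h * h)) ≤ M ^ 4 * 2 ^ 10 → k ≤ suc h * (8 * M) →
  k ^ 5 ≤ 2 ^ 27 * M ^ 8
few-links-arith k g M zero M≥1 _ _ k≤ =
  ≤-trans (few-links-sparse {k} {M} 8 M≥1 (≤-trans k≤ (≤-reflexive (*-identityˡ (8 * M)))))
    (*-monoˡ-≤ (M ^ 8) (≤ᵇ⇒≤ (8 ^ 5) (2 ^ 27) tt))
few-links-arith k g M h@(suc _) _ k≤2g stars k≤ =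
  ≤-trans (few-links-dense {k} {g} {M} {h} 16 (2 ^ 10) k≤2g stars k≤′)
    (*-monoˡ-≤ (M ^ 8) (≤ᵇ⇒≤ (2 * 16 ^ 4 * 2 ^ 10) (2 ^ 27) tt))
  where
  open ≤-Reasoning
  open +-*-Solver
  k≤′ : k ≤ 16 * (M * h)
  k≤′ = begin
    k                   ≤⟨ k≤ ⟩
    suc h * (8 * M)     ≤⟨ *-monoˡ-≤ (8 * M) (+-monoˡ-≤ h {1} {h} (s≤s z≤n)) ⟩
    (h + h) * (8 * M)   ≡⟨ solve 2 (λ h M → (h :+ h) :* (con 8 :* M) := con 16 :* (M :* h)) refl h M ⟩
    16 * (M * h)        ∎

-- Abstract, so that the numeral 2 ^ 27 is never unfolded.
abstract
  FewLinks : ℕ → ℕ → Set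
  FewLinks k m = k ^ 5 ≤ 2 ^ 27 * suc m ^ 8

  fewLinks⁻ : ∀ {k m} → FewLinks k m → k ^ 5 ≤ 2 ^ 27 * suc m ^ 8
  fewLinks⁻ p = p

  few-links : ∀ {n} {G : Graph n} {ℓ k} → 3 ≤ ℓ → Longest G ℓ → (L : LinkedCycles G ℓ k) → ∀ m →
    (∀ e → LinkedCycles.I L (LinkedCycles.a L e) < suc m) → (∀ e → LinkedCycles.J L (LinkedCycles.b L e) < suc m) →
    FewLinks k m
  few-links {k = k} long longest L m I< J< = few-links-arith k (length good) (suc m) (k / (8 * suc m)) (s≤s z≤n) good-many
    (≤-trans stars-many stars-few) (begin
      k                                              ≡⟨ m≡m%n+[m/n]*n k (8 * suc m) ⟩
      k % (8 * suc m) + k / (8 * suc m) * (8 * suc m) ≤⟨ +-monoˡ-≤ _ (<⇒≤ (m%n<n k (8 * suc m))) ⟩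
      suc (k / (8 * suc m)) * (8 * suc m)            ∎)
    where
    open Counting long longest L (suc m) (k / (8 * suc m)) (m/n*n≤m k (8 * suc m)) I< J<
    open ≤-Reasoning

-- Averaging over the automorphism group

∑ : ∀ {A : Set} → List A → (A → ℕ) → ℕ
∑ []       f = 0
∑ (x ∷ xs) f = f x + ∑ xs f

∑-+ : ∀ {A : Set} (xs : List A) f g → ∑ xs (λ x → f x + g x) ≡ ∑ xs f + ∑ xs g
∑-+ []       f g = refl
∑-+ (x ∷ xs) f g = trans (cong (f x + g x +_) (∑-+ xs f g))
  (solve 4 (λ a b c d → (a :+ b) :+ (c :+ d) := (a :+ c) :+ (b :+ d)) refl (f x) (g x) (∑ xs f) (∑ xs g))
  where open +-*-Solver

∑-const : ∀ {A : Set} (xs : List A) c → ∑ xs (λ _ → c) ≡ length xs * c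
∑-const []       c = refl
∑-const (x ∷ xs) c = cong (c +_) (∑-const xs c)

module _ {A : Set} where

  ∑-mono : ∀ (xs : List A) {f g} → (∀ {x} → x ∈ xs → f x ≤ g x) → ∑ xs f ≤ ∑ xs g
  ∑-mono []       h = z≤n
  ∑-mono (x ∷ xs) h = +-mono-≤ (h (here refl)) (∑-mono xs (h ∘ there))

  ∑-cong : ∀ (xs : List A) {f g} → (∀ x → f x ≡ g x) → ∑ xs f ≡ ∑ xs g
  ∑-cong []       h = refl
  ∑-cong (x ∷ xs) h = cong₂ _+_ (h x) (∑-cong xs h)

  ∑-* : ∀ c (xs : List A) f → c * ∑ xs f ≡ ∑ xs (λ x → c * f x)
  ∑-* c []       f = *-zeroʳ c
  ∑-* c (x ∷ xs) f = trans (*-distribˡ-+ c (f x) _) (cong (c * f x +_) (∑-* c xs f))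

  ∑-swap : ∀ {B : Set} (xs : List A) (ys : List B) (f : A → B → ℕ) →
    ∑ xs (λ x → ∑ ys (f x)) ≡ ∑ ys (λ y → ∑ xs (λ x → f x y))
  ∑-swap []       ys f = sym (trans (∑-const ys 0) (*-zeroʳ (length ys)))
  ∑-swap (x ∷ xs) ys f = trans (cong (∑ ys (f x) +_) (∑-swap xs ys f)) (sym (∑-+ ys (f x) _))

indicator : ∀ {P : Set} → Dec P → ℕ
indicator (yes _) = 1
indicator (no _)  = 0

length-filter-∑ : ∀ {A : Set} {P : A → Set} (P? : ∀ x → Dec (P x)) xs → length (filter P? xs) ≡ ∑ xs (λ x → indicator (P? x))
length-filter-∑ P? [] = refl
length-filter-∑ P? (x ∷ xs) with P? x
... | yes _ = cong suc (length-filter-∑ P? xs)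
... | no _  = length-filter-∑ P? xs

record Automorphism {n : ℕ} (G : Graph n) : Set where
  field
    to        : Fin n → Fin n
    injective : Injective _≡_ _≡_ to
    preserves : ∀ u v → adj G (to u) (to v) ≡ adj G u v

module Averaging {n : ℕ} (G : Graph (suc n)) (vt : VertexTransitive G) where
  private
    V = Fin (suc n)

  IsAut : Vec V (suc n) → Set
  IsAut g = Injective _≡_ _≡_ (Vec.lookup g) × (∀ u v → adj G (Vec.lookup g u) (Vec.lookup g v) ≡ adj G u v)

  isAut? : ∀ g → Dec (IsAut g)
  isAut? g = injective? g ×-dec all? λ u → all? λ v → _ Bool.≟ _

  -- Vectors of values turn the automorphism group into a list without repetition, over which sums
  -- can be taken.
  Γ : List (Vec V (suc n))
  Γ = filter isAut? (vecs (allFin (suc n)) (suc n))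

  ∈-Γ⁺ : ∀ {g} → IsAut g → g ∈ Γ
  ∈-Γ⁺ {g} p = ∈-filter⁺ isAut? (∈-vecs g λ i → ∈-allFin _) p

  ∈-Γ⁻ : ∀ {g} → g ∈ Γ → IsAut g
  ∈-Γ⁻ p = proj₂ (∈-filter⁻ isAut? {xs = vecs (allFin (suc n)) (suc n)} p)

  vecs-unique : ∀ m → Unique (vecs (allFin (suc n)) m)
  vecs-unique zero    = [] ∷ []
  vecs-unique (suc m) = Unq.cartesianProductWith⁺ Vec._∷_ VecP.∷-injective (Unq.allFin⁺ _) (vecs-unique m)

  Γ-unique : Unique Γ
  Γ-unique = Unq.filter⁺ isAut? (vecs-unique (suc n))

  σ-injective : ∀ {u v} → Injective _≡_ _≡_ (Inverse.to (proj₁ (vt u v)))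
  σ-injective {u} {v} {x} {y} eq = trans (sym (Inverse.strictlyInverseʳ σ x)) (trans (cong (Inverse.from σ) eq) (Inverse.strictlyInverseʳ σ y))
    where σ = proj₁ (vt u v)

  sends? : ∀ a b (g : Vec V (suc n)) → Dec (Vec.lookup g a ≡ b)
  sends? a b g = Vec.lookup g a Fin.≟ b

  N : V → V → ℕ
  N a b = ∑ Γ (λ g → indicator (sends? a b g))

  -- Composition with an automorphism from `b` to `c` is injective on the automorphisms that send
  -- `a` to `b`. As `b` and `c` are arbitrary, all targets of `a` are equally frequent.
  N-target : ∀ a b c → N a b ≤ N a c
  N-target a b c = begin
      N a b                                            ≡⟨ length-filter-∑ (sends? a b) Γ ⟨
      length (filter (sends? a b) Γ)                   ≡⟨ length-map (Vec.map τ) (filter (sends? a b) Γ) ⟨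
      length (map (Vec.map τ) (filter (sends? a b) Γ)) ≤⟨ unique-⊆-length (Unq.map⁺ map-τ-injective (Unq.filter⁺ (sends? a b) Γ-unique)) sub ⟩
      length (filter (sends? a c) Γ)                   ≡⟨ length-filter-∑ (sends? a c) Γ ⟩
      N a c                                            ∎
    where
    open ≤-Reasoning
    τ = Inverse.to (proj₁ (vt b c))
    map-τ-injective : ∀ {m} {v w : Vec V m} → Vec.map τ v ≡ Vec.map τ w → v ≡ w
    map-τ-injective {v = Vec.[]}    {Vec.[]}    _  = refl
    map-τ-injective {v = x Vec.∷ v} {y Vec.∷ w} eq =
      cong₂ Vec._∷_ (σ-injective (VecP.∷-injectiveˡ eq)) (map-τ-injective (VecP.∷-injectiveʳ eq))
    sub : ∀ {g} → g ∈ map (Vec.map τ) (filter (sends? a b) Γ) → g ∈ filter (sends? a c) Γ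
    sub p with ∈-map⁻ (Vec.map τ) p
    ... | g , g∈ , refl with ∈-filter⁻ (sends? a b) g∈
    ... | g∈Γ , refl = ∈-filter⁺ (sends? a c) (∈-Γ⁺ (inj′ , pres)) (trans (VecP.lookup-map a τ g) (proj₂ (proj₂ (vt b c))))
      where
      inj′ : Injective _≡_ _≡_ (Vec.lookup (Vec.map τ g))
      inj′ {x} {y} eq = proj₁ (∈-Γ⁻ g∈Γ) (σ-injective (trans (sym (VecP.lookup-map x τ g)) (trans eq (VecP.lookup-map y τ g))))
      pres : ∀ u v → adj G (Vec.lookup (Vec.map τ g) u) (Vec.lookup (Vec.map τ g) v) ≡ adj G u v
      pres u v = trans (cong₂ (adj G) (VecP.lookup-map u τ g) (VecP.lookup-map v τ g))
        (trans (proj₁ (proj₂ (vt b c)) _ _) (proj₂ (∈-Γ⁻ g∈Γ) u v))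

  N-uniform : ∀ a b → suc n * N a b ≤ length Γ
  N-uniform a b = begin
      suc n * N a b                                              ≡⟨ cong (_* N a b) (length-tabulate {n = suc n} id) ⟨
      length (allFin (suc n)) * N a b                            ≡⟨ ∑-const (allFin (suc n)) (N a b) ⟨
      ∑ (allFin (suc n)) (λ _ → N a b)                           ≤⟨ ∑-mono (allFin (suc n)) (λ {c} _ → N-target a b c) ⟩
      ∑ (allFin (suc n)) (λ c → N a c)                           ≡⟨ ∑-swap (allFin (suc n)) Γ _ ⟩
      ∑ Γ (λ g → ∑ (allFin (suc n)) (λ c → indicator (sends? a c g)))  ≤⟨ ∑-mono Γ (λ {g} _ → one (Vec.lookup g a)) ⟩
      ∑ Γ (λ _ → 1)                                              ≡⟨ ∑-const Γ 1 ⟩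
      length Γ * 1                                               ≡⟨ *-identityʳ _ ⟩
      length Γ                                                   ∎
    where
    open ≤-Reasoning
    one : ∀ u → ∑ (allFin (suc n)) (λ c → indicator (u Fin.≟ c)) ≤ 1
    one u = subst (_≤ 1) (length-filter-∑ (u Fin.≟_) (allFin (suc n)))
      (unique-⊆-length {ys = u ∷ []} (Unq.filter⁺ (u Fin.≟_) (Unq.allFin⁺ _))
        λ p → here (sym (proj₂ (∈-filter⁻ (u Fin.≟_) {xs = allFin (suc n)} p))))

  module _ (As Bs : List V) where

    weight : Vec V (suc n) → ℕ
    weight g = ∑ As (λ a → ∑ Bs (λ b → indicator (sends? a b g)))

    weight-average : suc n * ∑ Γ weight ≤ length As * length Bs * length Γ
    weight-average = begin
        suc n * ∑ Γ weight
          ≡⟨ cong (suc n *_) (trans (∑-swap Γ As _) (∑-cong As λ a → ∑-swap Γ Bs _)) ⟩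
        suc n * ∑ As (λ a → ∑ Bs (N a))
          ≡⟨ trans (∑-* (suc n) As _) (∑-cong As λ a → ∑-* (suc n) Bs _) ⟩
        ∑ As (λ a → ∑ Bs (λ b → suc n * N a b))
          ≤⟨ ∑-mono As (λ {a} _ → ∑-mono Bs (λ {b} _ → N-uniform a b)) ⟩
        ∑ As (λ a → ∑ Bs (λ b → length Γ))
          ≡⟨ trans (∑-cong As λ _ → ∑-const Bs (length Γ)) (∑-const As _) ⟩
        length As * (length Bs * length Γ)
          ≡⟨ *-assoc (length As) _ _ ⟨
        length As * length Bs * length Γ ∎
      where
      open ≤-Reasoning

    -- A random automorphism sends a given vertex to a given vertex with probability at most 1 / n,
    -- so the expected number of matched pairs is at most |As| |Bs| / n, and some automorphism does
    -- not exceed it.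
    light : ∃[ g ] (IsAut g × suc n * weight g ≤ length As * length Bs)
    light with Any.any? (λ g → suc n * weight g ≤? length As * length Bs) Γ
    ... | yes p = case find p of λ (g , g∈ , le) → g , ∈-Γ⁻ g∈ , le
    ... | no ¬p = ⊥-elim (<⇒≱ heavy weight-average)
      where
      open ≤-Reasoning
      nonempty : 0 < length Γ
      nonempty = ∈⇒0< (∈-Γ⁺ {Vec.tabulate f} (inj′ , pres))
        where
        f = Inverse.to (proj₁ (vt zero zero))
        inj′ : Injective _≡_ _≡_ (Vec.lookup (Vec.tabulate f))
        inj′ {x} {y} eq = σ-injective {zero} {zero} (trans (sym (lookup∘tabulate f x)) (trans eq (lookup∘tabulate f y)))
        pres : ∀ u v → adj G (Vec.lookup (Vec.tabulate f) u) (Vec.lookup (Vec.tabulate f) v) ≡ adj G u v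
        pres u v = trans (cong₂ (adj G) (lookup∘tabulate f u) (lookup∘tabulate f v)) (proj₁ (proj₂ (vt zero zero)) u v)
      heavy : length As * length Bs * length Γ < suc n * ∑ Γ weight
      heavy = begin-strict
        length As * length Bs * length Γ          ≡⟨ *-comm _ (length Γ) ⟩
        length Γ * (length As * length Bs)        <⟨ *-monoʳ-< (length Γ) {{>-nonZero nonempty}} (n<1+n _) ⟩
        length Γ * suc (length As * length Bs)    ≡⟨ ∑-const Γ _ ⟨
        ∑ Γ (λ _ → suc (length As * length Bs))   ≤⟨ ∑-mono Γ (λ g∈ → ≰⇒> λ le → ¬p (lose g∈ le)) ⟩
        ∑ Γ (λ g → suc n * weight g)              ≡⟨ ∑-* (suc n) Γ weight ⟨
        suc n * ∑ Γ weight                        ∎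

    average : Σ (Automorphism G) λ σ →
      suc n * length (filter (λ a → Any.any? (Automorphism.to σ a Fin.≟_) Bs) As) ≤ length As * length Bs
    average with light
    ... | g , (inj , pres) , le = record { to = Vec.lookup g ; injective = inj ; preserves = pres } ,
      ≤-trans (*-monoʳ-≤ (suc n) (subst (_≤ weight g) (sym (length-filter-∑ _ As)) (∑-mono As λ {a} _ → hit a))) le
      where
      hit : ∀ a → indicator (Any.any? (Vec.lookup g a Fin.≟_) Bs) ≤ ∑ Bs (λ b → indicator (sends? a b g))
      hit a with Any.any? (Vec.lookup g a Fin.≟_) Bs
      ... | no _  = z≤n
      ... | yes p = go p
        where
        go : ∀ {bs} → Vec.lookup g a ∈ bs → 1 ≤ ∑ bs (λ b → indicator (sends? a b g))
        go {b ∷ bs} p with sends? a b g | p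
        ... | yes _ | _         = s≤s z≤n
        ... | no ¬q | here q    = ⊥-elim (¬q q)
        ... | no _  | there q   = go q

-- From disjoint paths to linked cycles

module _ {n : ℕ} {G : Graph n} {ℓ : ℕ} (C : Cyc G ℓ) where
  open Cyc C

  on : Fin n → Bool
  on v = ⌊ any? (λ (i : Fin ℓ) → at (Fin.toℕ i) Fin.≟ v) ⌋

  on⁺ : ∀ p → on (at p) ≡ true
  on⁺ p with any? (λ (i : Fin ℓ) → at (Fin.toℕ i) Fin.≟ at p)
  ... | yes _ = refl
  ... | no ¬q with reduce p
  ... | r , r<ℓ , eq = ⊥-elim (¬q (Fin.fromℕ< r<ℓ , trans (cong at (toℕ-fromℕ< r<ℓ)) (sym eq)))

  on⁻ : ∀ v → on v ≡ true → ∃[ p ] (p < ℓ × v ≡ at p)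
  on⁻ v eq with any? (λ (i : Fin ℓ) → at (Fin.toℕ i) Fin.≟ v)
  ... | yes (i , q) = Fin.toℕ i , toℕ<n i , sym q
  on⁻ v () | no _

  vertexList : List (Fin n)
  vertexList = map at (upTo ℓ)

  length-vertexList : length vertexList ≡ ℓ
  length-vertexList = trans (length-map at (upTo ℓ)) (length-upTo ℓ)

  vertexList-unique : Unique vertexList
  vertexList-unique = unique-map at (λ p q → distinct′ (∈-upTo⁻ p) (∈-upTo⁻ q)) (Unq.upTo⁺ ℓ)

  ∈-vertexList⁺ : ∀ p → at p ∈ vertexList
  ∈-vertexList⁺ p with reduce p
  ... | r , r<ℓ , eq = subst (_∈ vertexList) (sym eq) (∈-map⁺ at (∈-upTo⁺ r<ℓ))

  ∈-vertexList⁻ : ∀ {v} → v ∈ vertexList → ∃[ p ] v ≡ at p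
  ∈-vertexList⁻ v∈ with ∈-map⁻ at v∈
  ... | p , _ , eq = p , eq

module Hits {n : ℕ} {G : Graph n} {ℓ : ℕ} (C D : Cyc G ℓ) where

  hit? : ∀ q → Dec (on D (Cyc.at C q) ≡ true)
  hit? q = on D (Cyc.at C q) Bool.≟ true

  positions : ℕ → List ℕ
  positions p = filter hit? (downFrom p)

  positions-unique : ∀ p → Unique (positions p)
  positions-unique p = Unq.filter⁺ hit? (Unq.downFrom⁺ p)

  ∈-positions⁻ : ∀ {p q} → q ∈ positions p → q < p × on D (Cyc.at C q) ≡ true
  ∈-positions⁻ {p} q∈ with ∈-filter⁻ hit? {xs = downFrom p} q∈
  ... | r , h = ∈-downFrom⁻ r , h

  ∈-positions⁺ : ∀ {p q} → q < p → on D (Cyc.at C q) ≡ true → q ∈ positions p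
  ∈-positions⁺ q<p h = ∈-filter⁺ hit? (∈-downFrom⁺ q<p) h

  -- This numbers the segment containing position p by the common vertices before it. Since counting
  -- starts at position 0, m common vertices allow the m + 1 values from 0 to m.
  hits : ℕ → ℕ
  hits p = length (positions p)

  hits-mono : ∀ {p q} → p ≤ q → hits p ≤ hits q
  hits-mono {p} p≤q = unique-⊆-length (positions-unique p) λ r∈ →
    ∈-positions⁺ (<-≤-trans (proj₁ (∈-positions⁻ {p} r∈)) p≤q) (proj₂ (∈-positions⁻ {p} r∈))

  hits-free : ∀ {p q r} → hits p ≡ hits q → p ≤ r → r < q → on D (Cyc.at C r) ≡ false
  hits-free {p} {q} {r} eq p≤r r<q = ≢true λ h → <-irrefl eq (unique-⊆-length
      (unique-∷ (λ r∈ → <⇒≱ (proj₁ (∈-positions⁻ {p} r∈)) p≤r) (positions-unique p))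
      (sub h))
    where
    sub : on D (Cyc.at C r) ≡ true → ∀ {x} → x ∈ r ∷ positions p → x ∈ positions q
    sub h (here refl) = ∈-positions⁺ r<q h
    sub h (there x∈) with ∈-positions⁻ {p} x∈
    ... | x<p , h′ = ∈-positions⁺ (<-trans (<-≤-trans x<p p≤r) r<q) h′

  hits≤common : ∀ {p} → p ≤ ℓ → hits p ≤ ∣ (λ v → on C v ∧ on D v) ∣ₛ
  hits≤common {p} p≤ℓ = ≤-trans (≤-reflexive (sym (length-map (Cyc.at C) (positions p))))
    (unique-⊆-length
      (unique-map (Cyc.at C) (λ x y → Cyc.distinct′ C (<-≤-trans (proj₁ (∈-positions⁻ {p} x)) p≤ℓ) (<-≤-trans (proj₁ (∈-positions⁻ {p} y)) p≤ℓ))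
        (positions-unique p))
      λ z∈ → case ∈-map⁻ (Cyc.at C) z∈ of λ { (q , q∈ , refl) →
        ∈-el⁺ (λ v → on C v ∧ on D v) (∧-true⁺ (on⁺ C q) (proj₂ (∈-positions⁻ {p} q∈))) })

module TwoCycles {n : ℕ} {G : Graph n} {ℓ : ℕ} (C D : Cyc G ℓ) where
  open Menger {n} hiding (V)
  open Trails
  private
    module c = Cyc C
    module d = Cyc D

  A B common : Fin n → Bool
  A v = on C v ∧ not (on D v)
  B v = on D v ∧ not (on C v)
  common v = on C v ∧ on D v

  -- A path from A to B along these edges has no inner vertex on C or D.
  edge? : ∀ (e : Fin n × Fin n) → Dec (adj G (proj₁ e) (proj₂ e) ≡ true × on D (proj₁ e) ≡ false × on C (proj₂ e) ≡ false)
  edge? (x , y) = (adj G x y Bool.≟ true) ×-dec (on D x Bool.≟ false) ×-dec (on C y Bool.≟ false)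

  edges : List (Fin n × Fin n)
  edges = filter edge? (cartesianProduct (allFin n) (allFin n))

  edges⁻ : ∀ {x y} → (x , y) ∈ edges → Adj G x y × on D x ≡ false × on C y ≡ false
  edges⁻ p = proj₂ (∈-filter⁻ edge? {xs = cartesianProduct (allFin n) (allFin n)} p)

  edges⁺ : ∀ {x y} → Adj G x y → on D x ≡ false → on C y ≡ false → (x , y) ∈ edges
  edges⁺ r p q = ∈-filter⁺ edge? (∈-cartesianProduct⁺ (∈-allFin _) (∈-allFin _)) (r , p , q)

  not-true⁻ : ∀ {b} → not b ≡ true → b ≡ false
  not-true⁻ {false} _ = refl

  record Inner (u v : Fin n) (xs : List (Fin n)) : Set where
    field
      list : List (Fin n)
      path : Open (Adj G) u v list
      eq   : xs ≡ list ++ v ∷ []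
      offC : ∀ {z} → z ∈ list → on C z ≡ false
      offD : ∀ {z} → z ∈ list → on D z ≡ false

  inner-part : ∀ {u w v xs} → Edge edges u w → Trail (Edge edges) w v xs → Inner u v xs
  inner-part r [ _ ] = record { list = [] ; path = [ proj₁ (edges⁻ r) ] ; eq = refl ; offC = λ () ; offD = λ () }
  inner-part {w = w} r (s ∷ t) = record
    { list = w ∷ I.list ; path = proj₁ (edges⁻ r) ∷ I.path ; eq = cong (w ∷_) I.eq
    ; offC = λ { (here refl) → proj₂ (proj₂ (edges⁻ r)) ; (there z∈) → I.offC z∈ }
    ; offD = λ { (here refl) → proj₁ (proj₂ (edges⁻ s)) ; (there z∈) → I.offD z∈ } }
    where module I = Inner (inner-part s t)

  module _ {k : ℕ} (𝓛 : Linkage edges A B k) where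
    open Linkage 𝓛

    private
      aData : ∀ e → ∃[ p ] (p < ℓ × src e ≡ c.at p)
      aData e = on⁻ C _ (proj₁ (∧-true⁻ (src∈ e)))
      bData : ∀ e → ∃[ p ] (p < ℓ × tgt e ≡ d.at p)
      bData e = on⁻ D _ (proj₁ (∧-true⁻ (tgt∈ e)))
      a b : Fin k → ℕ
      a e = proj₁ (aData e)
      b e = proj₁ (bData e)
      src≡ : ∀ e → src e ≡ c.at (a e)
      src≡ e = proj₂ (proj₂ (aData e))
      tgt≡ : ∀ e → tgt e ≡ d.at (b e)
      tgt≡ e = proj₂ (proj₂ (bData e))

      srcOff : ∀ e → on D (c.at (a e)) ≡ false
      srcOff e = subst (λ v → on D v ≡ false) (src≡ e) (not-true⁻ (proj₂ (∧-true⁻ {on C (src e)} (src∈ e))))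
      tgtOff : ∀ e → on C (d.at (b e)) ≡ false
      tgtOff e = subst (λ v → on C v ≡ false) (tgt≡ e) (not-true⁻ (proj₂ (∧-true⁻ {on D (tgt e)} (tgt∈ e))))

      record Middle (e : Fin k) : Set where
        field
          list : List (Fin n)
          path : Open (Adj G) (src e) (tgt e) list
          uniq : Unique list
          sub  : ∀ {z} → z ∈ list → z ∈ vertices e
          offC : ∀ {z} → z ∈ list → on C z ≡ false
          offD : ∀ {z} → z ∈ list → on D z ≡ false

      middle′ : ∀ e {u v xs} → Trail (Edge edges) u v xs → u ≡ src e → v ≡ tgt e → xs ≡ vertices e → Middle e
      -- The single vertex of a trivial trail would lie both on `D` and off `D`.
      middle′ e [ _ ] refl q _ = ⊥-elim (true≢false (proj₁ (∧-true⁻ (tgt∈ e)))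
        (subst (λ v → on D v ≡ false) q (not-true⁻ (proj₂ (∧-true⁻ {on C (src e)} (src∈ e))))))
      middle′ e (r ∷ t) refl refl refl′ = record
        { list = I.list ; path = I.path
        ; uniq = unique-++⁻ˡ I.list (subst Unique I.eq (tail (subst Unique (sym refl′) (unique e))))
        ; sub = λ z∈ → subst (_ ∈_) refl′ (there (subst (_ ∈_) (sym I.eq) (∈-++⁺ˡ z∈)))
        ; offC = I.offC ; offD = I.offD }
        where
        module I = Inner (inner-part r t)
        tail : ∀ {x xs} → Unique (x ∷ xs) → Unique xs
        tail (_ ∷ u) = u

      middle : ∀ e → Middle e
      middle e = middle′ e (trail e) refl refl refl

      module M e = Middle (middle e)

    linkedCycles : LinkedCycles G ℓ k
    linkedCycles = record
      { C = C ; D = D ; a = a ; b = b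
      ; a< = λ e → proj₁ (proj₂ (aData e)) ; b< = λ e → proj₁ (proj₂ (bData e))
      ; inner = M.list
      ; path = λ e → subst₂ (λ u v → Open (Adj G) u v (M.list e)) (src≡ e) (tgt≡ e) (M.path e)
      ; simple = M.uniq
      ; apart = λ {e} {f} p q → disjoint (M.sub e p) (M.sub f q)
      ; inner∉C = λ { {e} z∈ p refl → true≢false (on⁺ C p) (M.offC e z∈) }
      ; inner∉D = λ { {e} z∈ p refl → true≢false (on⁺ D p) (M.offD e z∈) }
      ; a-injective = λ {e} {f} eq → src-injective (trans (src≡ e) (trans (cong c.at eq) (sym (src≡ f))))
      ; b-injective = λ {e} {f} eq → tgt-injective (trans (tgt≡ e) (trans (cong d.at eq) (sym (tgt≡ f))))
      ; I = Hits.hits C D ; J = Hits.hits D C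
      ; I-mono = Hits.hits-mono C D ; J-mono = Hits.hits-mono D C
      ; I-free = λ e f _ same p lo hi q eq → true≢false (subst (λ v → on D v ≡ true) (sym eq) (on⁺ D q)) (I-off f p same lo hi)
      ; J-free = λ e f _ same p lo hi q eq → true≢false (subst (λ v → on C v ≡ true) (sym eq) (on⁺ C q)) (J-off f p same lo hi) }
      where
      -- `hits-free` rules out common vertices only before the later end of the stretch; that end
      -- itself is the source of a path and so is off `D`.
      I-off : ∀ f p {x} → Hits.hits C D x ≡ Hits.hits C D (a f) → x ≤ p → p ≤ a f → on D (c.at p) ≡ false
      I-off f p same lo hi with m≤n⇒m<n∨m≡n hi
      ... | inj₁ p<  = Hits.hits-free C D same lo p<
      ... | inj₂ refl = srcOff f
      J-off : ∀ f p {x} → Hits.hits D C x ≡ Hits.hits D C (b f) → x ≤ p → p ≤ b f → on C (d.at p) ≡ false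
      J-off f p same lo hi with m≤n⇒m<n∨m≡n hi
      ... | inj₁ p<  = Hits.hits-free D C same lo p<
      ... | inj₂ refl = tgtOff f

    row≤ : ∀ e → Hits.hits C D (a e) ≤ ∣ common ∣ₛ
    row≤ e = Hits.hits≤common C D (<⇒≤ (proj₁ (proj₂ (aData e))))

    col≤ : ∀ e → Hits.hits D C (b e) ≤ ∣ common ∣ₛ
    col≤ e = ≤-trans (Hits.hits≤common D C (<⇒≤ (proj₁ (proj₂ (bData e)))))
      (∣∣-mono _ common λ v p → ∧-true⁺ (proj₂ (∧-true⁻ {on D v} p)) (proj₁ (∧-true⁻ p)))

    linkage-bound : 3 ≤ ℓ → Longest G ℓ → FewLinks k ∣ common ∣ₛ
    linkage-bound long longest = few-links long longest linkedCycles ∣ common ∣ₛ (λ e → s≤s (row≤ e)) (λ e → s≤s (col≤ e))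

    -- Without common vertices all links lie in row 0 and column 0, so any two of them would form a
    -- digon.
    linkage-disjoint : 3 ≤ ℓ → Longest G ℓ → ∣ common ∣ₛ ≡ 0 → ∀ e f → e ≡ f
    linkage-disjoint long longest none e f = TwoSided.digon-free long longest linkedCycles
      (trans (n≤0⇒n≡0 (≤-trans (row≤ e) (≤-reflexive none))) (sym (n≤0⇒n≡0 (≤-trans (row≤ f) (≤-reflexive none)))))
      (trans (n≤0⇒n≡0 (≤-trans (col≤ e) (≤-reflexive none))) (sym (n≤0⇒n≡0 (≤-trans (col≤ f) (≤-reflexive none)))))

-- Vertex cuts between longest cycles

record Cut {n : ℕ} (G : Graph n) : Set where
  field
    X Y    : Fin n → Bool
    cover  : ∀ v → X v ≡ true ⊎ Y v ≡ true
    noEdge : ∀ {x y} → Adj G x y → Y x ≡ false → X y ≡ true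

  middle : Fin n → Bool
  middle v = X v ∧ Y v

  noEdge′ : ∀ {x y} → Adj G x y → X x ≡ false → Y y ≡ true
  noEdge′ {x} {y} r p with Y y in eq
  ... | true  = refl
  ... | false = ⊥-elim (true≢false (noEdge (adj-sym G r) eq) p)

module _ {n : ℕ} {G : Graph n} {ℓ : ℕ} (C D : Cyc G ℓ) where
  open TwoCycles C D
  open Menger {n} hiding (V)

  record Separated (s : ℕ) : Set where
    field
      cut   : Cut G
      C⊆X   : ∀ p → Cut.X cut (Cyc.at C p) ≡ true
      D⊆Y   : ∀ p → Cut.Y cut (Cyc.at D p) ≡ true
      order : ∣ Cut.middle cut ∣ₛ < s

  -- The given separation controls only edges with tail off `D` and head off `C`. With the common
  -- vertices added to both sides, `C` lies in `X′` and `D` in `Y′`, so the remaining edges satisfy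
  -- the condition too.
  separated : ∀ {k} → Separation edges A B k → Separated (k + ∣ common ∣ₛ)
  separated {k} s = record
    { cut = record { X = X′ ; Y = Y′ ; cover = cov ; noEdge = ne }
    ; C⊆X = λ p → C⊆ _ (on⁺ C p)
    ; D⊆Y = λ p → D⊆ _ (on⁺ D p)
    ; order = ≤-<-trans size (+-monoˡ-< ∣ common ∣ₛ order) }
    where
    open Separation s
    X′ Y′ : Fin n → Bool
    X′ v = X v ∨ common v
    Y′ v = Y v ∨ common v
    cov : ∀ v → X′ v ≡ true ⊎ Y′ v ≡ true
    cov v with cover v
    ... | inj₁ p = inj₁ (∨-trueˡ _ p)
    ... | inj₂ p = inj₂ (∨-trueˡ _ p)
    C⊆ : ∀ v → on C v ≡ true → X′ v ≡ true
    C⊆ v p with on D v in eq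
    ... | true  = ∨-trueʳ (X v) (∧-true⁺ p refl)
    ... | false = ∨-trueˡ _ (A⊆X v (∧-true⁺ p (cong not eq)))
    D⊆ : ∀ v → on D v ≡ true → Y′ v ≡ true
    D⊆ v p with on C v in eq
    ... | true  = ∨-trueʳ (Y v) p
    ... | false = ∨-trueˡ _ (B⊆Y v (∧-true⁺ p (cong not eq)))
    ∨-false⁻ : ∀ {a b} → a ∨ b ≡ false → a ≡ false
    ∨-false⁻ {false} _ = refl
    ne : ∀ {x y} → Adj G x y → Y′ x ≡ false → X′ y ≡ true
    ne {x} {y} r eq with on C y in Cy
    ... | true  = subst (λ b → X y ∨ b ∧ on D y ≡ true) Cy (C⊆ y Cy)
    ... | false = ∨-trueˡ _ (noEdge (edges⁺ r (≢true λ p → true≢false (D⊆ x p) eq) Cy) (∨-false⁻ eq))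
    size : ∣ (λ v → X′ v ∧ Y′ v) ∣ₛ ≤ ∣ (λ v → X v ∧ Y v) ∣ₛ + ∣ common ∣ₛ
    size = ≤-trans (unique-⊆-length {ys = el (λ v → X v ∧ Y v) ++ el common} (el-unique _) sub)
      (≤-reflexive (length-++ (el (λ v → X v ∧ Y v))))
      where
      sub : ∀ {v} → v ∈ el (λ v → X′ v ∧ Y′ v) → v ∈ el (λ v → X v ∧ Y v) ++ el common
      sub {v} p with ∧-true⁻ {X′ v} (∈-el⁻ (λ v → X′ v ∧ Y′ v) p)
      ... | q , r with ∨-true⁻ {X v} q | ∨-true⁻ {Y v} r
      ... | inj₁ x | inj₁ y = ∈-++⁺ˡ (∈-el⁺ (λ v → X v ∧ Y v) (∧-true⁺ x y))
      ... | inj₂ x | _      = ∈-++⁺ʳ _ (∈-el⁺ common x)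
      ... | _      | inj₂ y = ∈-++⁺ʳ _ (∈-el⁺ common y)

one-side : ∀ {n} {G : Graph n} {ℓ} (K : Cut G) (C : Cyc G ℓ) → (∀ p → Cut.middle K (Cyc.at C p) ≡ false) →
  (∀ p → Cut.Y K (Cyc.at C p) ≡ false) ⊎ (∀ p → Cut.X K (Cyc.at C p) ≡ false)
one-side K C off with X (at 0) in X₀ | Y (at 0) in Y₀
  where open Cut K ; open Cyc C
... | true | true = ⊥-elim (true≢false (∧-true⁺ X₀ Y₀) (off 0))
... | _ | false = inj₁ λ p → go p
  where
  open Cut K
  open Cyc C
  go : ∀ p → Y (at p) ≡ false
  go zero    = Y₀
  go (suc p) = ≢true λ y → true≢false (∧-true⁺ (noEdge (step p) (go p)) y) (off (suc p))
... | false | true = inj₂ λ p → go p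
  where
  open Cut K
  open Cyc C
  go : ∀ p → X (at p) ≡ false
  go zero    = X₀
  go (suc p) = ≢true λ x → true≢false (∧-true⁺ x (noEdge′ (step p) (go p))) (off (suc p))

image : ∀ {n} {G : Graph n} {ℓ} → Automorphism G → Cyc G ℓ → Cyc G ℓ
image σ C = record
  { at = λ p → to (at p)
  ; step = λ p → trans (preserves _ _) (step p)
  ; periodic = λ p → cong to (periodic p)
  ; distinct = λ p q eq → distinct p q (injective eq)
  ; reduce = λ p → case reduce p of λ (r , r< , eq) → r , r< , cong to eq }
  where
  open Automorphism σ
  open Cyc C

module VertexTransitiveGraph {n : ℕ} (G : Graph (suc n)) (conn : Connected G) (vt : VertexTransitive G) where
  private
    V = Fin (suc n)

  -- Connectedness of the induced subgraph, stated without paths.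
  Joined : List V → Set
  Joined xs = (f : V → Bool) → (∀ {u v} → u ∈ xs → v ∈ xs → Adj G u v → f u ≡ true → f v ≡ true) →
    ∀ {u v} → u ∈ xs → v ∈ xs → f u ≡ true → f v ≡ true

  joined-∷ : ∀ {xs p q} → p ∈ xs → Adj G p q → Joined xs → Joined (q ∷ xs)
  joined-∷ {xs} {p} {q} p∈ r j f closed = go
    where
    j′ : ∀ {u v} → u ∈ xs → v ∈ xs → f u ≡ true → f v ≡ true
    j′ = j f λ u∈ v∈ → closed (there u∈) (there v∈)
    go : ∀ {u v} → u ∈ q ∷ xs → v ∈ q ∷ xs → f u ≡ true → f v ≡ true
    go (here refl) (here refl) fu = fu
    go (here refl) (there v∈)  fu = j′ p∈ v∈ (closed (here refl) (there p∈) (adj-sym G r) fu)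
    go (there u∈)  (here refl) fu = closed (there p∈) (here refl) r (j′ u∈ p∈ fu)
    go (there u∈)  (there v∈)  fu = j′ u∈ v∈ fu

  -- Found as the last vertex when G is exhausted one adjacent vertex at a time.
  record NonCutVertex : Set where
    field
      vertex : V
      rest   : List V
      joined : Joined rest
      fresh  : vertex ∉ rest
      others : ∀ v → v ≢ vertex → v ∈ rest

  _∈?_ : (v : V) (xs : List V) → Dec (v ∈ xs)
  v ∈? xs = Any.any? (v Fin.≟_) xs

  exhaust : ∀ fuel xs → Unique xs → Joined xs → zero ∈ xs → ∃[ v ] v ∉ xs → suc n < fuel + length xs → NonCutVertex
  exhaust zero xs un _ _ _ big =
    ⊥-elim (<⇒≱ big (≤-trans (unique-⊆-length un (λ {z} _ → ∈-allFin z)) (≤-reflexive (length-tabulate {n = suc n} id))))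
  exhaust (suc fuel) xs un j z∈ (v , v∉) big
    with walk-exit (λ u → ⌊ u ∈? xs ⌋) (conn zero v) (does⁺ z∈) (does⁻ v∉)
    where
    does⁺ : ∀ {u} → u ∈ xs → ⌊ u ∈? xs ⌋ ≡ true
    does⁺ {u} p with u ∈? xs
    ... | yes _ = refl
    ... | no ¬p = ⊥-elim (¬p p)
    does⁻ : ∀ {u} → u ∉ xs → ⌊ u ∈? xs ⌋ ≡ false
    does⁻ {u} ¬p with u ∈? xs
    ... | yes p = ⊥-elim (¬p p)
    ... | no _  = refl
  ... | p , q , r , p? , q? with p ∈? xs | q ∈? xs
  exhaust (suc fuel) xs un j z∈ _ big | p , q , r , () , _  | no _   | _
  exhaust (suc fuel) xs un j z∈ _ big | p , q , r , _  , () | yes _  | yes _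
  ... | yes p∈ | no q∉ with any? (λ v → ¬? (v ∈? (q ∷ xs)))
  ... | yes more = exhaust fuel (q ∷ xs) (unique-∷ q∉ un) (joined-∷ p∈ r j) (there z∈) more
        (≤-trans big (≤-reflexive (sym (+-suc fuel _))))
  ... | no none = record { vertex = q ; rest = xs ; joined = j ; fresh = q∉ ; others = others }
    where
    others : ∀ v → v ≢ q → v ∈ xs
    others v v≢q with v ∈? (q ∷ xs)
    ... | yes (here v≡q) = ⊥-elim (v≢q v≡q)
    ... | yes (there v∈) = v∈
    ... | no v∉ = ⊥-elim (none (v , v∉))

  pull : Automorphism G → Cut G → Cut G
  pull σ K = record { X = λ v → X (to v) ; Y = λ v → Y (to v) ; cover = λ v → cover (to v)
                    ; noEdge = λ r → noEdge (trans (preserves _ _) r) }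
    where
    open Automorphism σ
    open Cut K

  automorphism : ∀ u v → Automorphism G
  automorphism u v = record
    { to = Inverse.to σ
    ; injective = λ {x} {y} eq → trans (sym (Inverse.strictlyInverseʳ σ x)) (trans (cong (Inverse.from σ) eq) (Inverse.strictlyInverseʳ σ y))
    ; preserves = proj₁ (proj₂ (vt u v)) }
    where σ = proj₁ (vt u v)

  -- With at most one middle vertex, which may be taken to be the non-cut vertex, one side is empty.
  no-small-cut : (K : Cut G) → ∣ Cut.middle K ∣ₛ < 2 → ∀ {u v} → Cut.Y K u ≡ false → Cut.X K v ≡ false → ⊥
  no-small-cut K small {u} {v} Yu Xv = go (el middle) refl small
    where
    open Cut K
    X-true : ∀ {w} → Y w ≡ false → X w ≡ true
    X-true {w} p with cover w
    ... | inj₁ q = q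
    ... | inj₂ q = ⊥-elim (true≢false q p)
    go : ∀ ms → el middle ≡ ms → length ms < 2 → ⊥
    go [] eq _ with walk-exit X (conn u v) (X-true Yu) Xv
    ... | p , q , r , Xp , Xq = true≢false (noEdge r (≢true λ Yp → case subst (p ∈_) eq (∈-el⁺ middle (∧-true⁺ Xp Yp)) of λ ())) Xq
    go (z ∷ []) eq _ with any? {n = suc n} (λ v → ¬? (v ∈? (zero ∷ [])))
    ... | no none = true≢false (X-true Yu) (subst (λ v → X v ≡ false) (trans (only v) (sym (only u))) Xv)
      where
      only : ∀ w → w ≡ zero
      only w with w ∈? (zero ∷ [])
      ... | yes (here p) = p
      ... | no w∉ = ⊥-elim (none (w , w∉))
    -- In the pulled-back cut the non-cut vertex is the only middle vertex. So `rest` avoids the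
    -- middle, and membership in `X` spreads within it from `u′` to `v′`.
    ... | yes more = true≢false (joined (λ v → Cut.X K′ v) closed (in-rest u′ (λ e → true≢false (Y-w e) Yu)) (in-rest v′ λ e → true≢false (X-w e) Xv)
                       (subst (λ v → X v ≡ true) (sym (σ-from u)) (X-true Yu))) (subst (λ v → X v ≡ false) (sym (σ-from v)) Xv)
      where
      nonCut = exhaust (suc n) (zero ∷ []) ([] ∷ []) (λ { f _ (here refl) (here refl) p → p }) (here refl) more (≤-reflexive (+-comm 1 (suc n)))
      open NonCutVertex nonCut
      σ = proj₁ (vt vertex z)
      σ-w : Inverse.to σ vertex ≡ z
      σ-w = proj₂ (proj₂ (vt vertex z))
      σ-from : ∀ v → Inverse.to σ (Inverse.from σ v) ≡ v
      σ-from = Inverse.strictlyInverseˡ σ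
      K′ = pull (automorphism vertex z) K
      u′ = Inverse.from σ u
      v′ = Inverse.from σ v
      z-mid : middle z ≡ true
      z-mid = ∈-el⁻ middle (subst (z ∈_) (sym eq) (here refl))
      Y-w : u′ ≡ vertex → Y u ≡ true
      Y-w e = subst (λ v → Y v ≡ true) (trans (sym σ-w) (trans (cong (Inverse.to σ) (sym e)) (σ-from u))) (proj₂ (∧-true⁻ {X z} z-mid))
      X-w : v′ ≡ vertex → X v ≡ true
      X-w e = subst (λ v → X v ≡ true) (trans (sym σ-w) (trans (cong (Inverse.to σ) (sym e)) (σ-from v))) (proj₁ (∧-true⁻ z-mid))
      in-rest : ∀ x → (x ≡ vertex → ⊥) → x ∈ rest
      in-rest x = others x
      only-z : ∀ {x} → middle x ≡ true → x ≡ z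
      only-z p with subst (_ ∈_) eq (∈-el⁺ middle p)
      ... | here q = q
      closed : ∀ {p q} → p ∈ rest → q ∈ rest → Adj G p q → Cut.X K′ p ≡ true → Cut.X K′ q ≡ true
      closed {p} p∈ _ r Xp = Cut.noEdge K′ r (≢true λ Yp →
        fresh (subst (_∈ rest) (Automorphism.injective (automorphism vertex z) (trans (only-z (∧-true⁺ Xp Yp)) (sym σ-w))) p∈))
    go (_ ∷ _ ∷ _) _ (s≤s (s≤s ()))

  module Longest′ {ℓ : ℕ} (long : 3 ≤ ℓ) (longest : Longest G ℓ) where
    open Menger {suc n} hiding (V)

    common : Cyc G ℓ → Cyc G ℓ → V → Bool
    common C D = TwoCycles.common C D

    meet : (C D : Cyc G ℓ) → ∣ common C D ∣ₛ ≢ 0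
    meet C D none with menger (TwoCycles.edges C D) (TwoCycles.A C D) (TwoCycles.B C D) 2
    ... | inj₁ l = case TwoCycles.linkage-disjoint C D l long longest none zero (suc zero) of λ ()
    ... | inj₂ s = no-small-cut cut small
          {Cyc.at C (proj₁ strictC)} {Cyc.at D (proj₁ strictD)} (proj₂ strictC) (proj₂ strictD)
      where
      open Separated (separated C D s)
      open Cut cut using (X; Y; middle)
      small : ∣ middle ∣ₛ < 2
      small = subst (λ m → ∣ middle ∣ₛ < 2 + m) none order
      -- The middle has at most one vertex, so it cannot contain both of the first two vertices of a
      -- cycle.
      strict : (E : Cyc G ℓ) (χ : V → Bool) → (∀ p → χ (Cyc.at E p) ≡ true → middle (Cyc.at E p) ≡ true) → ∃[ p ] χ (Cyc.at E p) ≡ false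
      strict E χ inMiddle with χ (Cyc.at E 0) in e₀ | χ (Cyc.at E 1) in e₁
      ... | false | _     = 0 , e₀
      ... | true  | false = 1 , e₁
      ... | true  | true  = ⊥-elim (<⇒≱ small (unique-⊆-length {xs = Cyc.at E 0 ∷ Cyc.at E 1 ∷ []}
              (unique-∷ (λ { (here eq) → Cyc.distinct E (s≤s z≤n) (<-≤-trans (s≤s (s≤s z≤n)) long) eq }) ([] ∷ []))
              λ { (here refl) → ∈-el⁺ middle (inMiddle 0 e₀) ; (there (here refl)) → ∈-el⁺ middle (inMiddle 1 e₁) }))
      strictC : ∃[ p ] Y (Cyc.at C p) ≡ false
      strictC = strict C Y λ p q → ∧-true⁺ (C⊆X p) q
      strictD : ∃[ p ] X (Cyc.at D p) ≡ false
      strictD = strict D X λ p q → ∧-true⁺ q (D⊆Y p)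

    disjoint⇒⊥ : (C D : Cyc G ℓ) → (∀ p → on D (Cyc.at C p) ≡ false) → ⊥
    disjoint⇒⊥ C D off = meet C D (n≤0⇒n≡0 (unique-⊆-length {ys = []} (el-unique (common C D)) λ {z} z∈ →
      case ∧-true⁻ {on C z} (∈-el⁻ (common C D) z∈) of λ (p , q) →
        case on⁻ C z p of λ { (r , _ , refl) → ⊥-elim (true≢false q (off r)) }))

    -- A translate of C missing the middle of the cut lies on one side, hence misses C or D.
    cut-bound : (C D : Cyc G ℓ) → ∀ {s} (S : Separated C D s) → suc n ≤ ℓ * ∣ Cut.middle (Separated.cut S) ∣ₛ
    cut-bound C D S = ≮⇒≥ λ small → case Averaging.average G vt (vertexList C) (el middle) of λ (σ , avg) →
        finish σ (one-side cut (image σ C) (off small σ avg))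
      where
      open Separated S
      open Cut cut using (middle)
      open ≤-Reasoning
      off : ℓ * ∣ middle ∣ₛ < suc n → ∀ σ →
        suc n * length (filter (λ a → Any.any? (Automorphism.to σ a Fin.≟_) (el middle)) (vertexList C)) ≤ length (vertexList C) * ∣ middle ∣ₛ →
        ∀ p → middle (Cyc.at (image σ C) p) ≡ false
      off small σ avg p = ≢true λ q → <⇒≱ small (begin
        suc n             ≡⟨ *-identityʳ (suc n) ⟨
        suc n * 1         ≤⟨ *-monoʳ-≤ (suc n) (∈⇒0< (∈-filter⁺ _ (∈-vertexList⁺ C p) (∈-el⁺ middle q))) ⟩
        suc n * length (filter (λ a → Any.any? (Automorphism.to σ a Fin.≟_) (el middle)) (vertexList C)) ≤⟨ avg ⟩
        length (vertexList C) * ∣ middle ∣ₛ ≡⟨ cong (_* ∣ middle ∣ₛ) (length-vertexList C) ⟩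
        ℓ * ∣ middle ∣ₛ   ∎)
      finish : ∀ σ → (∀ p → Cut.Y cut (Cyc.at (image σ C) p) ≡ false) ⊎ (∀ p → Cut.X cut (Cyc.at (image σ C) p) ≡ false) → ⊥
      finish σ (inj₁ Y-off) = disjoint⇒⊥ (image σ C) D λ p → ≢true λ q →
        case on⁻ D _ q of λ (r , _ , eq) → true≢false (subst (λ v → Cut.Y cut v ≡ true) (sym eq) (D⊆Y r)) (Y-off p)
      finish σ (inj₂ X-off) = disjoint⇒⊥ (image σ C) C λ p → ≢true λ q →
        case on⁻ C _ q of λ (r , _ , eq) → true≢false (subst (λ v → Cut.X cut v ≡ true) (sym eq) (C⊆X r)) (X-off p)

-- The exponent 13/21 and the constant

-- In n¹³ = n⁸ n⁵ the second factor is bounded through k⁵ by a multiple of m⁸ ℓ⁵, and then (n m)⁸ ≤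
-- ℓ¹⁶.
exponents : ∀ {n k m ℓ} c → n ≤ k * (2 * ℓ) → k ^ 5 ≤ c * (2 * m) ^ 8 → n * m ≤ ℓ * ℓ →
  n ^ 13 ≤ c * (2 ^ 8 * 2 ^ 5) * ℓ ^ 21
exponents {n} {k} {m} {ℓ} c n≤ k≤ nm≤ = begin
    n ^ 13                                     ≡⟨ ^-distribˡ-+-* n 8 5 ⟩
    n ^ 8 * n ^ 5                              ≤⟨ *-monoʳ-≤ (n ^ 8) (^-monoˡ-≤ 5 n≤) ⟩
    n ^ 8 * (k * (2 * ℓ)) ^ 5                  ≡⟨ cong (n ^ 8 *_) (trans (^-distribʳ-* 5 k (2 * ℓ)) (cong (k ^ 5 *_) (^-distribʳ-* 5 2 ℓ))) ⟩
    n ^ 8 * (k ^ 5 * (2 ^ 5 * ℓ ^ 5))          ≤⟨ *-monoʳ-≤ (n ^ 8) (*-monoˡ-≤ _ k≤) ⟩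
    n ^ 8 * (c * (2 * m) ^ 8 * (2 ^ 5 * ℓ ^ 5)) ≡⟨ cong (λ x → n ^ 8 * (c * x * (2 ^ 5 * ℓ ^ 5))) (^-distribʳ-* 8 2 m) ⟩
    n ^ 8 * (c * (2 ^ 8 * m ^ 8) * (2 ^ 5 * ℓ ^ 5)) ≡⟨ regroup (2 ^ 8) (2 ^ 5) (n ^ 8) (m ^ 8) (ℓ ^ 5) ⟩
    c * (2 ^ 8 * 2 ^ 5) * (n ^ 8 * m ^ 8 * ℓ ^ 5) ≡⟨ cong (λ x → c * (2 ^ 8 * 2 ^ 5) * (x * ℓ ^ 5)) (^-distribʳ-* 8 n m) ⟨
    c * (2 ^ 8 * 2 ^ 5) * ((n * m) ^ 8 * ℓ ^ 5) ≤⟨ *-monoʳ-≤ (c * (2 ^ 8 * 2 ^ 5)) (*-monoˡ-≤ (ℓ ^ 5) (^-monoˡ-≤ 8 nm≤)) ⟩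
    c * (2 ^ 8 * 2 ^ 5) * ((ℓ * ℓ) ^ 8 * ℓ ^ 5) ≡⟨ cong (λ x → c * (2 ^ 8 * 2 ^ 5) * (x * ℓ ^ 5)) (trans (^-distribʳ-* 8 ℓ ℓ) (sym (^-distribˡ-+-* ℓ 8 8))) ⟩
    c * (2 ^ 8 * 2 ^ 5) * (ℓ ^ 16 * ℓ ^ 5)     ≡⟨ cong (c * (2 ^ 8 * 2 ^ 5) *_) (^-distribˡ-+-* ℓ 16 5) ⟨
    c * (2 ^ 8 * 2 ^ 5) * ℓ ^ 21               ∎
  where
  open ≤-Reasoning
  open +-*-Solver
  regroup : ∀ s t x y z → x * (c * (s * y) * (t * z)) ≡ c * (s * t) * (x * y * z)
  regroup s t x y z = solve 6 (λ c s t x y z → x :* (c :* (s :* y) :* (t :* z)) := c :* (s :* t) :* (x :* y :* z)) refl c s t x y z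

-- Combining the two bounds eliminates m and leaves n² ≤ 2ℓ³; the seventh power has ℓ²¹ on the right
-- and n¹⁴ on the left.
exponents-thick : ∀ {n m ℓ} → 1 ≤ n → n ≤ 2 * m * ℓ → n * m ≤ ℓ * ℓ → n ^ 13 ≤ 2 ^ 7 * ℓ ^ 21
exponents-thick {n} {m} {ℓ} n≥1 n≤ nm≤ = begin
    n ^ 13                   ≤⟨ ^-monoʳ-≤ n {{>-nonZero n≥1}} (n≤1+n 13) ⟩
    n ^ 14                   ≡⟨ trans (^-distribˡ-+-* n 7 7) (sym (^-distribʳ-* 7 n n)) ⟩
    (n * n) ^ 7              ≤⟨ ^-monoˡ-≤ 7 square≤ ⟩
    (2 * (ℓ * (ℓ * ℓ))) ^ 7  ≡⟨ trans (^-distribʳ-* 7 2 (ℓ * (ℓ * ℓ))) (cong (2 ^ 7 *_) (trans (^-distribʳ-* 7 ℓ (ℓ * ℓ)) (cong (ℓ ^ 7 *_) (^-distribʳ-* 7 ℓ ℓ)))) ⟩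
    2 ^ 7 * (ℓ ^ 7 * (ℓ ^ 7 * ℓ ^ 7)) ≡⟨ cong (2 ^ 7 *_) (trans (cong (ℓ ^ 7 *_) (sym (^-distribˡ-+-* ℓ 7 7))) (sym (^-distribˡ-+-* ℓ 7 14))) ⟩
    2 ^ 7 * ℓ ^ 21           ∎
  where
  open ≤-Reasoning
  open +-*-Solver
  square≤ : n * n ≤ 2 * (ℓ * (ℓ * ℓ))
  square≤ = begin
    n * n                  ≤⟨ *-monoʳ-≤ n n≤ ⟩
    n * (2 * m * ℓ)        ≡⟨ solve 3 (λ n m l → n :* (con 2 :* m :* l) := con 2 :* (l :* (n :* m))) refl n m ℓ ⟩
    2 * (ℓ * (n * m))      ≤⟨ *-monoʳ-≤ 2 (*-monoʳ-≤ ℓ nm≤) ⟩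
    2 * (ℓ * (ℓ * ℓ))      ∎

-- Abstract, so that the numeral 4 ^ 21 is never unfolded.
abstract
  LongFor : ℕ → ℕ → Set
  LongFor n ℓ = 1 ^ 21 * n ^ 13 ≤ 4 ^ 21 * ℓ ^ 21

  longFor⁻ : ∀ {n ℓ} → LongFor n ℓ → 1 ^ 21 * n ^ 13 ≤ 4 ^ 21 * ℓ ^ 21
  longFor⁻ p = p

  conclusion : ∀ {n k m ℓ} → 1 ≤ n → 1 ≤ m → n ≤ k * (2 * ℓ) → n * m ≤ ℓ * ℓ →
    n ≤ 2 * m * ℓ ⊎ FewLinks k m → LongFor n ℓ
  conclusion {n} {k} {m} {ℓ} n≥1 m≥1 n≤ nm≤ = λ where
      (inj₁ thick) → finish (2 ^ 7) (≤ᵇ⇒≤ (2 ^ 7) (4 ^ 21) tt) (exponents-thick {n} {m} {ℓ} n≥1 thick nm≤)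
      -- 2²⁷ comes from the bound on links, 2⁸ from m + 1 ≤ 2m, and 2⁵ from n ≤ 2kℓ. Together this
      -- is 2⁴⁰, below 4²¹ = 2⁴².
      (inj₂ k≤) → finish (2 ^ 27 * (2 ^ 8 * 2 ^ 5)) (≤ᵇ⇒≤ (2 ^ 27 * (2 ^ 8 * 2 ^ 5)) (4 ^ 21) tt)
        (exponents {n} {k} {m} {ℓ} (2 ^ 27) n≤ (≤-trans (fewLinks⁻ {k} {m} k≤) (*-monoʳ-≤ (2 ^ 27) (^-monoˡ-≤ 8 suc-m≤))) nm≤)
    where
    finish : ∀ c → c ≤ 4 ^ 21 → n ^ 13 ≤ c * ℓ ^ 21 → 1 ^ 21 * n ^ 13 ≤ 4 ^ 21 * ℓ ^ 21
    finish c c≤ le = ≤-trans (≤-reflexive (*-identityˡ (n ^ 13))) (≤-trans le (*-monoˡ-≤ (ℓ ^ 21) c≤))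
    suc-m≤ : suc m ≤ 2 * m
    suc-m≤ = ≤-trans (+-monoˡ-≤ m m≥1) (≤-reflexive (cong (m +_) (sym (+-identityʳ m))))

module _ {n : ℕ} (G : Graph (suc n)) (conn : Connected G) (vt : VertexTransitive G)
         {ℓ : ℕ} (C : Cyc G ℓ) (long : 3 ≤ ℓ) (longest : Longest G ℓ) where
  open VertexTransitiveGraph G conn vt
  open Longest′ long longest
  open Menger {suc n} hiding (V)
  open ≤-Reasoning

  private
    N = suc n
    2ℓ≢0 : NonZero (2 * ℓ)
    2ℓ≢0 = >-nonZero (<-≤-trans (s≤s z≤n) (≤-trans long (m≤m+n ℓ _)))
    instance _ = 2ℓ≢0

  -- Large enough for N ≤ 2kℓ, yet small enough that a cut of fewer than k + m vertices violates
  -- `cut-bound` when 2mℓ < N.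
  k : ℕ
  k = suc (N / (2 * ℓ))

  N≤k2ℓ : N ≤ k * (2 * ℓ)
  N≤k2ℓ = begin
    N                                      ≡⟨ m≡m%n+[m/n]*n N (2 * ℓ) ⟩
    N % (2 * ℓ) + N / (2 * ℓ) * (2 * ℓ)    ≤⟨ +-monoˡ-≤ _ (<⇒≤ (m%n<n N (2 * ℓ))) ⟩
    k * (2 * ℓ)                            ∎

  no-separation : ∀ D → 2 * ∣ common D C ∣ₛ * ℓ < N → Separated D C (k + ∣ common D C ∣ₛ) → ⊥
  no-separation D thin S = <-irrefl refl (begin-strict
      2 * N                                    ≤⟨ *-monoʳ-≤ 2 (cut-bound D C S) ⟩
      2 * (ℓ * ∣ Cut.middle (Separated.cut S) ∣ₛ) ≤⟨ *-monoʳ-≤ 2 (*-monoʳ-≤ ℓ (m<1+n⇒m≤n (Separated.order S))) ⟩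
      2 * (ℓ * (N / (2 * ℓ) + m))              ≡⟨ regroup (N / (2 * ℓ)) ⟩
      N / (2 * ℓ) * (2 * ℓ) + 2 * m * ℓ        <⟨ +-mono-≤-< (m/n*n≤m N (2 * ℓ)) thin ⟩
      N + N                                    ≡⟨ cong (N +_) (+-identityʳ N) ⟨
      2 * N                                    ∎)
    where
    open +-*-Solver
    m = ∣ common D C ∣ₛ
    regroup : ∀ q → 2 * (ℓ * (q + m)) ≡ q * (2 * ℓ) + 2 * m * ℓ
    regroup q = solve 3 (λ l q m → con 2 :* (l :* (q :+ m)) := q :* (con 2 :* l) :+ con 2 :* m :* l) refl ℓ q m

  module _ (σ : Automorphism G)
           (avg : N * length (filter (λ a → Any.any? (Automorphism.to σ a Fin.≟_) (vertexList C)) (vertexList C)) ≤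
                  length (vertexList C) * length (vertexList C)) where
    private
      D = image σ C
      m = ∣ common D C ∣ₛ

    -- A vertex common to `D` and `C` is the image of a vertex of `C` that lands on `C` again, which
    -- is what `avg` counts.
    overlap≤ : N * m ≤ ℓ * ℓ
    overlap≤ = begin
      N * m                                                            ≤⟨ *-monoʳ-≤ N (unique-⊆-length (el-unique (common D C)) sub) ⟩
      N * length (map (Automorphism.to σ) stay)                        ≡⟨ cong (N *_) (length-map (Automorphism.to σ) stay) ⟩
      N * length stay                                                  ≤⟨ avg ⟩
      length (vertexList C) * length (vertexList C)                    ≡⟨ cong₂ _*_ (length-vertexList C) (length-vertexList C) ⟩
      ℓ * ℓ                                                            ∎
      where
      stay = filter (λ a → Any.any? (Automorphism.to σ a Fin.≟_) (vertexList C)) (vertexList C)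
      sub : ∀ {v} → v ∈ el (common D C) → v ∈ map (Automorphism.to σ) stay
      sub {v} v∈ with ∧-true⁻ {on D v} (∈-el⁻ (common D C) v∈)
      ... | d , c with on⁻ D v d | on⁻ C v c
      ... | p , _ , refl | q , _ , eq = ∈-map⁺ (Automorphism.to σ)
            (∈-filter⁺ _ (∈-vertexList⁺ C p) (subst (_∈ vertexList C) (sym eq) (∈-vertexList⁺ C q)))

    thick-or-few : Dec (N ≤ 2 * m * ℓ) → N ≤ 2 * m * ℓ ⊎ FewLinks k m
    thick-or-few (yes thick) = inj₁ thick
    thick-or-few (no thin)   = inj₂ (linked (menger (TwoCycles.edges D C) (TwoCycles.A D C) (TwoCycles.B D C) k))
      where
      linked : Linkage (TwoCycles.edges D C) (TwoCycles.A D C) (TwoCycles.B D C) k ⊎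
               Separation (TwoCycles.edges D C) (TwoCycles.A D C) (TwoCycles.B D C) k → FewLinks k m
      linked (inj₁ l) = TwoCycles.linkage-bound D C l long longest
      linked (inj₂ s) = ⊥-elim (no-separation D (≰⇒> thin) (separated D C s))

    image-conclusion : LongFor N ℓ
    image-conclusion = conclusion {N} {k} {m} {ℓ} (s≤s z≤n) (n≢0⇒n>0 (meet D C)) N≤k2ℓ overlap≤
      (thick-or-few (N ≤? 2 * m * ℓ))

  long-enough : LongFor N ℓ
  long-enough = case Averaging.average G vt (vertexList C) (vertexList C) of λ (σ , avg) → image-conclusion σ avg

someLongCycle : ∀ n → 3 ≤ n → (G : Graph n) → Connected G → VertexTransitive G →
  ∃[ L ] (HasCycleOfLength G L × LongFor n L)
someLongCycle (suc (suc (suc n))) (s≤s (s≤s (s≤s _))) G conn vt with longestCycle G (proj₂ (someCycle G conn vt))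
... | ℓ , cyc , longest = ℓ , cyc , long-enough G conn vt (toCyc cyc) (proj₁ (proj₂ (proj₂ cyc))) longest

theorem1p1 : Σ ℕ λ p → Σ ℕ λ q → 1 ≤ p × 1 ≤ q ×
    ((n : ℕ) → 3 ≤ n → (G : Graph n) → Connected G → VertexTransitive G →
    Σ ℕ λ L → HasCycleOfLength G L × p ^ 21 * n ^ 13 ≤ q ^ 21 * L ^ 21)
-- The constant c is the ratio 1 / 4 of these witnesses.
theorem1p1 = 1 , 4 , s≤s z≤n , s≤s z≤n , λ n n≥3 G conn vt →
  Data.Product.map₂ (Data.Product.map₂ longFor⁻) (someLongCycle n n≥3 G conn vt)
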